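{- Consider the problem: given a planar graph $G$, a family $\mathcal{O}$ of subsets of $V(G)$ each inducing a connected subgraph of $G$, and an integer $k$, decide whether there are $k$ sets in $\mathcal{O}$ whose union is $V(G)$. Assuming SETH, there is no algorithm for this problem with running time $f(k)\cdot(|\mathcal{O}|+|V(G)|)^{k-\epsilon}$ for any computable function $f$ and any $\epsilon>0$.
   Context: SETH (Strong Exponential Time Hypothesis): for every $\epsilon>0$ there is no algorithm solving CNF-SAT on $n$ variables in time $O((2-\epsilon)^n)$ (more precisely: for every $\epsilon>0$ there is $q$ such that $q$-SAT cannot be solved in time $O((2-\epsilon)^n)$). -}

module Defs where

open import Data.Bool using (Bool; true; false; if_then_else_; T)
open import Data.Fin using (Fin; toℕ)
open import Data.Fin.Subset using (Subset; _∈_; Nonempty; ⋃; ⊤)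
open import Data.Fin.Subset.Properties using (_∈?_)
import Data.Fin as Fin
open import Data.Integer using (∣_∣)
open import Data.List using (List; []; _∷_; _++_; [_]; length; map; filter; concatMap; allFin; cartesianProduct)
open import Data.List.Relation.Binary.Sublist.Propositional using (_⊆_)
open import Data.List.Relation.Unary.All using (All)
open import Data.List.Relation.Unary.Any using (Any)
open import Data.List.Relation.Unary.Unique.Propositional using (Unique)
open import Data.Nat using (ℕ; zero; suc; _+_; _*_; _∸_; _^_; _≤_; _≡ᵇ_)
open import Data.Nat.Logarithm using (⌊log₂_⌋)
open import Data.Product using (∃-syntax; _×_; _,_; proj₁; proj₂)
open import Data.Rational as ℚ using (ℚ; 0ℚ; 1ℚ; ↥_; ↧ₙ_)
open import Data.Sum using (_⊎_)
open import Data.Unit using () renaming (⊤ to Unit)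
open import Data.Empty using () renaming (⊥ to Empty)
open import Relation.Binary.Construct.Closure.ReflexiveTransitive using (Star)
open import Relation.Binary.PropositionalEquality using (_≡_; _≢_)
open import Relation.Nullary using (¬_; Dec; _×-dec_)
open import Relation.Nullary.Decidable using (T?)

------------------------------------------------------------------------
-- Algorithms: deterministic random access machines with the logarithmic
-- cost criterion, written as structured programs.
--
-- A program uses finitely many registers and finitely many memories
-- (arrays), all holding natural numbers and all addressable indirectly
-- through registers.  Every step costs the total binary length of the
-- numbers and addresses it reads.  Up to polylogarithmic factors this is
-- the same time measure as unit cost on a RAM with logarithmic word size,
-- and all bounds below quantify over every ε > 0, which absorbs such
-- factors.

infixl 5 _⨾_
infix  6 _:=#_ _:=_⊕_ _:=_⊖_ _:=_[_] _[_]:=_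

data Program : Set where
  skip        : Program
  _:=#_       : (x c : ℕ) → Program
  _:=_⊕_      : (x y z : ℕ) → Program
  _:=_⊖_      : (x y z : ℕ) → Program
  _:=_[_]     : (x a y : ℕ) → Program
  _[_]:=_     : (a x y : ℕ) → Program
  _⨾_         : Program → Program → Program
  ifnz_then_else_ : (x : ℕ) → Program → Program → Program
  whilenz_loop_ : (x : ℕ) → Program → Program

record State : Set where
  constructor ⟪_,_⟫
  field
    reg : ℕ → ℕ
    mem : ℕ → ℕ → ℕ

open State public

_[_↦_] : {A : Set} → (ℕ → A) → ℕ → A → (ℕ → A)
(f [ i ↦ a ]) j = if i ≡ᵇ j then a else f j

len : ℕ → ℕ
len m = suc ⌊log₂ m ⌋

infix 4 _∶_⟶[_]_

-- c ∶ s ⟶[ t ] s′ : started in s, the program c halts in s′ at total cost t.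
data _∶_⟶[_]_ : Program → State → ℕ → State → Set where
  skip  : ∀ {s} → skip ∶ s ⟶[ 1 ] s
  const : ∀ {r m x c} →
          x :=# c ∶ ⟪ r , m ⟫ ⟶[ len c ] ⟪ r [ x ↦ c ] , m ⟫
  add   : ∀ {r m x y z} →
          x := y ⊕ z ∶ ⟪ r , m ⟫
            ⟶[ len (r y) + len (r z) ] ⟪ r [ x ↦ r y + r z ] , m ⟫
  sub   : ∀ {r m x y z} →
          x := y ⊖ z ∶ ⟪ r , m ⟫
            ⟶[ len (r y) + len (r z) ] ⟪ r [ x ↦ r y ∸ r z ] , m ⟫
  load  : ∀ {r m x a y} →
          x := a [ y ] ∶ ⟪ r , m ⟫
            ⟶[ len (r y) + len (m a (r y)) ] ⟪ r [ x ↦ m a (r y) ] , m ⟫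
  store : ∀ {r m a x y} →
          a [ x ]:= y ∶ ⟪ r , m ⟫
            ⟶[ len (r x) + len (r y) ] ⟪ r , m [ a ↦ m a [ r x ↦ r y ] ] ⟫
  seq   : ∀ {c d s₁ s₂ s₃ t u} →
          c ∶ s₁ ⟶[ t ] s₂ → d ∶ s₂ ⟶[ u ] s₃ →
          c ⨾ d ∶ s₁ ⟶[ t + u ] s₃
  if-nz : ∀ {x c d s s′ t} → reg s x ≢ 0 → c ∶ s ⟶[ t ] s′ →
          ifnz x then c else d ∶ s ⟶[ len (reg s x) + t ] s′
  if-z  : ∀ {x c d s s′ t} → reg s x ≡ 0 → d ∶ s ⟶[ t ] s′ →
          ifnz x then c else d ∶ s ⟶[ len (reg s x) + t ] s′
  while-nz : ∀ {x c s₁ s₂ s₃ t u} → reg s₁ x ≢ 0 →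
          c ∶ s₁ ⟶[ t ] s₂ → whilenz x loop c ∶ s₂ ⟶[ u ] s₃ →
          whilenz x loop c ∶ s₁ ⟶[ len (reg s₁ x) + (t + u) ] s₃
  while-z  : ∀ {x c s} → reg s x ≡ 0 →
          whilenz x loop c ∶ s ⟶[ len (reg s x) ] s

contents : List ℕ → ℕ → ℕ
contents []       _       = 0
contents (x ∷ _)  zero    = x
contents (_ ∷ xs) (suc i) = contents xs i

-- The input word is in memory 0, its length in register 0; everything
-- else is zero.  The output is read from register 0.
initial : List ℕ → State
initial w = ⟪ (λ _ → 0) [ 0 ↦ length w ] , (λ _ _ → 0) [ 0 ↦ contents w ] ⟫

Outputs : Program → List ℕ → ℕ → ℕ → Set
Outputs A w out t = ∃[ s ] A ∶ initial w ⟶[ t ] s × reg s 0 ≡ out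

Computable : (ℕ → ℕ) → Set
Computable f = ∃[ A ] (∀ m → ∃[ t ] Outputs A [ m ] (f m) t)

record Problem : Set₁ where
  field
    Instance : Set
    encode   : Instance → List ℕ
    Yes      : Instance → Set

-- A answers every instance correctly, and its running times on the
-- instances I satisfy the bound B I.
Decides_by_within_ : (P : Problem) → Program → (Problem.Instance P → ℕ → Set) → Set
Decides P by A within B =
  ∀ I → ∃[ t ] B I t ×
    ((Yes I × Outputs A (encode I) 1 t) ⊎ (¬ Yes I × Outputs A (encode I) 0 t))
  where open Problem P

------------------------------------------------------------------------
-- q-SAT and SETH

Literal : ℕ → Set
Literal n = Fin n × Bool

Clause : ℕ → Set
Clause n = List (Literal n)

-- A formula is a set of clauses, so clauses are not repeated.  This keeps
-- the number of clauses polynomial in n for fixed q, without which a time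
-- bound in terms of n alone would be meaningless.
record CNF (q : ℕ) : Set where
  field
    n        : ℕ
    clauses  : List (Clause n)
    distinct : Unique clauses
    width    : All (λ C → length C ≤ q) clauses

Satisfies : ∀ {n} → (Fin n → Bool) → Clause n → Set
Satisfies α = Any (λ ℓ → α (proj₁ ℓ) ≡ proj₂ ℓ)

encodeLiteral : ∀ {n} → Literal n → ℕ
encodeLiteral (v , b) = 2 * toℕ v + (if b then 1 else 0)

encodeCNF : ∀ {q} → CNF q → List ℕ
encodeCNF φ =
  n ∷ length clauses ∷
    concatMap (λ C → length C ∷ map encodeLiteral C) clauses
  where open CNF φ

Satisfiable : ∀ {q} → CNF q → Set
Satisfiable φ = ∃[ α ] All (Satisfies {n} α) clauses
  where open CNF φ

_-SAT : ℕ → Problem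
q -SAT = record
  { Instance = CNF q
  ; encode   = encodeCNF
  ; Yes      = Satisfiable
  }

-- t ≤ C · (2 − ε)^n, denominators cleared.  The truncation for ε > 2 is
-- harmless: the bound then says t ≤ 0 for n ≥ 1, and every run costs at
-- least 1.
_≤_·[2−_]^_ : ℕ → ℕ → ℚ → ℕ → Set
t ≤ C ·[2− ε ]^ n = t * ↧ₙ ε ^ n ≤ C * (2 * ↧ₙ ε ∸ ∣ ↥ ε ∣) ^ n

-- Restricting to rational ε here and below loses nothing, since the bounds
-- are monotone in ε.
SETH : Set
SETH = ∀ (ε : ℚ) → 0ℚ ℚ.< ε →
  ∃[ q ] ¬ (∃[ A ] ∃[ C ] ∃[ n₀ ]
    Decides (q -SAT) by A within
      λ φ t → n₀ ≤ CNF.n φ → t ≤ C ·[2− ε ]^ CNF.n φ)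

------------------------------------------------------------------------
-- Planar graphs

-- Finite simple graphs on the vertex set Fin n.
record Graph (n : ℕ) : Set where
  field
    adj    : Fin n → Fin n → Bool
    sym    : ∀ u v → adj u v ≡ adj v u
    irrefl : ∀ v → adj v v ≡ false

  Adj : Fin n → Fin n → Set
  Adj u v = T (adj u v)

  -- Each undirected edge is listed once, smaller endpoint first.
  Edge : Fin n × Fin n → Set
  Edge (u , v) = u Fin.< v × Adj u v

  Edge? : ∀ e → Dec (Edge e)
  Edge? (u , v) = (u Fin.<? v) ×-dec T? (adj u v)

  edges : List (Fin n × Fin n)
  edges = filter Edge? (cartesianProduct (allFin n) (allFin n))

Point : Set
Point = ℚ × ℚ

OnSegment : Point → Point → Point → Set
OnSegment (x , y) (x₀ , y₀) (x₁ , y₁) =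
  ∃[ s ] 0ℚ ℚ.≤ s × s ℚ.≤ 1ℚ
    × x ≡ x₀ ℚ.+ s ℚ.* (x₁ ℚ.- x₀)
    × y ≡ y₀ ℚ.+ s ℚ.* (y₁ ℚ.- y₀)

-- A list of points stands for the polygonal curve through them in order.
OnCurve : Point → List Point → Set
OnCurve p []           = Empty
OnCurve p (a ∷ [])     = p ≡ a
OnCurve p (a ∷ b ∷ ps) = OnSegment p a b ⊎ OnCurve p (b ∷ ps)

IsArc : List Point → Set
IsArc []           = Empty
IsArc (a ∷ [])     = Unit
IsArc (a ∷ b ∷ ps) =
  a ≢ b × (∀ p → OnSegment p a b → OnCurve p (b ∷ ps) → p ≡ b) × IsArc (b ∷ ps)

-- A plane drawing: vertices are distinct points, edges are simple
-- polygonal arcs between their endpoints, and the interior of an arc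
-- contains no vertex and no point of another arc.  Rational coordinates
-- suffice because a drawing can be perturbed, and segments with rational
-- endpoints that meet do so in a rational point.
record PlaneDrawing {n} (G : Graph n) : Set where
  open Graph G
  field
    position  : Fin n → Point
    bends     : Fin n × Fin n → List Point

  curve : Fin n × Fin n → List Point
  curve (u , v) = position u ∷ bends (u , v) ++ [ position v ]

  field
    injective : ∀ {u v} → position u ≡ position v → u ≡ v
    arcs      : ∀ {e} → Edge e → IsArc (curve e)
    avoids    : ∀ {u v} → Edge (u , v) → ∀ w →
                OnCurve (position w) (curve (u , v)) → w ≡ u ⊎ w ≡ v
    disjoint  : ∀ {e e′} → Edge e → Edge e′ → e ≢ e′ → ∀ p →
                OnCurve p (curve e) → OnCurve p (curve e′) →
                ∃[ w ] p ≡ position w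

Planar : ∀ {n} → Graph n → Set
Planar = PlaneDrawing

-- S induces a connected subgraph; the graph without vertices is not
-- regarded as connected.
InducesConnected : ∀ {n} → Graph n → Subset n → Set
InducesConnected G S =
  Nonempty S ×
  (∀ {u v} → u ∈ S → v ∈ S → Star (λ x y → x ∈ S × y ∈ S × Adj x y) u v)
  where open Graph G

------------------------------------------------------------------------
-- Covering the vertices of a planar graph by connected sets

record CoverInstance : Set where
  field
    n         : ℕ
    graph     : Graph n
    planar    : Planar graph
    family    : List (Subset n)
    distinct  : Unique family
    connected : All (InducesConnected graph) family
    k         : ℕ

  size : ℕ
  size = length family + n

encodeSubset : ∀ {n} → Subset n → List ℕ
encodeSubset {n} S = length members ∷ map toℕ members
  where members = filter (_∈? S) (allFin n)

encodeCover : CoverInstance → List ℕ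
encodeCover I =
  k ∷ n ∷ length edges ∷
    concatMap (λ (u , v) → toℕ u ∷ toℕ v ∷ []) edges
    ++ length family ∷ concatMap encodeSubset family
  where
  open CoverInstance I
  open Graph graph

-- The family has distinct members, so a sublist of length k is exactly a
-- choice of k sets from it.
HasCover : CoverInstance → Set
HasCover I = ∃[ 𝒮 ] 𝒮 ⊆ family × length 𝒮 ≡ k × ⋃ 𝒮 ≡ ⊤
  where open CoverInstance I

ConnectedCover : Problem
ConnectedCover = record
  { Instance = CoverInstance
  ; encode   = encodeCover
  ; Yes      = HasCover
  }

-- t ≤ c · N^(k − ε): with ε = p / d, raised to the power d and multiplied
-- by N^p.  For N = 0, where the power need not make sense, nothing is
-- demanded.
_≤_·_^[_−_] : ℕ → ℕ → ℕ → ℕ → ℚ → Set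
t ≤ c · N ^[ k − ε ] =
  t ^ ↧ₙ ε * N ^ ∣ ↥ ε ∣ ≤ c ^ ↧ₙ ε * N ^ (k * ↧ₙ ε)

{-# OPTIONS --safe #-}
-- Split the n variables of a q-CNF formula into k groups of s = ⌊n/k⌋ + 1 variables.  Every assignment of a
-- group becomes a set, consisting of the clauses that it satisfies, so that k sets, one from each group, cover all
-- clauses iff the formula is satisfiable.  Adding a centre that lies in every set, adjacent to all clauses, makes
-- the graph a star, hence planar, and the sets connected.  Further tautological clauses force the k sets to
-- come from different groups and make the sets distinct.  Since there are at most (2n + 1)^q clauses, the instance
-- has size O(2^s), and time N^(k − ε) on it is time 2^(n (1 − ε/k)) up to a constant.  As k is fixed, f(k) is a
-- constant too, and for k ≥ 16 a construction of the instance in time O(2^(8 s)) is negligible.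
--
-- The construction is carried out by an explicit machine program.  It suffices to count its steps: T steps from
-- a state with entries of length at most L cost at most 2 T (L + T + 1), because a step at most doubles the
-- largest entry.  The assumed algorithm then runs on registers and memories disjoint from those of the construction.

module Submission where

open import Defs
open import Data.Bool using (Bool; true; false; if_then_else_; T; _∨_; _∧_)
open import Data.Fin as Fin using (Fin; zero; suc; toℕ; fromℕ<; combine)
open import Data.Fin.Properties using (toℕ-injective; toℕ<n; toℕ-fromℕ<; injective⇒≤; combine-injective)
open import Data.Fin.Subset as Subset using (Subset; ⋃; ⊤)
open import Data.Fin.Subset.Properties as Subset using (_∈?_)
open import Data.Integer as ℤ using (∣_∣)
import Data.Integer.Properties as ℤₚ
open import Data.List as List using (List; []; _∷_; _++_; [_]; length; map; concatMap; replicate; downFrom; filter; tabulate; allFin; cartesianProduct)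
open import Data.List.Membership.Propositional using (_∈_; lose; find)
open import Data.List.Membership.Propositional.Properties
open import Data.List.Properties using (length-++; ++-assoc; ++-identityʳ; length-replicate; length-map; length-downFrom; length-tabulate; concatMap-++; concatMap-map; concatMap-cong; filter-++; filter-all; filter-none; map-++; map-tabulate)
open import Data.List.Relation.Binary.Sublist.Propositional as Sublist using (_⊆_; [])
import Data.List.Relation.Binary.Sublist.Propositional.Properties as Sublist
open import Data.List.Relation.Unary.All as All using (All; []; _∷_)
import Data.List.Relation.Unary.All.Properties as All
open import Data.List.Relation.Unary.Any using (Any; here; there)
open import Data.List.Relation.Unary.Unique.Propositional using (Unique; []; _∷_)
open import Data.List.Relation.Unary.Unique.Propositional.Properties using (downFrom⁺; cartesianProduct⁺)
open import Data.Nat using (ℕ; zero; suc; pred; _+_; _*_; _∸_; _^_; _≤_; _<_; _≡ᵇ_; _⊔_; _<?_; z≤n; s≤s; NonZero; _/_; _%_; >-nonZero; >-nonZero⁻¹)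
open import Data.Nat.Coprimality using (1-coprimeTo)
open import Data.Nat.Divisibility using (n∣m*n)
open import Data.Nat.DivMod using (m≡m%n+[m/n]*n; m%n<n; m/n*n≤m; m<n*o⇒m/o<n; +-distrib-/-∣ˡ; m*n/n≡m; m<n⇒m/n≡0; [m+kn]%n≡m%n; m<n⇒m%n≡m)
open import Data.Nat.ListAction using (sum)
open import Data.Nat.Logarithm using (⌊log₂_⌋; ⌊log₂⌋-mono-≤; ⌊log₂[2^n]⌋≡n)
open import Data.Nat.Properties
open import Data.Nat.Solver using (module +-*-Solver)
open import Data.Product using (Σ; ∃-syntax; _×_; _,_; proj₁; proj₂; uncurry)
open import Data.Rational as ℚ using (ℚ; 0ℚ; 1ℚ; mkℚ; ↥_; ↧ₙ_)
import Data.Rational.Properties as ℚₚ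
open import Data.Rational.Literals using (fromℤ)
open import Data.Sum using (_⊎_; inj₁; inj₂)
open import Data.Unit using (tt)
open import Data.Vec as Vec using (Vec; []; _∷_; here; there; lookup; fromList)
open import Data.Vec.Properties using (lookup∘tabulate; tabulate∘lookup; tabulate-cong; []=⇒lookup; lookup⇒[]=)
open import Function using (_∘_; id)
open import Relation.Binary.Construct.Closure.ReflexiveTransitive using (Star; _◅_) renaming (ε to stay)
open import Relation.Binary.PropositionalEquality using (_≡_; _≢_; refl; sym; trans; cong; cong₂; subst; subst₂; module ≡-Reasoning)
open import Relation.Nullary using (¬_; yes; no; contradiction)

-- Write ε = p/d and e = k·d. An instance of size about 2^(n/k) is solved in time about 2^(n (1 -
-- p/e)), and Bernoulli's inequality gives 2^(1 - 1/e) ≤ 2 - 1/e, so SETH is contradicted at 1/e.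
-- This number depends on k and ε only. That matters because SETH supplies q only after 1/e is
-- fixed: q may enter the constants, but neither k nor e. The constants 8 and 16: the program nests
-- four loops (groups, assignments of a group, clauses, literals), each of at most Z = O(2^s)
-- rounds, so it makes O(Z^4) steps. Numbers may grow by one bit per step, so the cost is quadratic
-- in the number of steps, O(Z^8). As s is about n/k, k ≥ 16 gives 2^(8 s) = O(2^(n/2)), and √2 ≤ 2
-- - 1/e for e ≥ 2. Real exponents are avoided throughout: both sides are raised to a power, d or 2,
-- that clears the root, and the power is cancelled at the end.

-- Inequalities between powers

^-cancelˡ-≤ : ∀ {a b} d .{{_ : NonZero d}} → a ^ d ≤ b ^ d → a ≤ b
^-cancelˡ-≤ d a^d≤b^d = ≮⇒≥ (λ b<a → <⇒≱ (^-monoˡ-< d b<a) a^d≤b^d)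

^-distribʳ-* : ∀ o m n → (m * n) ^ o ≡ m ^ o * n ^ o
^-distribʳ-* zero    m n = refl
^-distribʳ-* (suc o) m n = trans (cong (m * n *_) (^-distribʳ-* o m n))
  (solve 4 (λ m n p q → m :* n :* (p :* q) := m :* p :* (n :* q)) refl m n (m ^ o) (n ^ o))
  where open +-*-Solver using (solve; _:=_; _:*_)

n<2^n : ∀ n → n < 2 ^ n
n<2^n zero    = s≤s z≤n
n<2^n (suc n) = +-mono-≤-< (>-nonZero⁻¹ (2 ^ n) {{m^n≢0 2 n}}) (≤-trans (n<2^n n) (m≤m+n _ 0))

-- Division by q spreads the exponential: `suc s` is at most q · 2^(s / q), and the q-th power of
-- the last factor is at most 2^s. It turns a polynomial number of clauses into O(2^S).
pow≤exp : ∀ q → ∃[ c ] ∀ s → suc s ^ q ≤ c * 2 ^ s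
pow≤exp zero = 1 , λ s → ≤-trans (m^n>0 2 s) (m≤m+n _ 0)
pow≤exp q@(suc _) = q ^ q , λ s → begin
  suc s ^ q                    ≤⟨ ^-monoˡ-≤ q (base s) ⟩
  (q * 2 ^ (s / q)) ^ q        ≡⟨ ^-distribʳ-* q q (2 ^ (s / q)) ⟩
  q ^ q * (2 ^ (s / q)) ^ q    ≡⟨ cong (q ^ q *_) (^-*-assoc 2 (s / q) q) ⟩
  q ^ q * 2 ^ (s / q * q)      ≤⟨ *-monoʳ-≤ (q ^ q) (^-monoʳ-≤ 2 (m/n*n≤m s q)) ⟩
  q ^ q * 2 ^ s                ∎
  where
  open ≤-Reasoning
  base : ∀ s → suc s ≤ q * 2 ^ (s / q)
  base s = begin
    suc s                     ≡⟨ cong suc (m≡m%n+[m/n]*n s q) ⟩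
    suc (s % q) + s / q * q   ≤⟨ +-monoˡ-≤ (s / q * q) (m%n<n s q) ⟩
    suc (s / q) * q           ≤⟨ *-monoˡ-≤ q (n<2^n (s / q)) ⟩
    2 ^ (s / q) * q           ≡⟨ *-comm (2 ^ (s / q)) q ⟩
    q * 2 ^ (s / q)           ∎

-- Bernoulli's inequality (1 − 1/x)^j ≥ 1 − j/x for x = y + 1.
bernoulli : ∀ y j a → a + j ≡ suc y → suc y ^ j * a ≤ y ^ j * suc y
bernoulli y zero    a e = *-monoʳ-≤ 1 (≤-reflexive (trans (sym (+-identityʳ a)) e))
bernoulli y (suc j) a e = begin
  suc y * suc y ^ j * a       ≡⟨ *-assoc (suc y) (suc y ^ j) a ⟩
  suc y * (suc y ^ j * a)     ≡⟨ solve 3 (λ y p a → (con 1 :+ y) :* (p :* a) := p :* (a :+ y :* a)) refl y (suc y ^ j) a ⟩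
  suc y ^ j * (a + y * a)     ≤⟨ *-monoʳ-≤ (suc y ^ j) (+-monoˡ-≤ (y * a) a≤y) ⟩
  suc y ^ j * (y + y * a)     ≡⟨ solve 3 (λ y p a → p :* (y :+ y :* a) := y :* (p :* (con 1 :+ a))) refl y (suc y ^ j) a ⟩
  y * (suc y ^ j * suc a)     ≤⟨ *-monoʳ-≤ y (bernoulli y j (suc a) (trans (sym (+-suc a j)) e)) ⟩
  y * (y ^ j * suc y)         ≡⟨ sym (*-assoc y (y ^ j) (suc y)) ⟩
  y * y ^ j * suc y           ∎
  where
  open ≤-Reasoning
  open +-*-Solver using (solve; _:=_; _:+_; _:*_; con)
  a≤y : a ≤ y
  a≤y = ≤-trans (m≤m+n a j) (≤-reflexive (suc-injective (trans (sym (+-suc a j)) e)))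

suc-2e∸1 : ∀ e .{{_ : NonZero e}} → suc (2 * e ∸ 1) ≡ 2 * e
suc-2e∸1 (suc e) = refl

-- Bernoulli's inequality for x = 2e and j = e says (1 - 1/(2e))^e ≥ 1/2. Equivalently 2^(1 - 1/e) ≤
-- 2 - 1/e, which converts a saved factor into a smaller base.
2e^e≤ : ∀ e .{{_ : NonZero e}} → (2 * e) ^ e ≤ 2 * (2 * e ∸ 1) ^ e
2e^e≤ e = *-cancelʳ-≤ _ _ e (begin
  (2 * e) ^ e * e                  ≡⟨ cong (λ x → x ^ e * e) (sym (suc-2e∸1 e)) ⟩
  suc (2 * e ∸ 1) ^ e * e          ≤⟨ bernoulli (2 * e ∸ 1) e e (trans (cong (e +_) (sym (+-identityʳ e))) (sym (suc-2e∸1 e))) ⟩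
  (2 * e ∸ 1) ^ e * suc (2 * e ∸ 1) ≡⟨ cong ((2 * e ∸ 1) ^ e *_) (suc-2e∸1 e) ⟩
  (2 * e ∸ 1) ^ e * (2 * e)        ≡⟨ solve 2 (λ p e → p :* (con 2 :* e) := con 2 :* p :* e) refl ((2 * e ∸ 1) ^ e) e ⟩
  2 * (2 * e ∸ 1) ^ e * e          ∎)
  where
  open ≤-Reasoning
  open +-*-Solver using (solve; _:=_; _:+_; _:*_; con)

-- This is √2 ≤ 2 - 1/e with root and denominator cleared; it fails for e = 1.
2e²≤ : ∀ e → 2 ≤ e → 2 * (e * e) ≤ (2 * e ∸ 1) * (2 * e ∸ 1)
2e²≤ e@(suc (suc i)) (s≤s (s≤s z≤n)) = begin
  2 * (e * e)                                  ≤⟨ m≤m+n _ (2 * (i * i) + 4 * i + 1) ⟩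
  2 * (e * e) + (2 * (i * i) + 4 * i + 1)      ≡⟨ solve 1 (λ i → let e = con 2 :+ i ; y = con 1 :+ i :+ (con 2 :+ i :+ con 0) in
                                                   con 2 :* (e :* e) :+ (con 2 :* (i :* i) :+ con 4 :* i :+ con 1) := y :* y) refl i ⟩
  (2 * e ∸ 1) * (2 * e ∸ 1)                    ∎
  where
  open ≤-Reasoning
  open +-*-Solver using (solve; _:=_; _:+_; _:*_; con)

-- The reduction is fast: 8 groups out of k ≥ 16 contribute at most half of the exponent n.
preprocessing-≤ : ∀ {k n S e} → 16 ≤ k → 2 ≤ e → S * k ≤ n + k →
                  2 ^ (8 * S) * e ^ n ≤ 2 ^ k * (2 * e ∸ 1) ^ n
-- Squaring turns 2^(8 S) into 2^(16 S), which k ≥ 16 bounds by 2^(n + k).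
preprocessing-≤ {k} {n} {S} {e} 16≤k 2≤e Sk≤ = ^-cancelˡ-≤ 2 (begin
  (2 ^ (8 * S) * e ^ n) ^ 2              ≡⟨ ^-distribʳ-* 2 (2 ^ (8 * S)) (e ^ n) ⟩
  (2 ^ (8 * S)) ^ 2 * (e ^ n) ^ 2        ≡⟨ cong₂ _*_ (^-*-assoc 2 (8 * S) 2) (swap e) ⟩
  2 ^ (8 * S * 2) * (e * e) ^ n          ≤⟨ *-monoˡ-≤ ((e * e) ^ n) (^-monoʳ-≤ 2 exponent) ⟩
  2 ^ (n + k) * (e * e) ^ n              ≡⟨ cong (_* (e * e) ^ n) (^-distribˡ-+-* 2 n k) ⟩
  2 ^ n * 2 ^ k * (e * e) ^ n            ≡⟨ solve 3 (λ a b c → a :* b :* c := b :* (a :* c)) refl (2 ^ n) (2 ^ k) ((e * e) ^ n) ⟩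
  2 ^ k * (2 ^ n * (e * e) ^ n)          ≡⟨ cong (2 ^ k *_) (sym (^-distribʳ-* n 2 (e * e))) ⟩
  2 ^ k * (2 * (e * e)) ^ n              ≤⟨ *-monoʳ-≤ (2 ^ k) (^-monoˡ-≤ n (2e²≤ e 2≤e)) ⟩
  2 ^ k * (y * y) ^ n                    ≡⟨ cong (2 ^ k *_) (sym (swap y)) ⟩
  2 ^ k * (y ^ n) ^ 2                    ≤⟨ *-monoˡ-≤ ((y ^ n) ^ 2) (m≤m*n (2 ^ k) (2 ^ k * 1) {{m*n≢0 (2 ^ k) 1 {{m^n≢0 2 k}}}}) ⟩
  (2 ^ k) ^ 2 * (y ^ n) ^ 2              ≡⟨ sym (^-distribʳ-* 2 (2 ^ k) (y ^ n)) ⟩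
  (2 ^ k * y ^ n) ^ 2                    ∎)
  where
  open ≤-Reasoning
  open +-*-Solver using (solve; _:=_; _:+_; _:*_; con)
  y = 2 * e ∸ 1
  swap : ∀ x → (x ^ n) ^ 2 ≡ (x * x) ^ n
  swap x = trans (cong (x ^ n *_) (*-identityʳ (x ^ n))) (sym (^-distribʳ-* n x x))
  exponent : 8 * S * 2 ≤ n + k
  exponent = begin
    8 * S * 2  ≡⟨ solve 1 (λ s → con 8 :* s :* con 2 := s :* con 16) refl S ⟩
    S * 16     ≤⟨ *-monoʳ-≤ S 16≤k ⟩
    S * k      ≤⟨ Sk≤ ⟩
    n + k      ∎

-- `2e^e≤` controls only exponents that are multiples of e. So n·d is filled up by j·d to e·S, and
-- the extra factors, where 2e - 1 is at most 2e, are cancelled again.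
x^nd≤ : ∀ {k n S} d .{{_ : NonZero k}} .{{_ : NonZero d}} → n ≤ S * k →
        let e = k * d in (2 * e) ^ (n * d) ≤ 2 ^ S * (2 * e ∸ 1) ^ (n * d)
x^nd≤ {k} {n} {S} d n≤ with m≤n⇒∃[o]m+o≡n n≤
... | j , n+j≡ = *-cancelʳ-≤ _ _ (x ^ (j * d)) {{m^n≢0 x (j * d) {{m*n≢0 2 e}}}} (begin
  x ^ (n * d) * x ^ (j * d)            ≡⟨ sym (^-distribˡ-+-* x (n * d) (j * d)) ⟩
  x ^ (n * d + j * d)                  ≡⟨ cong (x ^_) exponent ⟩
  x ^ (e * S)                          ≡⟨ sym (^-*-assoc x e S) ⟩
  (x ^ e) ^ S                          ≤⟨ ^-monoˡ-≤ S (2e^e≤ e) ⟩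
  (2 * y ^ e) ^ S                      ≡⟨ ^-distribʳ-* S 2 (y ^ e) ⟩
  2 ^ S * (y ^ e) ^ S                  ≡⟨ cong (2 ^ S *_) (trans (^-*-assoc y e S) (cong (y ^_) (sym exponent))) ⟩
  2 ^ S * y ^ (n * d + j * d)          ≡⟨ cong (2 ^ S *_) (^-distribˡ-+-* y (n * d) (j * d)) ⟩
  2 ^ S * (y ^ (n * d) * y ^ (j * d))  ≤⟨ *-monoʳ-≤ (2 ^ S) (*-monoʳ-≤ (y ^ (n * d)) (^-monoˡ-≤ (j * d) (m∸n≤m x 1))) ⟩
  2 ^ S * (y ^ (n * d) * x ^ (j * d))  ≡⟨ sym (*-assoc (2 ^ S) (y ^ (n * d)) (x ^ (j * d))) ⟩
  2 ^ S * y ^ (n * d) * x ^ (j * d)    ∎)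
  where
  open ≤-Reasoning
  open +-*-Solver using (solve; _:=_; _:+_; _:*_; con)
  e = k * d
  x = 2 * e
  y = 2 * e ∸ 1
  instance _ = m*n≢0 k d
  exponent : n * d + j * d ≡ e * S
  exponent = trans (sym (*-distribʳ-+ d n j)) (trans (cong (_* d) n+j≡)
    (solve 3 (λ s k d → s :* k :* d := k :* d :* s) refl S k d))

-- The running time N^(k − p/d) on an instance of size N ≈ 2^S turns into (2 − 1/e)^n for e = k·d.
solving-≤ : ∀ {k n S N F p t c} d .{{_ : NonZero k}} .{{_ : NonZero d}} → n ≤ S * k → S * k ≤ n + k →
  1 ≤ p → p ≤ k * d → 1 ≤ N → N ≤ F * 2 ^ S → t ^ d * N ^ p ≤ c ^ d * N ^ (k * d) →
  let e = k * d in t * e ^ n ≤ (c ^ d * F ^ (e ∸ p) * 2 ^ (k * d)) * (2 * e ∸ 1) ^ n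
solving-≤ {k} {n} {S} {N} {F} {p} {t} {c} d n≤ Sk≤ 1≤p p≤ 1≤N N≤ bound = ^-cancelˡ-≤ d (begin
  (t * e ^ n) ^ d                    ≡⟨ trans (^-distribʳ-* d t (e ^ n)) (cong (t ^ d *_) (^-*-assoc e n d)) ⟩
  t ^ d * e ^ (n * d)                ≤⟨ *-cancelˡ-≤ (2 ^ (n * d)) {{m^n≢0 2 (n * d)}} main ⟩
  G * y ^ (n * d)                    ≤⟨ *-monoˡ-≤ (y ^ (n * d)) (G≤G^d G d) ⟩
  G ^ d * y ^ (n * d)                ≡⟨ sym (trans (^-distribʳ-* d G (y ^ n)) (cong (G ^ d *_) (^-*-assoc y n d))) ⟩
  (G * y ^ n) ^ d                    ∎)
  where
  open ≤-Reasoning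
  open +-*-Solver using (solve; _:=_; _:+_; _:*_; con)
  e = k * d
  y = 2 * e ∸ 1
  r = e ∸ p
  G = c ^ d * F ^ r * 2 ^ (k * d)

  G≤G^d : ∀ G d .{{_ : NonZero d}} → G ≤ G ^ d
  G≤G^d zero    d       = z≤n
  G≤G^d (suc g) (suc d) = m≤m*n (suc g) (suc g ^ d) {{m^n≢0 (suc g) d}}

  -- With N^p cancelled, N occurs only on the right, so that from here on an upper bound on the
  -- instance size suffices.
  t^d≤ : t ^ d ≤ c ^ d * N ^ r
  t^d≤ = *-cancelʳ-≤ _ _ (N ^ p) {{m^n≢0 N p {{>-nonZero 1≤N}}}} (begin
    t ^ d * N ^ p             ≤⟨ bound ⟩
    c ^ d * N ^ e             ≡⟨ cong (λ z → c ^ d * N ^ z) (sym (m∸n+n≡m p≤)) ⟩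
    c ^ d * N ^ (r + p)       ≡⟨ cong (c ^ d *_) (^-distribˡ-+-* N r p) ⟩
    c ^ d * (N ^ r * N ^ p)   ≡⟨ sym (*-assoc (c ^ d) (N ^ r) (N ^ p)) ⟩
    c ^ d * N ^ r * N ^ p     ∎)

  saved : t ^ d * 2 ^ (S * p) ≤ G * 2 ^ (n * d)
  saved = begin
    t ^ d * 2 ^ (S * p)                           ≤⟨ *-monoˡ-≤ (2 ^ (S * p)) t^d≤ ⟩
    c ^ d * N ^ r * 2 ^ (S * p)                   ≤⟨ *-monoˡ-≤ (2 ^ (S * p)) (*-monoʳ-≤ (c ^ d) (^-monoˡ-≤ r N≤)) ⟩
    c ^ d * (F * 2 ^ S) ^ r * 2 ^ (S * p)         ≡⟨ cong (λ z → c ^ d * z * 2 ^ (S * p)) (trans (^-distribʳ-* r F (2 ^ S)) (cong (F ^ r *_) (^-*-assoc 2 S r))) ⟩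
    c ^ d * (F ^ r * 2 ^ (S * r)) * 2 ^ (S * p)   ≡⟨ solve 4 (λ a b u v → a :* (b :* u) :* v := a :* b :* (u :* v)) refl (c ^ d) (F ^ r) (2 ^ (S * r)) (2 ^ (S * p)) ⟩
    c ^ d * F ^ r * (2 ^ (S * r) * 2 ^ (S * p))   ≡⟨ cong (c ^ d * F ^ r *_) (sym (^-distribˡ-+-* 2 (S * r) (S * p))) ⟩
    c ^ d * F ^ r * 2 ^ (S * r + S * p)           ≤⟨ *-monoʳ-≤ (c ^ d * F ^ r) (^-monoʳ-≤ 2 exponent) ⟩
    c ^ d * F ^ r * 2 ^ (k * d + n * d)           ≡⟨ trans (cong (c ^ d * F ^ r *_) (^-distribˡ-+-* 2 (k * d) (n * d))) (sym (*-assoc (c ^ d * F ^ r) (2 ^ (k * d)) (2 ^ (n * d)))) ⟩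
    G * 2 ^ (n * d)                               ∎
    where
    exponent : S * r + S * p ≤ k * d + n * d
    exponent = begin
      S * r + S * p   ≡⟨ trans (sym (*-distribˡ-+ S r p)) (cong (S *_) (m∸n+n≡m p≤)) ⟩
      S * (k * d)     ≡⟨ sym (*-assoc S k d) ⟩
      S * k * d       ≤⟨ *-monoˡ-≤ d Sk≤ ⟩
      (n + k) * d     ≡⟨ trans (*-distribʳ-+ d n k) (+-comm (n * d) (k * d)) ⟩
      k * d + n * d   ∎

  main : 2 ^ (n * d) * (t ^ d * e ^ (n * d)) ≤ 2 ^ (n * d) * (G * y ^ (n * d))
  main = begin
    2 ^ (n * d) * (t ^ d * e ^ (n * d))    ≡⟨ solve 3 (λ a b c → a :* (b :* c) := b :* (a :* c)) refl (2 ^ (n * d)) (t ^ d) (e ^ (n * d)) ⟩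
    t ^ d * (2 ^ (n * d) * e ^ (n * d))    ≡⟨ cong (t ^ d *_) (sym (^-distribʳ-* (n * d) 2 e)) ⟩
    t ^ d * (2 * e) ^ (n * d)              ≤⟨ *-monoʳ-≤ (t ^ d) (x^nd≤ {k} {n} {S} d n≤) ⟩
    -- One factor 2^S has paid for lowering the base from 2e to 2e - 1; as p ≥ 1, the saved 2^(S·p)
    -- contains it.
    t ^ d * (2 ^ S * y ^ (n * d))          ≤⟨ *-monoʳ-≤ (t ^ d) (*-monoˡ-≤ (y ^ (n * d)) (^-monoʳ-≤ 2 (m≤m*n S p {{>-nonZero 1≤p}}))) ⟩
    t ^ d * (2 ^ (S * p) * y ^ (n * d))    ≡⟨ sym (*-assoc (t ^ d) (2 ^ (S * p)) (y ^ (n * d))) ⟩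
    t ^ d * 2 ^ (S * p) * y ^ (n * d)      ≤⟨ *-monoˡ-≤ (y ^ (n * d)) saved ⟩
    G * 2 ^ (n * d) * y ^ (n * d)          ≡⟨ solve 3 (λ a b c → a :* b :* c := b :* (a :* c)) refl G (2 ^ (n * d)) (y ^ (n * d)) ⟩
    2 ^ (n * d) * (G * y ^ (n * d))        ∎

-- The cost bound is quadratic in the steps, so Z^4 becomes Z^8. The 5 is 4 for L and 1 for the
-- successor, both measured in units of Z^4.
cost-from-steps : ∀ Z a {L T t} .{{_ : NonZero Z}} → L ≤ 4 * Z ^ 4 → T ≤ a * Z ^ 4 → t ≤ T * (2 * suc (L + T)) →
                  t ≤ a * (2 * (5 + a)) * Z ^ 8
cost-from-steps Z a {L} {T} {t} L≤ T≤ t≤ = begin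
  t                                        ≤⟨ t≤ ⟩
  T * (2 * suc (L + T))                    ≤⟨ *-mono-≤ T≤ (*-monoʳ-≤ 2 (+-mono-≤ {1} (m^n>0 Z 4) (+-mono-≤ L≤ T≤))) ⟩
  a * W * (2 * (W + (4 * W + a * W)))      ≡⟨ solve 2 (λ a w → a :* w :* (con 2 :* (w :+ (con 4 :* w :+ a :* w))) := a :* (con 2 :* (con 5 :+ a)) :* (w :* w)) refl a W ⟩
  a * (2 * (5 + a)) * (W * W)              ≡⟨ cong (a * (2 * (5 + a)) *_) (sym (^-distribˡ-+-* Z 4 4)) ⟩
  a * (2 * (5 + a)) * Z ^ 8                ∎
  where
  open ≤-Reasoning
  open +-*-Solver using (solve; _:=_; _:+_; _:*_; con)
  W = Z ^ 4

total-≤ : ∀ a {E k n S e G t u} → 16 ≤ k → 2 ≤ e → S * k ≤ n + k → 1 ≤ E * 2 ^ S →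
          u ≤ a * (E * 2 ^ S) ^ 8 + t + 3 → t * e ^ n ≤ G * (2 * e ∸ 1) ^ n →
          u * e ^ n ≤ ((a + 3) * (E ^ 8 * 2 ^ k) + G) * (2 * e ∸ 1) ^ n
total-≤ a {E} {k} {n} {S} {e} {G} {t} {u} 16≤k 2≤e Sk≤ 1≤Z u≤ t≤ = begin
  u * e ^ n                                                       ≤⟨ *-monoˡ-≤ (e ^ n) (≤-trans u≤ absorb) ⟩
  ((a + 3) * Z ^ 8 + t) * e ^ n                                   ≡⟨ cong (λ z → ((a + 3) * z + t) * e ^ n) Z^8≡ ⟩
  ((a + 3) * (E ^ 8 * 2 ^ (8 * S)) + t) * e ^ n                   ≡⟨ solve 5 (λ b E p t x → (b :* (E :* p) :+ t) :* x := b :* (E :* (p :* x)) :+ t :* x) refl (a + 3) (E ^ 8) (2 ^ (8 * S)) t (e ^ n) ⟩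
  (a + 3) * (E ^ 8 * (2 ^ (8 * S) * e ^ n)) + t * e ^ n           ≤⟨ +-mono-≤ (*-monoʳ-≤ (a + 3) (*-monoʳ-≤ (E ^ 8) (preprocessing-≤ {k} {n} {S} 16≤k 2≤e Sk≤))) t≤ ⟩
  (a + 3) * (E ^ 8 * (2 ^ k * y ^ n)) + G * y ^ n                 ≡⟨ solve 5 (λ b E p g x → b :* (E :* (p :* x)) :+ g :* x := (b :* (E :* p) :+ g) :* x) refl (a + 3) (E ^ 8) (2 ^ k) G (y ^ n) ⟩
  ((a + 3) * (E ^ 8 * 2 ^ k) + G) * y ^ n                         ∎
  where
  open ≤-Reasoning
  open +-*-Solver using (solve; _:=_; _:+_; _:*_; con)
  y = 2 * e ∸ 1
  Z = E * 2 ^ S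
  Z^8≡ : Z ^ 8 ≡ E ^ 8 * 2 ^ (8 * S)
  Z^8≡ = trans (^-distribʳ-* 8 E (2 ^ S)) (cong (E ^ 8 *_) (trans (^-*-assoc 2 S 8) (cong (2 ^_) (*-comm S 8))))
  absorb : a * Z ^ 8 + t + 3 ≤ (a + 3) * Z ^ 8 + t
  absorb = begin
    a * Z ^ 8 + t + 3           ≤⟨ +-monoʳ-≤ (a * Z ^ 8 + t) (*-monoʳ-≤ 3 {1} {Z ^ 8} (m^n>0 Z {{>-nonZero 1≤Z}} 8)) ⟩
    a * Z ^ 8 + t + 3 * Z ^ 8   ≡⟨ solve 3 (λ a w t → a :* w :+ t :+ con 3 :* w := (a :+ con 3) :* w :+ t) refl a (Z ^ 8) t ⟩
    (a + 3) * Z ^ 8 + t         ∎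

n<1+n/k*k : ∀ n k .{{_ : NonZero k}} → n < suc (n / k) * k
n<1+n/k*k n k = begin-strict
  n                     ≡⟨ m≡m%n+[m/n]*n n k ⟩
  n % k + n / k * k     <⟨ +-monoˡ-< (n / k * k) (m%n<n n k) ⟩
  k + n / k * k         ∎
  where open ≤-Reasoning

-- Updates of functions

≡ᵇ-+ : ∀ a x y → (a + x ≡ᵇ a + y) ≡ (x ≡ᵇ y)
≡ᵇ-+ zero    x y = refl
≡ᵇ-+ (suc a) x y = ≡ᵇ-+ a x y

update-all : ∀ {A : Set} (P : A → Set) (f : ℕ → A) i {v} →
             P v → (∀ j → P (f j)) → ∀ j → P ((f [ i ↦ v ]) j)
update-all P f i pv pf j with i ≡ᵇ j
... | true  = pv
... | false = pf j

-- The relation is a parameter because memories are themselves functions: cells are compared by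
-- `_≡_`, whole memories only pointwise.
update-shift : ∀ {A : Set} (_~_ : A → A → Set) a x (f g : ℕ → A) {v w} →
               v ~ w → (∀ y → f (a + y) ~ g y) →
               ∀ y → (f [ a + x ↦ v ]) (a + y) ~ (g [ x ↦ w ]) y
update-shift _~_ a x f g v~w f~g y rewrite ≡ᵇ-+ a x y with x ≡ᵇ y
... | true  = v~w
... | false = f~g y

update-cong : ∀ {A : Set} (f g : ℕ → A) {x y v w} →
              x ≡ y → v ≡ w → (∀ z → f z ≡ g z) →
              ∀ z → (f [ x ↦ v ]) z ≡ (g [ y ↦ w ]) z
update-cong f g {x = x} refl refl f≡g z with x ≡ᵇ z
... | true  = refl
... | false = f≡g z

-- Simulating a program on shifted registers and memories

module Shift (ρ μ : ℕ) where

  shift : Program → Program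
  shift skip                       = skip
  shift (x :=# c)                  = (ρ + x) :=# c
  shift (x := y ⊕ z)               = (ρ + x) := (ρ + y) ⊕ (ρ + z)
  shift (x := y ⊖ z)               = (ρ + x) := (ρ + y) ⊖ (ρ + z)
  shift (x := a [ y ])             = (ρ + x) := (μ + a) [ ρ + y ]
  shift (a [ x ]:= y)              = (μ + a) [ ρ + x ]:= (ρ + y)
  shift (c ⨾ d)                    = shift c ⨾ shift d
  shift (ifnz x then c else d)     = ifnz (ρ + x) then shift c else shift d
  shift (whilenz x loop c)         = whilenz (ρ + x) loop shift c

  record Simulates (s₁ s : State) : Set where
    constructor simulates
    field
      regs : ∀ x → reg s₁ (ρ + x) ≡ reg s x
      mems : ∀ a i → mem s₁ (μ + a) i ≡ mem s a i

  open Simulates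

  private
    Simulation : Program → State → ℕ → State → Set
    Simulation c s₁ t s′ = ∃[ s₁′ ] shift c ∶ s₁ ⟶[ t ] s₁′ × Simulates s₁′ s′

    step : ∀ {c s₁ s₁′ t u s′} → t ≡ u → shift c ∶ s₁ ⟶[ t ] s₁′ →
           Simulates s₁′ s′ → Simulation c s₁ u s′
    step refl D S = _ , D , S

    write : ∀ {s₁ s} x {v w} → v ≡ w → Simulates s₁ s →
            Simulates ⟪ reg s₁ [ ρ + x ↦ v ] , mem s₁ ⟫ ⟪ reg s [ x ↦ w ] , mem s ⟫
    write {s₁} {s} x v≡w S = simulates (update-shift _≡_ ρ x (reg s₁) (reg s) v≡w (regs S)) (mems S)

  -- The cost charges the numbers and the run-time addresses that are read, never the names of
  -- registers and memories, so renaming these preserves the running time exactly.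
  simulate : ∀ {c s t s′ s₁} → c ∶ s ⟶[ t ] s′ → Simulates s₁ s →
             ∃[ s₁′ ] shift c ∶ s₁ ⟶[ t ] s₁′ × Simulates s₁′ s′
  simulate skip S = _ , skip , S
  simulate (const {x = x}) S = _ , const , write x refl S
  simulate (add {x = x} {y} {z}) S =
    step {x := y ⊕ z} (cong₂ (λ a b → len a + len b) (regs S y) (regs S z)) add
      (write x (cong₂ _+_ (regs S y) (regs S z)) S)
  simulate (sub {x = x} {y} {z}) S =
    step {x := y ⊖ z} (cong₂ (λ a b → len a + len b) (regs S y) (regs S z)) sub
      (write x (cong₂ _∸_ (regs S y) (regs S z)) S)
  simulate (load {m = m} {x} {a} {y}) S =
    step {x := a [ y ]} (cong₂ (λ a b → len a + len b) (regs S y) eq) load (write x eq S)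
    where eq = trans (mems S a _) (cong (m a) (regs S y))
  simulate {s₁ = s₁} (store {m = m} {a} {x} {y}) S =
    step {a [ x ]:= y} (cong₂ (λ a b → len a + len b) (regs S x) (regs S y)) store
      (simulates (regs S)
        (update-shift (λ f g → ∀ i → f i ≡ g i) μ a (mem s₁) m
          (update-cong (mem s₁ (μ + a)) (m a) (regs S x) (regs S y) (mems S a)) (mems S)))
  simulate (seq D E) S with simulate D S
  ... | _ , D₁ , S₁ with simulate E S₁
  ... | _ , E₁ , S₂ = _ , seq D₁ E₁ , S₂
  simulate (if-nz {x} {c} {d} x≢0 D) S with simulate D S
  ... | _ , D₁ , S₁ = step {ifnz x then c else d} (cong (λ a → len a + _) (regs S x))
                        (if-nz (λ e → x≢0 (trans (sym (regs S x)) e)) D₁) S₁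
  simulate (if-z {x} {c} {d} x≡0 D) S with simulate D S
  ... | _ , D₁ , S₁ = step {ifnz x then c else d} (cong (λ a → len a + _) (regs S x))
                        (if-z (trans (regs S x) x≡0) D₁) S₁
  simulate (while-nz {x} {c} x≢0 D E) S with simulate D S
  ... | _ , D₁ , S₁ with simulate E S₁
  ... | _ , E₁ , S₂ = step {whilenz x loop c} (cong (λ a → len a + _) (regs S x))
                        (while-nz (λ e → x≢0 (trans (sym (regs S x)) e)) D₁ E₁) S₂
  simulate (while-z {x} {c} x≡0) S =
    step {whilenz x loop c} (cong len (regs S x)) (while-z (trans (regs S x) x≡0)) S

-- Number of steps against logarithmic cost

steps : ∀ {c s t s′} → c ∶ s ⟶[ t ] s′ → ℕ
steps (seq D E)        = steps D + steps E
steps (if-nz _ D)      = 1 + steps D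
steps (if-z _ D)       = 1 + steps D
steps (while-nz _ D E) = 1 + (steps D + steps E)
steps _                = 1

-- Apart from addition, which at most doubles, a constant assignment is the only way to obtain a
-- number larger than all present ones.
maxConstant : Program → ℕ
maxConstant (_ :=# c)                = c
maxConstant (c ⨾ d)                  = maxConstant c ⊔ maxConstant d
maxConstant (ifnz _ then c else d)   = maxConstant c ⊔ maxConstant d
maxConstant (whilenz _ loop c)       = maxConstant c
maxConstant _                        = 0

record Bounded (L : ℕ) (s : State) : Set where
  constructor bounded
  field
    regs : ∀ x → reg s x ≤ 2 ^ L
    mems : ∀ a i → mem s a i ≤ 2 ^ L

open Bounded

len-≤ : ∀ {x L} → x ≤ 2 ^ L → len x ≤ suc L
len-≤ {x} {L} x≤ = s≤s (subst (⌊log₂ x ⌋ ≤_) (⌊log₂[2^n]⌋≡n L) (⌊log₂⌋-mono-≤ x≤))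

bounded-weaken : ∀ {L M s} → L ≤ M → Bounded L s → Bounded M s
bounded-weaken L≤M B = bounded (λ x → ≤-trans (regs B x) le) (λ a i → ≤-trans (mems B a i) le)
  where le = ^-monoʳ-≤ 2 L≤M

bounded-write : ∀ {L s} x {v} → v ≤ 2 ^ L → Bounded L s → Bounded L ⟪ reg s [ x ↦ v ] , mem s ⟫
bounded-write {L} {s} x v≤ B = bounded (update-all (_≤ 2 ^ L) (reg s) x v≤ (regs B)) (mems B)

private
  stepCost : ℕ → ℕ → ℕ
  stepCost L T = T * (2 * suc (L + T))

  elementary : ∀ {L x y} → x ≤ 2 ^ L → y ≤ 2 ^ L → len x + len y ≤ stepCost L 1
  elementary {L} {x} {y} x≤ y≤ = subst (len x + len y ≤_) (solve 1 (λ l → (con 1 :+ (l :+ con 1)) :+ (con 1 :+ (l :+ con 1)) := con 1 :* (con 2 :* (con 1 :+ (l :+ con 1)))) refl L)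
    (+-mono-≤ (≤-trans (len-≤ x≤) (s≤s (m≤m+n L 1))) (≤-trans (len-≤ y≤) (s≤s (m≤m+n L 1))))
    where open +-*-Solver

  compose : ∀ {L t u} a b → t ≤ stepCost L a → u ≤ stepCost (L + a) b → t + u ≤ stepCost L (a + b)
  compose {L} {t} {u} a b t≤ u≤ = begin
    t + u                                               ≤⟨ +-mono-≤ t≤ u≤ ⟩
    a * (2 * suc (L + a)) + b * (2 * suc (L + a + b))   ≤⟨ +-monoˡ-≤ _ (*-monoʳ-≤ a (*-monoʳ-≤ 2 (s≤s (m≤m+n (L + a) b)))) ⟩
    a * (2 * suc (L + a + b)) + b * (2 * suc (L + a + b)) ≡⟨ sym (*-distribʳ-+ _ a b) ⟩
    (a + b) * (2 * suc (L + a + b))                     ≡⟨ cong (λ z → (a + b) * (2 * suc z)) (+-assoc L a b) ⟩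
    stepCost L (a + b)                                  ∎
    where open ≤-Reasoning

  test : ∀ {L x} → x ≤ 2 ^ L → len x ≤ stepCost L 1
  test {L} x≤ = ≤-trans (len-≤ x≤) (≤-trans (s≤s (m≤m+n L 1)) (≤-trans (m≤n*m _ 2) (≤-reflexive (sym (*-identityˡ _)))))

  weaken₁ : ∀ {L s} → Bounded L s → Bounded (L + 1) s
  weaken₁ {L} = bounded-weaken (m≤m+n L 1)

  double : ∀ L {x} → x ≤ 2 ^ L → x ≤ 2 ^ (L + 1)
  double L x≤ = ≤-trans x≤ (^-monoʳ-≤ 2 (m≤m+n L 1))

-- The bound on the final state is part of the claim because the second half of a sequence starts
-- with entries whose length has grown by the steps already made.
cost : ∀ {c s t s′ L} (D : c ∶ s ⟶[ t ] s′) → maxConstant c ≤ 2 ^ L → Bounded L s →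
       t ≤ steps D * (2 * suc (L + steps D)) × Bounded (L + steps D) s′
cost {L = L} skip c≤ B = test {L} {0} z≤n , weaken₁ B
cost {L = L} (const {x = x}) c≤ B = test {L} c≤ , bounded-write x (double L c≤) (weaken₁ B)
cost {L = L} (add {r} {x = x} {y} {z}) c≤ B =
  elementary {L} (regs B y) (regs B z) ,
  bounded-write x (subst (r y + r z ≤_) (trans (cong (2 ^ L +_) (sym (+-identityʳ _))) (cong (2 ^_) (+-comm 1 L)))
                  (+-mono-≤ (regs B y) (regs B z))) (weaken₁ B)
cost {L = L} (sub {r} {x = x} {y} {z}) c≤ B =
  elementary {L} (regs B y) (regs B z) ,
  bounded-write x (double L (≤-trans (m∸n≤m (r y) (r z)) (regs B y))) (weaken₁ B)
cost {L = L} (load {r} {x = x} {a} {y}) c≤ B =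
  elementary {L} (regs B y) (mems B a (r y)) ,
  bounded-write x (double L (mems B a (r y))) (weaken₁ B)
cost {L = L} (store {r} {m} {a} {x} {y}) c≤ B =
  elementary {L} (regs B x) (regs B y) ,
  bounded (regs B₁) (update-all (λ f → ∀ i → f i ≤ 2 ^ (L + 1)) m a
                      (update-all (_≤ 2 ^ (L + 1)) (m a) (r x) (regs B₁ y) (mems B₁ a)) (mems B₁))
  where
  B₁ : Bounded (L + 1) ⟪ r , m ⟫
  B₁ = weaken₁ B
cost {L = L} (seq {c} {d} {s₃ = s₃} D E) c≤ B =
  let t≤ , B₁ = cost D (m⊔n≤o⇒m≤o (maxConstant c) _ c≤) B
      u≤ , B₂ = cost E (≤-trans (m⊔n≤o⇒n≤o (maxConstant c) _ c≤) (^-monoʳ-≤ 2 (m≤m+n L (steps D)))) B₁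
  in compose (steps D) (steps E) t≤ u≤ , subst (λ l → Bounded l s₃) (+-assoc L (steps D) (steps E)) B₂
cost {L = L} (if-nz {x} {c} {s′ = s′} _ D) c≤ B =
  let t≤ , B₁ = cost D (≤-trans (m⊔n≤o⇒m≤o (maxConstant c) _ c≤) (^-monoʳ-≤ 2 (m≤m+n L 1))) (weaken₁ B)
  in compose 1 (steps D) (test {L} (regs B x)) t≤ , subst (λ l → Bounded l s′) (+-assoc L 1 (steps D)) B₁
cost {L = L} (if-z {x} {c} {s′ = s′} _ D) c≤ B =
  let t≤ , B₁ = cost D (≤-trans (m⊔n≤o⇒n≤o (maxConstant c) _ c≤) (^-monoʳ-≤ 2 (m≤m+n L 1))) (weaken₁ B)
  in compose 1 (steps D) (test {L} (regs B x)) t≤ , subst (λ l → Bounded l s′) (+-assoc L 1 (steps D)) B₁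
cost {L = L} (while-nz {x} {c} {s₃ = s₃} _ D E) c≤ B =
  let t≤ , B₁ = cost D (≤-trans c≤ (^-monoʳ-≤ 2 (m≤m+n L 1))) (weaken₁ B)
      u≤ , B₂ = cost E (≤-trans c≤ (^-monoʳ-≤ 2 (≤-trans (m≤m+n L 1) (m≤m+n (L + 1) (steps D))))) B₁
  in compose 1 (steps D + steps E) (test {L} (regs B x)) (compose (steps D) (steps E) t≤ u≤) ,
     subst (λ l → Bounded l s₃) (trans (+-assoc (L + 1) (steps D) (steps E)) (+-assoc L 1 _)) B₂
cost {L = L} (while-z {x} _) c≤ B = test {L} (regs B x) , weaken₁ B

-- Registers and memories that a program does not write

writesReg : Program → ℕ → Bool
writesReg (x :=# _)              y = x ≡ᵇ y
writesReg (x := _ ⊕ _)           y = x ≡ᵇ y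
writesReg (x := _ ⊖ _)           y = x ≡ᵇ y
writesReg (x := _ [ _ ])         y = x ≡ᵇ y
writesReg (c ⨾ d)                y = writesReg c y ∨ writesReg d y
writesReg (ifnz _ then c else d) y = writesReg c y ∨ writesReg d y
writesReg (whilenz _ loop c)     y = writesReg c y
writesReg _                      y = false

writesMem : Program → ℕ → Bool
writesMem (a [ _ ]:= _)          b = a ≡ᵇ b
writesMem (c ⨾ d)                b = writesMem c b ∨ writesMem d b
writesMem (ifnz _ then c else d) b = writesMem c b ∨ writesMem d b
writesMem (whilenz _ loop c)     b = writesMem c b
writesMem _                      b = false

-- Being unwritten is a Boolean computed from the program, so for concrete programs and registers
-- the condition is discharged by `refl`.
record Frame (c : Program) (s s′ : State) : Set where
  constructor framed
  field
    reg= : ∀ x → writesReg c x ≡ false → reg s′ x ≡ reg s x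
    mem= : ∀ a → writesMem c a ≡ false → ∀ i → mem s′ a i ≡ mem s a i

open Frame public

private
  ∨-false : ∀ a {b} → a ∨ b ≡ false → a ≡ false × b ≡ false
  ∨-false false eq = refl , eq

  untouched : ∀ {A : Set} (f : ℕ → A) {v} i j → (i ≡ᵇ j) ≡ false → (f [ i ↦ v ]) j ≡ f j
  untouched f i j eq rewrite eq = refl

frame : ∀ {c s t s′} → c ∶ s ⟶[ t ] s′ → Frame c s s′
frame skip = framed (λ _ _ → refl) (λ _ _ _ → refl)
frame (const {x = x}) = framed (untouched _ x) (λ _ _ _ → refl)
frame (add {x = x}) = framed (untouched _ x) (λ _ _ _ → refl)
frame (sub {x = x}) = framed (untouched _ x) (λ _ _ _ → refl)
frame (load {x = x}) = framed (untouched _ x) (λ _ _ _ → refl)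
frame (store {m = m} {a}) = framed (λ _ _ → refl) (λ b e i → cong (λ f → f i) (untouched m a b e))
frame (seq {c} D E) =
  let F = frame D ; G = frame E in
  framed (λ x e → let e₁ , e₂ = ∨-false (writesReg c x) e in trans (reg= G x e₂) (reg= F x e₁))
         (λ a e i → let e₁ , e₂ = ∨-false (writesMem c a) e in trans (mem= G a e₂ i) (mem= F a e₁ i))
frame (if-nz {c = c} _ D) =
  let F = frame D in
  framed (λ x e → reg= F x (proj₁ (∨-false (writesReg c x) e)))
         (λ a e → mem= F a (proj₁ (∨-false (writesMem c a) e)))
frame (if-z {c = c} _ D) =
  let F = frame D in
  framed (λ x e → reg= F x (proj₂ (∨-false (writesReg c x) e)))
         (λ a e → mem= F a (proj₂ (∨-false (writesMem c a) e)))
frame (while-nz _ D E) =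
  let F = frame D ; G = frame E in
  framed (λ x e → trans (reg= G x e) (reg= F x e)) (λ a e i → trans (mem= G a e i) (mem= F a e i))
frame (while-z _) = framed (λ _ _ → refl) (λ _ _ _ → refl)

-- Terminating runs with a monomial bound a · Z^j on the number of steps

module Runs (Z : ℕ) .{{_ : NonZero Z}} where

  -- A total-correctness triple with the step bound as an index: composition and loops compute the
  -- coefficient and the exponent, so the numerals in later types are read off the programs.
  record Run (c : Program) (s : State) (a j : ℕ) (Q : State → Set) : Set where
    constructor ran
    field
      {final}    : State
      {time}     : ℕ
      derivation : c ∶ s ⟶[ time ] final
      bound      : steps derivation ≤ a * Z ^ j
      post       : Q final

  open Run public

  infixl 1 _▹_

  -- The continuation receives the frame of the first program, so its postcondition need not mention
  -- registers that it does not write.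
  _▹_ : ∀ {c d s a b i j Q R} → Run c s a i Q →
        (∀ {s′} → Frame c s s′ → Q s′ → Run d s′ b j R) →
        Run (c ⨾ d) s (a + b) (i ⊔ j) R
  _▹_ {a = a} {b} {i} {j} (ran D D≤ q) f with f (frame D) q
  ... | ran E E≤ r = ran (seq D E) (begin
    steps D + steps E                     ≤⟨ +-mono-≤ D≤ E≤ ⟩
    a * Z ^ i + b * Z ^ j                 ≤⟨ +-mono-≤ (*-monoʳ-≤ a (^-monoʳ-≤ Z (m≤m⊔n i j))) (*-monoʳ-≤ b (^-monoʳ-≤ Z (m≤n⊔m i j))) ⟩
    a * Z ^ (i ⊔ j) + b * Z ^ (i ⊔ j)     ≡⟨ sym (*-distribʳ-+ (Z ^ (i ⊔ j)) a b) ⟩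
    (a + b) * Z ^ (i ⊔ j)                 ∎) r
    where open ≤-Reasoning

  branch-nz : ∀ {x c d s a j Q} → reg s x ≢ 0 → Run c s a j Q →
              Run (ifnz x then c else d) s (1 + a) j Q
  branch-nz {a = a} {j} x≢0 (ran D D≤ q) =
    ran (if-nz x≢0 D) (+-mono-≤ (m^n>0 Z j) D≤) q

  branch-z : ∀ {x c d s a j Q} → reg s x ≡ 0 → Run d s a j Q →
             Run (ifnz x then c else d) s (1 + a) j Q
  branch-z {a = a} {j} x≡0 (ran D D≤ q) =
    ran (if-z x≡0 D) (+-mono-≤ (m^n>0 Z j) D≤) q

  weaken : ∀ {c s a b j Q} → a ≤ b → Run c s a j Q → Run c s b j Q
  weaken {j = j} a≤b (ran D D≤ q) = ran D (≤-trans D≤ (*-monoˡ-≤ (Z ^ j) a≤b)) q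

  private
    -- The frame always relates the current state to the one before the loop; hence the invariant
    -- need not record what the loop leaves alone.
    iterate : ∀ {x c s₀ a j} (Inv : ℕ → State → Set) →
           (∀ {s} → Inv 0 s → reg s x ≡ 0) →
           (∀ i {s} → Frame (whilenz x loop c) s₀ s → Inv (suc i) s → reg s x ≢ 0) →
           (∀ i {s} → Frame (whilenz x loop c) s₀ s → Inv (suc i) s → Run c s a j (Inv i)) →
           ∀ i {s} → Frame (whilenz x loop c) s₀ s → Inv i s →
           ∃[ s′ ] ∃[ t ] ∃[ D ] steps {whilenz x loop c} {s} {t} {s′} D ≤ 1 + i * (1 + a * Z ^ j) × Inv 0 s′
    iterate Inv stop go body zero F I = _ , _ , while-z (stop I) , ≤-refl , I
    iterate {a = a} {j} Inv stop go body (suc i) F I with body i F I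
    ... | ran D D≤ I₁ with iterate Inv stop go body i
                             (framed (λ x e → trans (reg= (frame D) x e) (reg= F x e))
                                     (λ m e z → trans (mem= (frame D) m e z) (mem= F m e z))) I₁
    ... | _ , _ , E , E≤ , I₂ =
      _ , _ , while-nz (go i F I) D E ,
      s≤s (≤-trans (+-mono-≤ D≤ E≤) (≤-reflexive (+-suc (a * Z ^ j) _))) , I₂

  -- The number of remaining rounds lives in the invariant only; `for` is the case in which the
  -- tested register holds it. The 2 in `2 + a` pays for the test in each round and for the last,
  -- failing test.
  while : ∀ {x c s a j} (Inv : ℕ → State → Set) N → N ≤ Z →
          (∀ {s₁} → Inv 0 s₁ → reg s₁ x ≡ 0) →
          (∀ i {s₁} → Frame (whilenz x loop c) s s₁ → Inv (suc i) s₁ → reg s₁ x ≢ 0) →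
          Inv N s →
          (∀ i {s₁} → Frame (whilenz x loop c) s s₁ → Inv (suc i) s₁ → Run c s₁ a j (Inv i)) →
          Run (whilenz x loop c) s (2 + a) (suc j) (Inv 0)
  while {a = a} {j} Inv N N≤Z stop go I body
    with iterate Inv stop go body N (framed (λ _ _ → refl) (λ _ _ _ → refl)) I
  ... | _ , _ , D , D≤ , I₁ = ran D (begin
    steps D                                ≤⟨ D≤ ⟩
    1 + N * (1 + a * Z ^ j)                ≤⟨ +-mono-≤ (m^n>0 Z (suc j)) (*-mono-≤ N≤Z (+-monoˡ-≤ (a * Z ^ j) (m^n>0 Z j))) ⟩
    Z ^ suc j + Z * (Z ^ j + a * Z ^ j)    ≡⟨ solve 3 (λ z p a → z :* p :+ z :* (p :+ a :* p) := (con 2 :+ a) :* (z :* p)) refl Z (Z ^ j) a ⟩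
    (2 + a) * Z ^ suc j                    ∎) I₁
    where open ≤-Reasoning
          open +-*-Solver using (solve; _:=_; _:+_; _:*_; con)

  for : ∀ {x c s a j} (Inv : ℕ → State → Set) N → N ≤ Z → reg s x ≡ N → Inv N s →
        (∀ i {s₁} → Frame (whilenz x loop c) s s₁ → reg s₁ x ≡ suc i → Inv (suc i) s₁ →
         Run c s₁ a j (λ s₂ → reg s₂ x ≡ i × Inv i s₂)) →
        Run (whilenz x loop c) s (2 + a) (suc j) (Inv 0)
  for {x} Inv N N≤Z x≡N I body
    with while (λ i s → reg s x ≡ i × Inv i s) N N≤Z proj₁
           (λ i _ (e , _) e₀ → 1+n≢0 (trans (sym e) e₀)) (x≡N , I)
           (λ i F (e , J) → body i F e J)
  ... | ran D D≤ (_ , I₀) = ran D D≤ I₀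

-- Memories holding a word

contents-++ˡ : ∀ xs {ys i} → i < length xs → contents (xs ++ ys) i ≡ contents xs i
contents-++ˡ (x ∷ xs) {i = zero}  _       = refl
contents-++ˡ (x ∷ xs) {i = suc i} (s≤s p) = contents-++ˡ xs p

contents-beyond : ∀ xs {i} → length xs ≤ i → contents xs i ≡ 0
contents-beyond []       _       = refl
contents-beyond (x ∷ xs) (s≤s p) = contents-beyond xs p

contents-zeros : ∀ n i → contents (replicate n 0) i ≡ 0
contents-zeros zero    i       = refl
contents-zeros (suc n) zero    = refl
contents-zeros (suc n) (suc i) = contents-zeros n i

contents-snoc : ∀ xs v i → (contents xs [ length xs ↦ v ]) i ≡ contents (xs ++ [ v ]) i
contents-snoc []       v zero    = refl
contents-snoc []       v (suc i) = refl
contents-snoc (x ∷ xs) v zero    = refl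
contents-snoc (x ∷ xs) v (suc i) = contents-snoc xs v i

-- A set is written before its size is known; this fills in the size afterwards.
contents-patch : ∀ xs y v ys i →
                 (contents (xs ++ y ∷ ys) [ length xs ↦ v ]) i ≡ contents (xs ++ v ∷ ys) i
contents-patch []       y v ys zero    = refl
contents-patch []       y v ys (suc i) = refl
contents-patch (x ∷ xs) y v ys zero    = refl
contents-patch (x ∷ xs) y v ys (suc i) = contents-patch xs y v ys i

-- All cells are specified, those behind the word as zero, because `initial` demands this of an
-- input.
record Tape (a p : ℕ) (w : List ℕ) (s : State) : Set where
  constructor tape
  field
    end   : reg s p ≡ length w
    cells : ∀ i → mem s a i ≡ contents w i

open Tape public

retape : ∀ {a p w s s′} → reg s′ p ≡ reg s p → mem s′ a ≡ mem s a → Tape a p w s → Tape a p w s′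
retape p≡ a≡ t = tape (trans p≡ (end t)) (λ i → trans (cong (λ f → f i) a≡) (cells t i))

carry : ∀ {c a p w s s′} → Frame c s s′ → writesReg c p ≡ false → writesMem c a ≡ false → Tape a p w s → Tape a p w s′
carry F p∉ a∉ t = tape (trans (reg= F _ p∉) (end t)) (λ i → trans (mem= F _ a∉ i) (cells t i))

-- Straight-line programs

line : Program → Bool
line (c ⨾ d)                 = line c ∧ line d
line (ifnz _ then _ else _)  = false
line (whilenz _ loop _)      = false
line _                       = true

-- The final state as a term, so that register contents after a straight-line program are found by
-- computation. Branches and loops, which `line` excludes, fall under the default.
exec : Program → State → State
exec (x :=# c)     s = ⟪ reg s [ x ↦ c ] , mem s ⟫
exec (x := y ⊕ z)  s = ⟪ reg s [ x ↦ reg s y + reg s z ] , mem s ⟫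
exec (x := y ⊖ z)  s = ⟪ reg s [ x ↦ reg s y ∸ reg s z ] , mem s ⟫
exec (x := a [ y ]) s = ⟪ reg s [ x ↦ mem s a (reg s y) ] , mem s ⟫
exec (a [ x ]:= y) s = ⟪ reg s , mem s [ a ↦ mem s a [ reg s x ↦ reg s y ] ] ⟫
exec (c ⨾ d)       s = exec d (exec c s)
exec _             s = s

size : Program → ℕ
size (c ⨾ d) = size c + size d
size _       = 1

exec-derivation : ∀ c s → T (line c) → ∃[ t ] Σ (c ∶ s ⟶[ t ] exec c s) λ D → steps D ≡ size c
exec-derivation skip s _            = _ , skip , refl
exec-derivation (x :=# c) s _       = _ , const , refl
exec-derivation (x := y ⊕ z) s _    = _ , add , refl
exec-derivation (x := y ⊖ z) s _    = _ , sub , refl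
exec-derivation (x := a [ y ]) s _  = _ , load , refl
exec-derivation (a [ x ]:= y) s _   = _ , store , refl
exec-derivation (c ⨾ d) s l with line c in eq
... | true with exec-derivation c s (subst T (sym eq) _) | exec-derivation d (exec c s) l
... | _ , D , D≡ | _ , E , E≡ = _ , seq D E , cong₂ _+_ D≡ E≡

infixr 4 _⍮_

-- Sequencing that associates to the right, which is the shape produced by nested continuations of
-- `_▹_`.
_⍮_ : Program → Program → Program
c ⍮ d = c ⨾ d

_⊙_ : ∀ {c d s₁ s₂ s₃} → Frame c s₁ s₂ → Frame d s₂ s₃ → Frame (c ⨾ d) s₁ s₃
_⊙_ {c} F G = framed (λ x e → trans (reg= G x (right (writesReg c x) e)) (reg= F x (left (writesReg c x) e)))
                     (λ a e i → trans (mem= G a (right (writesMem c a) e) i) (mem= F a (left (writesMem c a) e) i))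
  where
  left : ∀ a {b} → a ∨ b ≡ false → a ≡ false
  left false _ = refl
  right : ∀ a {b} → a ∨ b ≡ false → b ≡ false
  right false e = e

≡ᵇ-refl : ∀ i → (i ≡ᵇ i) ≡ true
≡ᵇ-refl zero    = refl
≡ᵇ-refl (suc i) = ≡ᵇ-refl i

update-at : ∀ {A : Set} (f : ℕ → A) i {v} → (f [ i ↦ v ]) i ≡ v
update-at f i rewrite ≡ᵇ-refl i = refl

-- Registers and memories of the reduction.  Registers rF, rL and rO point behind the words in the memories mF
-- (the padded formula), mT (the truth table of the current partial assignment) and mO (the output).  The
-- registers from rO on and the memories from mO on are those of the simulated algorithm.

rF rOne rN rS rKS rP rm rv ru rt rd rK rL rI rM rx rj rPos rCnt rPtr rJ rc rSat rS2 r0 rO : ℕ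
rF = 0
rOne = 1
rN = 2
rS = 3
rKS = 4
rP = 5
rm = 6
rv = 7
ru = 8
rt = 9
rd = 10
rK = 11
rL = 12
rI = 13
rM = 14
rx = 15
rj = 16
rPos = 17
rCnt = 18
rPtr = 19
rJ = 20
rc = 21
rSat = 22
rS2 = 23
r0 = 24
rO = 25

mF mT mO : ℕ
mF = 0
mT = 1
mO = 2

push : ℕ → ℕ → ℕ → Program
push a p x = a [ p ]:= x ⨾ p := p ⊕ rOne

tape-push : ∀ {a p x w v s} → reg s rOne ≡ 1 → reg s x ≡ v → Tape a p w s →
            Tape a p (w ++ [ v ]) (exec (push a p x) s)
tape-push {a} {p} {x} {w} {v} {s} one x≡v t = tape
  (trans (update-at (reg s) p) (trans (cong₂ _+_ (end t) one) (sym (length-++ w))))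
  (λ i → trans (cong (λ f → f i) (update-at (mem s) a))
           (trans (update-cong (mem s a) (contents w) (end t) x≡v (cells t) i) (contents-snoc w v i)))

-- The word that encodes the constructed instance

nz : ℕ → Bool
nz zero    = false
nz (suc _) = true

encClause : List ℕ → List ℕ
encClause c = length c ∷ c

-- The clause v ∨ ¬u ∨ u.  For u = v only sets from the group of v contain it.  If u belongs to another group than
-- v, then every set from the group of u contains it, while a set from the group of v does iff v is true.
pad : ℕ → ℕ → List ℕ
pad v u = v + v + 1 ∷ u + u ∷ u + u + 1 ∷ []

pads-from : ℕ → ℕ → List (List ℕ)
pads-from K i = concatMap (λ v → map (pad v) (downFrom K)) (downFrom i)

pads : ℕ → List (List ℕ)
pads K = pads-from K K

length-pads : ∀ K → length (pads K) ≡ K * K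
length-pads K = from K
  where
  from : ∀ i → length (pads-from K i) ≡ i * K
  from zero    = refl
  from (suc i) = trans (length-++ (map (pad i) (downFrom K)))
    (cong₂ _+_ (trans (length-map (pad i) (downFrom K)) (length-downFrom K)) (from i))

-- The binary digits of x / 2^j for P = 2^(t + j), most significant first: without division, x is doubled instead
-- of P being halved.
bits : ℕ → (t : ℕ) → ℕ → Vec Bool t
bits P zero    x = []
bits P (suc t) x = b ∷ bits P t (if b then x + x ∸ P else x + x)
  where b = nz (x + x + 1 ∸ P)

-- Cell 2j is the truth value of the negative literal of variable j and cell 2j + 1 that of the
-- positive one, as numbered by `encodeLiteral`.
table : ∀ {t} → Vec Bool t → List ℕ
table []           = []
table (true  ∷ bs) = 0 ∷ 1 ∷ table bs
table (false ∷ bs) = 1 ∷ 0 ∷ table bs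

-- On a truth table this counts the true literals: the machine adds and tests for zero instead of
-- computing a disjunction.
hits : (ℕ → ℕ) → List ℕ → ℕ
hits τ c = sum (map τ c)

members : (ℕ → ℕ) → ℕ → List (List ℕ) → List ℕ
members τ J []       = []
members τ J (c ∷ cs) = (if nz (hits τ c) then [ J ] else []) ++ members τ (J + 1) cs

encSet : (ℕ → ℕ) → List (List ℕ) → List ℕ
encSet τ cs = length ms ∷ ms
  where ms = 0 ∷ members τ 1 cs

-- Only the variables of group i have entries. The cells before them are explicit zeros and those
-- after them zero by the default of `contents`, so no literal of another group counts as true.
truth : ℕ → ℕ → ℕ → ℕ → ℕ → ℕ
truth S P i M = contents (replicate (i * (S + S)) 0 ++ table (bits P S M))

spokes : ℕ → ℕ → List ℕ
spokes j zero    = []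
spokes j (suc i) = 0 ∷ j + 1 ∷ spokes (j + 1) i

encGroup : ℕ → ℕ → List (List ℕ) → ℕ → List ℕ
encGroup S P cs g = concatMap (λ M → encSet (truth S P g M) cs) (downFrom P)

coverWord : ℕ → ℕ → List (List ℕ) → List ℕ
coverWord k S cs =
  (k ∷ length cs + 1 ∷ length cs ∷ spokes 0 (length cs) ++ [ k * 2 ^ S ]) ++
  concatMap (encGroup S (2 ^ S) cs) (downFrom k)

-- The program of the reduction

setup : ℕ → Program
setup k =
  rOne :=# 1 ⍮ rK :=# k ⍮ rP :=# 1 ⍮
  -- Starting from n + 1, subtraction of k reaches zero after ⌊n/k⌋ + 1 rounds. The same rounds
  -- build up S, S · k and 2^S by additions, there being no multiplication.
  rm := mF [ rOne ] ⍮ rN := mF [ r0 ] ⍮ rN := rN ⊕ rOne ⍮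
  whilenz rN loop
    (rN := rN ⊖ rK ⍮ rS := rS ⊕ rOne ⍮ rKS := rKS ⊕ rK ⍮ rP := rP ⊕ rP)

-- Register 0 initially holds the length of the input in memory 0, so the pads are appended to the
-- input in place. The clause count inside the word stays as it was; the current one is in `rm`.
addPad : Program
addPad =
  (ru := ru ⊖ rOne ⍮ rt := rOne ⊕ rOne ⍮ rt := rt ⊕ rOne) ⍮ push mF rF rt ⍮
  (rt := rv ⊕ rv ⍮ rt := rt ⊕ rOne) ⍮ push mF rF rt ⍮
  rt := ru ⊕ ru ⍮ push mF rF rt ⍮
  rt := rt ⊕ rOne ⍮ push mF rF rt ⍮
  rm := rm ⊕ rOne

addPads : Program
addPads =
  rv := rKS ⊕ r0 ⍮
  whilenz rv loop
    ((rv := rv ⊖ rOne ⍮ ru := rKS ⊕ r0) ⍮ whilenz ru loop addPad)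

writeHeader : Program
writeHeader =
  push mO rO rK ⍮
  rt := rm ⊕ rOne ⍮ push mO rO rt ⍮
  push mO rO rm ⍮
  (rv := rm ⊕ r0 ⍮ rJ := r0 ⊕ r0) ⍮
  whilenz rv loop
    ((rv := rv ⊖ rOne ⍮ rJ := rJ ⊕ rOne) ⍮ push mO rO r0 ⍮ push mO rO rJ) ⍮
  (rv := rK ⊕ r0 ⍮ rt := r0 ⊕ r0) ⍮
  whilenz rv loop (rv := rv ⊖ rOne ⍮ rt := rt ⊕ rP) ⍮
  push mO rO rt

tabulateBits : Program
tabulateBits =
  (rx := rM ⊕ r0 ⍮ rj := rS ⊕ r0) ⍮
  whilenz rj loop
    -- The added one makes the truncated subtraction test 2x ≥ P rather than 2x > P.
    ((rj := rj ⊖ rOne ⍮ rx := rx ⊕ rx ⍮ rd := rx ⊕ rOne ⍮ rd := rd ⊖ rP) ⍮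
     ifnz rd
       then (rx := rx ⊖ rP ⍮ push mT rL r0 ⍮ push mT rL rOne)
       else (push mT rL rOne ⍮ push mT rL r0))

writeMember : Program
writeMember =
  (rc := mF [ rPtr ] ⍮ rPtr := rPtr ⊕ rOne ⍮ rSat := r0 ⊕ r0) ⍮
  whilenz rc loop
    (rc := rc ⊖ rOne ⍮ rt := mF [ rPtr ] ⍮ rPtr := rPtr ⊕ rOne ⍮
     rt := mT [ rt ] ⍮ rSat := rSat ⊕ rt) ⍮
  (ifnz rSat then (push mO rO rJ ⍮ rCnt := rCnt ⊕ rOne) else skip) ⍮
  rJ := rJ ⊕ rOne

writeSet : Program
writeSet =
  -- The first zero reserves the cell for the size, the second is the centre, vertex 0. Hence the
  -- count starts at 1, clauses are vertices from 1 on, and reading starts at cell 2, behind the two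
  -- header numbers.
  rPos := rO ⊕ r0 ⍮ push mO rO r0 ⍮ push mO rO r0 ⍮
  (rCnt := rOne ⊕ r0 ⍮ rPtr := rOne ⊕ rOne ⍮ rJ := rOne ⊕ r0 ⍮ rj := rm ⊕ r0) ⍮
  whilenz rj loop (rj := rj ⊖ rOne ⍮ writeMember) ⍮
  mO [ rPos ]:= rCnt

-- `truth` presupposes zeros outside the block of the group, so each table is erased after use,
-- which also moves `rL` back to the start of the block.
clearBits : Program
clearBits =
  rj := rS ⊕ r0 ⍮
  whilenz rj loop
    (rj := rj ⊖ rOne ⍮ rL := rL ⊖ rOne ⍮ mT [ rL ]:= r0 ⍮ rL := rL ⊖ rOne ⍮ mT [ rL ]:= r0)

writeFamily : Program
writeFamily =
  (rL := rKS ⊕ rKS ⍮ rS2 := rS ⊕ rS ⍮ rI := rK ⊕ r0) ⍮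
  whilenz rI loop
    ((rI := rI ⊖ rOne ⍮ rL := rL ⊖ rS2 ⍮ rM := rP ⊕ r0) ⍮
     whilenz rM loop
       (rM := rM ⊖ rOne ⍮ tabulateBits ⍮ writeSet ⍮ clearBits))

reduction : ℕ → Program
reduction k = setup k ⍮ addPads ⍮ writeHeader ⍮ writeFamily

-- Correctness and number of steps of the program

module Correctness (Z : ℕ) .{{_ : NonZero Z}} where

  open Runs Z

  by : ∀ {c s} {l : T (line c)} → Run c s (size c) 0 (λ s′ → s′ ≡ exec c s)
  by {c} {s} {l} with exec-derivation c s l
  ... | _ , D , D≡ = ran D (≤-reflexive (trans D≡ (sym (*-identityʳ _)))) refl

  pushing : ∀ {a p x w v s} → reg s rOne ≡ 1 → reg s x ≡ v → Tape a p w s →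
            Run (push a p x) s 2 0 (λ s′ → s′ ≡ exec (push a p x) s × Tape a p (w ++ [ v ]) s′)
  pushing {a} {p} {x} one x≡v t = ran (seq store add) (s≤s (s≤s z≤n)) (refl , tape-push {a} {p} {x} one x≡v t)

  conseq : ∀ {c s a j Q R} → (∀ {s′} → Frame c s s′ → Q s′ → R s′) → Run c s a j Q → Run c s a j R
  conseq f (ran D D≤ q) = ran D D≤ (f (frame D) q)

  predecessor : ∀ {a b i} → a ≡ suc i → b ≡ 1 → a ∸ b ≡ i
  predecessor refl refl = refl

  setup-run : ∀ {k n s m} .{{_ : NonZero k}} → suc (n / k) ≤ Z → reg s rS ≡ 0 → reg s rKS ≡ 0 → reg s r0 ≡ 0 →
              mem s mF 0 ≡ n → mem s mF 1 ≡ m →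
              Run (setup k) s 12 1 (λ s′ →
                reg s′ rOne ≡ 1 × reg s′ rK ≡ k × reg s′ rm ≡ m × reg s′ rS ≡ suc (n / k) ×
                reg s′ rKS ≡ suc (n / k) * k × reg s′ rP ≡ 2 ^ suc (n / k))
  setup-run {k} {n} {s} {m} S≤Z S≡0 KS≡0 z F₀ F₁ =
    by ▹ λ { _ refl → by ▹ λ { _ refl → by ▹ λ { _ refl → by ▹ λ { _ refl → by ▹ λ { _ refl → by ▹ λ { _ refl →
    conseq (λ { F (one , K , M , j , j≡ , X , rS≡ , KS≡ , P≡) →
      let j≡S = trans (sym (+-identityʳ j)) j≡ in
      one , K , trans M F₁ , trans rS≡ j≡S ,
      trans KS≡ (cong (_* k) j≡S) , trans P≡ (cong (2 ^_) j≡S) })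
    (while Inv (suc (n / k)) S≤Z
      -- After S rounds nothing is left of n + 1, since n < S · k. Before that, j ≤ n / k rounds
      -- have removed at most n, so at least 1 is left.
      (λ { (_ , _ , _ , j , j≡ , X , _) → trans X (m≤n⇒m∸n≡0
           (subst (λ z → suc n ≤ z * k) (trans (sym j≡) (+-identityʳ j)) (n<1+n/k*k n k))) })
      (λ { i _ (_ , _ , _ , j , j≡ , X , _) X≡0 → <-irrefl refl (≤-trans
           (s≤s (≤-trans (*-monoˡ-≤ k (j≤n/k j i j≡)) (m/n*n≤m n k)))
           (m∸n≡0⇒m≤n (trans (sym X) X≡0))) })
      (refl , refl , refl , 0 , refl , trans (cong (λ z → mem s mF z + 1) z) (trans (cong (_+ 1) F₀) (+-comm n 1)) , S≡0 , KS≡0 , refl)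
      (λ { i _ (one , K , M , j , j≡ , X , rS≡ , KS≡ , P≡) →
         by ▹ λ { _ refl → by ▹ λ { _ refl → by ▹ λ { _ refl → conseq (λ { _ refl →
           one , K , M , suc j , trans (sym (+-suc j i)) j≡ ,
           trans (cong₂ _∸_ X K) (trans (∸-+-assoc (suc n) (j * k) k) (cong (suc n ∸_) (+-comm (j * k) k))) ,
           trans (cong₂ _+_ rS≡ one) (+-comm j 1) ,
           trans (cong₂ _+_ KS≡ K) (+-comm (j * k) k) ,
           trans (cong₂ _+_ P≡ P≡) (cong (2 ^ j +_) (sym (+-identityʳ _))) }) by }}} })) }}}}}}
    where
    Inv : ℕ → State → Set
    Inv i s′ = reg s′ rOne ≡ 1 × reg s′ rK ≡ k × reg s′ rm ≡ mem s mF 1 × ∃[ j ]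
      j + i ≡ suc (n / k) × reg s′ rN ≡ suc n ∸ j * k × reg s′ rS ≡ j × reg s′ rKS ≡ j * k × reg s′ rP ≡ 2 ^ j
    j≤n/k : ∀ j i → j + suc i ≡ suc (n / k) → j ≤ n / k
    j≤n/k j i e = ≤-trans (m≤m+n j i) (≤-reflexive (suc-injective (trans (sym (+-suc j i)) e)))

  -- Loop invariants describe a tape by what remains to be written on it.

  Writing : ℕ → ℕ → List ℕ → List ℕ → State → Set
  Writing a p rest W s = ∃[ w ] Tape a p w s × w ++ rest ≡ W

  written : ∀ {a p W s} → Writing a p [] W s → Tape a p W s
  written {a} {p} {s = s} (w , t , w≡) = subst (λ w → Tape a p w s) (trans (sym (++-identityʳ w)) w≡) t

  one-more : ∀ (w : List ℕ) x {r} → (w ++ [ x ]) ++ r ≡ w ++ x ∷ r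
  one-more w x {r} = ++-assoc w [ x ] r

  addPads-inner : ∀ {s v N w m} → N ≤ Z → reg s rOne ≡ 1 → reg s rv ≡ v → reg s ru ≡ N →
    reg s rm ≡ m → Tape mF rF w s →
    Run (whilenz ru loop addPad) s 18 1 (λ s′ →
      Tape mF rF (w ++ concatMap encClause (map (pad v) (downFrom N))) s′ × reg s′ rm ≡ m + N)
  addPads-inner {s} {v} {N} {w} {m} N≤Z one rv≡ ru≡ rm≡ t =
    conseq (λ { _ (t′ , m≡) → written t′ , trans (sym (+-identityʳ _)) m≡ })
      (for Inv N N≤Z ru≡ ((w , t , refl) , cong (_+ N) rm≡) body)
    where
    W = w ++ concatMap encClause (map (pad v) (downFrom N))
    Inv : ℕ → State → Set
    Inv i s′ = Writing mF rF (concatMap encClause (map (pad v) (downFrom i))) W s′ × reg s′ rm + i ≡ m + N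
    body : ∀ i {s₁} → Frame (whilenz ru loop addPad) s s₁ → reg s₁ ru ≡ suc i → Inv (suc i) s₁ →
           Run addPad s₁ 16 0 (λ s₂ → reg s₂ ru ≡ i × Inv i s₂)
    body i {s₁} F u≡ ((w′ , t′ , w≡) , m≡) =
      let one′ = trans (reg= F rOne refl) one
          v′ = trans (reg= F rv refl) rv≡
          i≡ = predecessor u≡ one′
      in
      by ▹ λ { _ refl → pushing {v = 3} one′ (cong₂ _+_ (cong₂ _+_ one′ one′) one′) (retape refl refl t′) ▹ λ { {s₂} F₁ (_ , t₁) →
      let one₁ = trans (reg= F₁ rOne refl) one′
          v₁ = trans (reg= F₁ rv refl) v′
      in
      by ▹ λ { G₂ refl → pushing {v = v + v + 1} one₁ (cong₂ _+_ (cong₂ _+_ v₁ v₁) one₁) (retape {s = s₂} refl refl t₁) ▹ λ { {s₃} H₂ (_ , t₂) →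
      let F₂ = F₁ ⊙ (G₂ ⊙ H₂)
          u₂ = trans (reg= F₂ ru refl) i≡
      in
      by ▹ λ { G₃ refl → pushing {v = i + i} (trans (reg= F₂ rOne refl) one′) (cong₂ _+_ u₂ u₂) (retape {s = s₃} refl refl t₂) ▹ λ { {s₄} H₃ (_ , t₃) →
      let F₃ = F₂ ⊙ (G₃ ⊙ H₃)
          one₃ = trans (reg= F₃ rOne refl) one′
      in
      by ▹ λ { G₄ refl → pushing {v = i + i + 1} one₃ (cong₂ _+_ (trans (reg= H₃ rt refl) (cong₂ _+_ u₂ u₂)) one₃) (retape {s = s₄} refl refl t₃) ▹ λ { {s₅} H₄ (_ , t₄) →
      let F₄ = F₃ ⊙ (G₄ ⊙ H₄) in
      conseq (λ { _ refl → trans (reg= F₄ ru refl) i≡ ,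
        (_ , retape {s = s₅} refl refl t₄ ,
          trans (one-more (((w′ ++ _) ++ _) ++ _) _) (trans (one-more ((w′ ++ _) ++ _) _)
            (trans (one-more (w′ ++ _) _) (trans (one-more w′ _) w≡)))) ,
        trans (cong₂ (λ m o → m + o + i) (reg= F₄ rm refl) (trans (reg= F₄ rOne refl) one′)) (trans (+-assoc (reg s₁ rm) 1 i) m≡) }) by }}}}}}}}

  addPads-run : ∀ {s K w m} → K ≤ Z → reg s rOne ≡ 1 → reg s r0 ≡ 0 → reg s rKS ≡ K → reg s rm ≡ m →
    Tape mF rF w s →
    Run addPads s 23 2 (λ s′ → Tape mF rF (w ++ concatMap encClause (pads K)) s′ × reg s′ rm ≡ m + K * K)
  addPads-run {s} {K} {w} {m} K≤Z one z KS≡ rm≡ t =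
    by ▹ λ { _ refl →
    conseq (λ { _ (t′ , m≡) → written t′ , trans (sym (+-identityʳ _)) m≡ })
      (for Inv K K≤Z (trans (cong₂ _+_ KS≡ z) (+-identityʳ K)) ((w , retape refl refl t , refl) , cong (_+ K * K) rm≡) body) }
    where
    W = w ++ concatMap encClause (pads K)
    Inv : ℕ → State → Set
    Inv i s′ = Writing mF rF (concatMap encClause (pads-from K i)) W s′ × reg s′ rm + i * K ≡ m + K * K
    body : ∀ i {s₁} → Frame _ _ s₁ → reg s₁ rv ≡ suc i → Inv (suc i) s₁ →
           Run ((rv := rv ⊖ rOne ⍮ ru := rKS ⊕ r0) ⍮ whilenz ru loop addPad) s₁ 20 1 (λ s₂ → reg s₂ rv ≡ i × Inv i s₂)
    body i {s₁} F v≡ ((w′ , t′ , w≡) , m≡) =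
      let one′ = trans (reg= F rOne refl) one
          i≡ = predecessor v≡ one′
      in
      by ▹ λ { _ refl →
      conseq (λ { G (t₁ , m₁≡) → trans (reg= G rv refl) i≡ ,
          (_ , t₁ , trans (++-assoc w′ _ _) (trans (cong (w′ ++_) (sym (concatMap-++ encClause (map (pad i) (downFrom K)) _))) w≡)) ,
          trans (cong (_+ i * K) m₁≡) (trans (+-assoc (reg s₁ rm) K (i * K)) m≡) })
        (addPads-inner K≤Z one′ i≡ (trans (cong₂ _+_ (trans (reg= F rKS refl) KS≡) (trans (reg= F r0 refl) z)) (+-identityʳ K))
          refl (retape refl refl t′)) }

  writeHeader-run : ∀ {s k m P} → k ≤ Z → m ≤ Z → reg s rOne ≡ 1 → reg s r0 ≡ 0 →
    reg s rK ≡ k → reg s rm ≡ m → reg s rP ≡ P → Tape mO rO [] s →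
    Run writeHeader s 25 1 (Tape mO rO (k ∷ m + 1 ∷ m ∷ spokes 0 m ++ [ k * P ]))
  writeHeader-run {s} {k} {m} {P} k≤Z m≤Z one z K≡ m≡ P≡ t =
    pushing one K≡ t ▹ λ { _ (refl , t₁) →
    by ▹ λ { _ refl → pushing {v = m + 1} one (cong₂ _+_ m≡ one) (retape refl refl t₁) ▹ λ { _ (refl , t₂) →
    pushing one m≡ t₂ ▹ λ { _ (refl , t₃) →
    by ▹ λ { _ refl →
    for Inv m m≤Z (trans (cong₂ _+_ m≡ z) (+-identityʳ m))
      (_ , retape refl refl t₃ , cong (λ j → k ∷ m + 1 ∷ m ∷ spokes j m) (cong₂ _+_ z z))
      (λ { i {s₁} F v≡ (w , t , w≡) →
        let one′ = trans (reg= F rOne refl) one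
            z′ = trans (reg= F r0 refl) z
        in by ▹ λ { _ refl → pushing one′ z′ (retape refl refl t) ▹ λ { _ (refl , t₁) →
           conseq (λ { _ (refl , t₂) → predecessor v≡ one′ , _ , t₂ ,
             trans (one-more (w ++ _) _) (trans (one-more w _) (trans (cong (λ o → w ++ 0 ∷ reg s₁ rJ + 1 ∷ spokes (reg s₁ rJ + o) i) one′) w≡)) })
             (pushing one′ (cong (reg s₁ rJ +_) one′) t₁) }} }) ▹ λ F t₄ →
    by ▹ λ { _ refl →
    let K′ = trans (reg= F rK refl) K≡ ; z′ = trans (reg= F r0 refl) z in
    for (λ i s′ → reg s′ rt + i * P ≡ k * P) k k≤Z (trans (cong₂ _+_ K′ z′) (+-identityʳ k)) (cong (_+ k * P) (cong₂ _+_ z′ z′))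
      (λ { i {s₁} G v≡ t≡ → conseq (λ { _ refl →
             predecessor v≡ (trans (reg= G rOne refl) (trans (reg= F rOne refl) one)) ,
             trans (cong (λ p → reg s₁ rt + p + i * P) (trans (reg= G rP refl) (trans (reg= F rP refl) P≡)))
               (trans (+-assoc (reg s₁ rt) P (i * P)) t≡) }) by }) ▹ λ G t≡ →
    conseq (λ { _ (_ , t₅) → t₅ })
      (pushing (trans (reg= G rOne refl) (trans (reg= F rOne refl) one)) (trans (sym (+-identityʳ _)) t≡)
        (tape (trans (reg= G rO refl) (end (written t₄))) (λ i → trans (mem= G mO refl i) (cells (written t₄) i)))) }}}}}}
    where
    Inv : ℕ → State → Set
    Inv i s′ = Writing mO rO (spokes (reg s′ rJ) i) (k ∷ m + 1 ∷ m ∷ spokes 0 m) s′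

  length-table : ∀ {t} (bs : Vec Bool t) → length (table bs) ≡ t + t
  length-table []                   = refl
  length-table {suc t} (true  ∷ bs) = cong suc (trans (cong suc (length-table bs)) (sym (+-suc t t)))
  length-table {suc t} (false ∷ bs) = cong suc (trans (cong suc (length-table bs)) (sym (+-suc t t)))

  tabulateBits-run : ∀ {s S P M w} → S ≤ Z → reg s rOne ≡ 1 → reg s r0 ≡ 0 → reg s rS ≡ S →
    reg s rP ≡ P → reg s rM ≡ M → Tape mT rL w s →
    Run tabulateBits s 14 1 (Tape mT rL (w ++ table (bits P S M)))
  tabulateBits-run {s} {S} {P} {M} {w} S≤Z one z S≡ P≡ M≡ t =
    by ▹ λ { _ refl →
    conseq (λ _ → written) (for Inv S S≤Z (trans (cong₂ _+_ S≡ z) (+-identityʳ S))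
      (w , retape refl refl t , cong (λ x → w ++ table (bits P S x)) (trans (cong₂ _+_ M≡ z) (+-identityʳ M)))
      (λ { i {s₁} F j≡ (w′ , t′ , w≡) →
         let one′ = trans (reg= F rOne refl) one
             z′ = trans (reg= F r0 refl) z
             P′ = trans (reg= F rP refl) P≡
         in by ▹ λ { _ refl → conseq (λ G I → trans (reg= G rj refl) (predecessor j≡ one′) , I)
              (branch _ _ one′ z′ P′ (cong₂ _∸_ (cong (reg s₁ rx + reg s₁ rx +_) one′) P′) refl (retape refl refl t′) w≡) } })) }
    where
    W = w ++ table (bits P S M)
    Inv : ℕ → State → Set
    Inv i s′ = Writing mT rL (table (bits P i (reg s′ rx))) W s′
    branch : ∀ {s i w} y d → reg s rOne ≡ 1 → reg s r0 ≡ 0 → reg s rP ≡ P → reg s rd ≡ d → reg s rx ≡ y →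
             Tape mT rL w s → w ++ table (nz d ∷ bits P i (if nz d then y ∸ P else y)) ≡ W →
             Run (ifnz rd then (rx := rx ⊖ rP ⍮ push mT rL r0 ⍮ push mT rL rOne)
                          else (push mT rL rOne ⍮ push mT rL r0)) s 6 0 (Inv i)
    branch {w = w} y zero one z P≡ d≡ refl t w≡ =
      weaken (n≤1+n 5) (branch-z d≡ (pushing one one t ▹ λ { _ (refl , t₁) → conseq (λ { _ (refl , t₂) →
        _ , t₂ , trans (one-more (w ++ _) _) (trans (one-more w _) w≡) }) (pushing one z t₁) }))
    branch {s} {i} {w} y (suc d) one z P≡ d≡ refl t w≡ =
      branch-nz (λ e → 1+n≢0 (trans (sym d≡) e)) (by ▹ λ { _ refl →
        pushing one z (retape refl refl t) ▹ λ { _ (refl , t₁) → conseq (λ { _ (refl , t₂) →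
        _ , t₂ , trans (one-more (w ++ _) _) (trans (one-more w _)
          (trans (cong (λ p → w ++ 0 ∷ 1 ∷ table (bits P i (reg s rx ∸ p))) P≡) w≡)) }) (pushing one one t₁) }})

  -- The counterpart of `Writing` for input: the word still to be read starts at the pointer p.
  At : (ℕ → ℕ) → ℕ → List ℕ → Set
  At φ p w = ∀ a → φ (p + a) ≡ contents w a

  at-head : ∀ {φ p x w} → At φ p (x ∷ w) → φ p ≡ x
  at-head {φ} {p} at = trans (cong φ (sym (+-identityʳ p))) (at 0)

  at-tail : ∀ {φ p q x w} → q ≡ p + 1 → At φ p (x ∷ w) → At φ q w
  at-tail {φ} {p} refl at a = trans (cong φ (+-assoc p 1 a)) (at (suc a))

  select : ℕ → ℕ → List ℕ
  select h J = if nz h then [ J ] else []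

  select-run : ∀ {s h w} → reg s rOne ≡ 1 → reg s rSat ≡ h → Tape mO rO w s →
    Run (ifnz rSat then (push mO rO rJ ⍮ rCnt := rCnt ⊕ rOne) else skip) s 4 0 (λ s′ →
      Tape mO rO (w ++ select h (reg s rJ)) s′ × reg s′ rCnt ≡ reg s rCnt + length (select h (reg s rJ)))
  select-run {s} {zero} {w} one h≡ t = weaken (s≤s (s≤s z≤n)) (branch-z h≡ (conseq (λ { _ refl →
    subst (λ w → Tape mO rO w s) (sym (++-identityʳ w)) t , sym (+-identityʳ _) }) by))
  select-run {s} {suc h} one h≡ t = branch-nz (λ e → 1+n≢0 (trans (sym h≡) e))
    (pushing one refl t ▹ λ { _ (refl , t₁) → conseq (λ { _ refl → retape refl refl t₁ , cong (reg s rCnt +_) one }) by })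

  writeMember-run : ∀ {s φ τ c rest w} → length c ≤ Z → reg s rOne ≡ 1 → reg s r0 ≡ 0 →
    (∀ i → mem s mF i ≡ φ i) → (∀ i → mem s mT i ≡ τ i) →
    At φ (reg s rPtr) (encClause c ++ rest) → Tape mO rO w s →
    Run writeMember s 15 1 (λ s′ → At φ (reg s′ rPtr) rest × reg s′ rJ ≡ reg s rJ + 1 ×
      Tape mO rO (w ++ select (hits τ c) (reg s rJ)) s′ ×
      reg s′ rCnt ≡ reg s rCnt + length (select (hits τ c) (reg s rJ)))
  writeMember-run {s} {φ} {τ} {c} {rest} {w} c≤Z one z F≡ T≡ at t =
    by ▹ λ { _ refl →
    for Inv (length c) c≤Z (trans (F≡ _) (at-head {φ} at))
      (c , refl , at-tail {φ} (cong (reg s rPtr +_) one) at , cong (_+ hits τ c) (cong₂ _+_ z z)) body ▹ λ { F ([] , _ , at₁ , sat≡) →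
    select-run {h = hits τ c} (trans (reg= F rOne refl) one) (trans (sym (+-identityʳ _)) sat≡)
      (carry F refl refl (retape refl refl t)) ▹ λ G (t₂ , cnt≡) →
    conseq (λ { _ refl →
      subst (λ p → At φ p rest) (sym (reg= G rPtr refl)) at₁ ,
      cong₂ _+_ (trans (reg= G rJ refl) (reg= F rJ refl)) (trans (reg= G rOne refl) (trans (reg= F rOne refl) one)) ,
      subst (λ J → Tape mO rO (w ++ select (hits τ c) J) _) (reg= F rJ refl) (retape refl refl t₂) ,
      trans cnt≡ (cong₂ (λ n J → n + length (select (hits τ c) J)) (reg= F rCnt refl) (reg= F rJ refl)) }) by } }
    where
    Inv : ℕ → State → Set
    Inv i s′ = ∃[ ls ] length ls ≡ i × At φ (reg s′ rPtr) (ls ++ rest) × reg s′ rSat + hits τ ls ≡ hits τ c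
    body : ∀ i {s₁} → Frame _ _ s₁ → reg s₁ rc ≡ suc i → Inv (suc i) s₁ → Run _ s₁ 5 0 (λ s₂ → reg s₂ rc ≡ i × Inv i s₂)
    body i {s₁} F c≡ (l ∷ ls , l≡ , at , sat≡) =
      let one′ = trans (reg= F rOne refl) one in
      conseq (λ { _ refl → predecessor c≡ one′ , ls , suc-injective l≡ , at-tail {φ} (cong (reg s₁ rPtr +_) one′) at ,
        trans (cong (λ x → reg s₁ rSat + x + hits τ ls)
                (trans (trans (mem= F mT refl _) (T≡ _)) (cong τ (trans (trans (mem= F mF refl _) (F≡ _)) (at-head {φ} at)))))
          (trans (+-assoc (reg s₁ rSat) (τ l) (hits τ ls)) sat≡) }) by

  writeSet-run : ∀ {s φ τ cs w} → length cs ≤ Z → All (λ c → length c ≤ Z) cs → reg s rOne ≡ 1 → reg s r0 ≡ 0 →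
    reg s rm ≡ length cs → (∀ i → mem s mF i ≡ φ i) → (∀ i → mem s mT i ≡ τ i) →
    At φ 2 (concatMap encClause cs) → Tape mO rO w s →
    Run writeSet s 28 2 (Tape mO rO (w ++ encSet τ cs))
  writeSet-run {s} {φ} {τ} {cs} {w} cs≤Z widths one z m≡ F≡ T≡ at t =
    by ▹ λ { _ refl → pushing one z (retape refl refl t) ▹ λ { _ (refl , t₁) →
    pushing one z t₁ ▹ λ { _ (refl , t₂) → by ▹ λ { _ refl →
    for Inv (length cs) cs≤Z (trans (cong₂ _+_ m≡ z) (+-identityʳ _))
      (cs , [ 0 ] , refl , widths , subst (λ p → At φ p (concatMap encClause cs)) (sym (cong₂ _+_ one one)) at ,
       subst (λ w → Tape mO rO w _) (++-assoc w [ 0 ] [ 0 ]) (retape refl refl t₂) ,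
       cong₂ _+_ one z , cong (λ J → 0 ∷ members τ J cs) (cong₂ _+_ one z))
      body ▹ λ { G ([] , acc , _ , _ , _ , t₃ , cnt≡ , acc≡) →
    conseq (λ { {s′} _ refl →
      let pos≡ = trans (reg= G rPos refl) (trans (cong₂ _+_ (end t) z) (+-identityʳ _))
          acc≡′ = trans (sym (++-identityʳ acc)) acc≡
      in subst (λ ms → Tape mO rO (w ++ length ms ∷ ms) s′) acc≡′
           (tape (trans (end t₃) (trans (length-++ w) (sym (length-++ w))))
                 (λ i → trans (update-cong _ (contents (w ++ 0 ∷ acc)) pos≡ cnt≡ (cells t₃) i)
                              (contents-patch w 0 (length acc) acc i))) }) by } }}}}
    where
    Inv : ℕ → State → Set
    Inv i s′ = ∃[ rem ] ∃[ acc ] length rem ≡ i × All (λ c → length c ≤ Z) rem ×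
      At φ (reg s′ rPtr) (concatMap encClause rem) × Tape mO rO (w ++ 0 ∷ acc) s′ × reg s′ rCnt ≡ length acc ×
      acc ++ members τ (reg s′ rJ) rem ≡ 0 ∷ members τ 1 cs
    body : ∀ i {s₁} → Frame _ _ s₁ → reg s₁ rj ≡ suc i → Inv (suc i) s₁ →
           Run (rj := rj ⊖ rOne ⍮ writeMember) s₁ 16 1 (λ s₂ → reg s₂ rj ≡ i × Inv i s₂)
    body i {s₁} F j≡ (c ∷ rem , acc , l≡ , wc ∷ wrem , at , t , cnt≡ , acc≡) =
      let one′ = trans (reg= F rOne refl) one in
      by ▹ λ { _ refl → conseq (λ { {s₂} G (at₁ , J≡ , t₁ , cnt₁≡) →
        trans (reg= G rj refl) (predecessor j≡ one′) ,
        rem , acc ++ select (hits τ c) (reg s₁ rJ) , suc-injective l≡ , wrem , at₁ ,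
        subst (λ w → Tape mO rO w s₂) (++-assoc w (0 ∷ acc) _) t₁ ,
        trans cnt₁≡ (trans (cong (_+ length (select (hits τ c) (reg s₁ rJ))) cnt≡) (sym (length-++ acc))) ,
        trans (++-assoc acc _ _) (trans (cong (λ J → acc ++ select (hits τ c) (reg s₁ rJ) ++ members τ J rem) J≡) acc≡) })
        (writeMember-run {φ = φ} {τ} {c} wc one′ (trans (reg= F r0 refl) z)
          (λ a → trans (mem= F mF refl a) (F≡ a)) (λ a → trans (mem= F mT refl a) (T≡ a)) at (retape refl refl t)) }

  cleared : ∀ (f : ℕ → ℕ) q {v} a → v ≡ 0 → (q ≢ a → f a ≡ 0) → (f [ q ↦ v ]) a ≡ 0
  cleared f q a v≡0 h with q ≡ᵇ a in eq
  ... | true  = v≡0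
  ... | false = h (λ q≡a → subst T eq (≡⇒≡ᵇ q a q≡a))

  -- Only the cells outside the block are known to be zero. Clearing from the top lets this region
  -- grow downwards by two cells per round until it is everything.
  clearBits-run : ∀ {s S B} → S ≤ Z → reg s rOne ≡ 1 → reg s r0 ≡ 0 → reg s rS ≡ S → reg s rL ≡ B + (S + S) →
    (∀ a → a < B ⊎ B + (S + S) ≤ a → mem s mT a ≡ 0) →
    Run clearBits s 8 1 (λ s′ → reg s′ rL ≡ B × (∀ a → mem s′ mT a ≡ 0))
  clearBits-run {s} {S} {B} S≤Z one z S≡ L≡ T≡ =
    by ▹ λ { _ refl →
    conseq (λ { _ (L≡ , T≡) → trans L≡ (+-identityʳ B) , λ a → T≡ a (below a) })
      (for Inv S S≤Z (trans (cong₂ _+_ S≡ z) (+-identityʳ S)) (L≡ , T≡) body) }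
    where
    below : ∀ a → a < B ⊎ B + 0 ≤ a
    below a with ≤-total B a
    ... | inj₁ B≤a = inj₂ (subst (_≤ a) (sym (+-identityʳ B)) B≤a)
    ... | inj₂ a≤B with m≤n⇒m<n∨m≡n a≤B
    ...   | inj₁ a<B = inj₁ a<B
    ...   | inj₂ a≡B = inj₂ (≤-reflexive (trans (+-identityʳ B) (sym a≡B)))
    Inv : ℕ → State → Set
    Inv i s′ = reg s′ rL ≡ B + (i + i) × (∀ a → a < B ⊎ B + (i + i) ≤ a → mem s′ mT a ≡ 0)
    body : ∀ i {s₁} → Frame _ _ s₁ → reg s₁ rj ≡ suc i → Inv (suc i) s₁ → Run _ s₁ 5 0 (λ s₂ → reg s₂ rj ≡ i × Inv i s₂)
    body i {s₁} F j≡ (L≡ , T≡) = conseq (λ { _ refl → predecessor j≡ one′ , L₂≡ , clear }) by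
      where
      one′ = trans (reg= F rOne refl) one
      z′ = trans (reg= F r0 refl) z
      L₁ = reg s₁ rL ∸ reg s₁ rOne
      L₂ = L₁ ∸ reg s₁ rOne
      L₁≡ : L₁ ≡ suc (B + (i + i))
      L₁≡ = predecessor (trans L≡ (trans (cong (B +_) (cong suc (+-suc i i))) (trans (+-suc B _) (cong suc (+-suc B _))))) one′
      L₂≡ : L₂ ≡ B + (i + i)
      L₂≡ = predecessor L₁≡ one′
      clear : ∀ a → a < B ⊎ B + (i + i) ≤ a → _
      clear a side = cleared (mem s₁ mT [ L₁ ↦ reg s₁ r0 ]) L₂ a z′ (λ a≢L₂ → cleared (mem s₁ mT) L₁ a z′ (λ a≢L₁ → T≡ a (farther side a≢L₂ a≢L₁)))
        where
        farther : a < B ⊎ B + (i + i) ≤ a → L₂ ≢ a → L₁ ≢ a → a < B ⊎ B + suc (i + suc i) ≤ a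
        farther (inj₁ a<B) _ _ = inj₁ a<B
        farther (inj₂ ≤a) a≢L₂ a≢L₁ = inj₂ (subst (_≤ a)
          (sym (trans (cong (B +_) (cong suc (+-suc i i))) (trans (+-suc B _) (cong suc (+-suc B _)))))
          (≤∧≢⇒< (≤∧≢⇒< ≤a (λ e → a≢L₂ (trans L₂≡ e))) (λ e → a≢L₁ (trans L₁≡ e))))

  writeFamily-run : ∀ {s φ k S P cs w} → k ≤ Z → P ≤ Z → S ≤ Z → length cs ≤ Z → All (λ c → length c ≤ Z) cs →
    reg s rOne ≡ 1 → reg s r0 ≡ 0 → reg s rK ≡ k → reg s rS ≡ S → reg s rKS ≡ S * k → reg s rP ≡ P →
    reg s rm ≡ length cs → (∀ i → mem s mF i ≡ φ i) → (∀ a → mem s mT a ≡ 0) →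
    At φ 2 (concatMap encClause cs) → Tape mO rO w s →
    Run writeFamily s 61 4 (Tape mO rO (w ++ concatMap (encGroup S P cs) (downFrom k)))
  writeFamily-run {s} {φ} {k} {S} {P} {cs} {w} k≤Z P≤Z S≤Z cs≤Z widths one z K≡ S≡ KS≡ P≡ m≡ F≡ T≡ at t =
    by ▹ λ { _ refl →
    conseq (λ { _ (t , _) → written t })
      (for Inv k k≤Z (trans (cong₂ _+_ K≡ z) (+-identityʳ k))
        ((w , retape refl refl t , refl) , trans (cong₂ _+_ KS≡ KS≡) 2kS≡ , T≡ , cong₂ _+_ S≡ S≡) outer) }
    where
    W = w ++ concatMap (encGroup S P cs) (downFrom k)
    2kS≡ : S * k + S * k ≡ k * (S + S)
    2kS≡ = trans (sym (*-distribʳ-+ k S S)) (*-comm (S + S) k)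
    Inv : ℕ → State → Set
    Inv i s′ = Writing mO rO (concatMap (encGroup S P cs) (downFrom i)) W s′ × reg s′ rL ≡ i * (S + S) ×
               (∀ a → mem s′ mT a ≡ 0) × reg s′ rS2 ≡ S + S
    outer : ∀ g {s₁} → Frame _ _ s₁ → reg s₁ rI ≡ suc g → Inv (suc g) s₁ → Run _ s₁ 56 3 (λ s₂ → reg s₂ rI ≡ g × Inv g s₂)
    outer g {s₁} F I≡ ((w₁ , t₁ , w₁≡) , L≡ , T₁≡ , S2≡) =
      by ▹ λ { _ refl →
      conseq (λ { H (t₂ , L₂≡ , T₂≡) → trans (reg= H rI refl) (predecessor I≡ one′) , t₂ , L₂≡ , T₂≡ , trans (reg= H rS2 refl) S2≡ })
        (for Inv′ P P≤Z (trans (cong₂ _+_ (trans (reg= F rP refl) P≡) z′) (+-identityʳ P))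
          ((w₁ , retape refl refl t₁ , w₁≡) , trans (cong₂ _∸_ L≡ S2≡) (m+n∸m≡n (S + S) B) , T₁≡) inner) }
      where
      one′ = trans (reg= F rOne refl) one
      z′ = trans (reg= F r0 refl) z
      B = g * (S + S)
      rest = concatMap (encGroup S P cs) (downFrom g)
      Inv′ : ℕ → State → Set
      Inv′ i s′ = Writing mO rO (concatMap (λ M → encSet (truth S P g M) cs) (downFrom i) ++ rest) W s′ ×
                  reg s′ rL ≡ B × (∀ a → mem s′ mT a ≡ 0)
      inner : ∀ M {s₂} → Frame _ _ s₂ → reg s₂ rM ≡ suc M → Inv′ (suc M) s₂ → Run _ s₂ 51 2 (λ s₃ → reg s₃ rM ≡ M × Inv′ M s₃)
      inner M {s₂} G M≡ ((w₂ , t₂ , w₂≡) , L₂≡ , T₂≡) =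
        by ▹ λ { _ refl →
        tabulateBits-run {w = replicate B 0} S≤Z one″ z″ S″ P″ M″
          (tape (trans L₂≡ (sym (length-replicate B))) (λ i → trans (T₂≡ i) (sym (contents-zeros B i)))) ▹ λ H₁ u₁ →
        writeSet-run {φ = φ} {truth S P g M} cs≤Z widths (trans (reg= H₁ rOne refl) one″) (trans (reg= H₁ r0 refl) z″)
          (trans (reg= H₁ rm refl) (trans (reg= G rm refl) (trans (reg= F rm refl) m≡)))
          (λ a → trans (mem= H₁ mF refl a) (trans (mem= G mF refl a) (trans (mem= F mF refl a) (F≡ a))))
          (cells u₁) at (carry H₁ refl refl (retape {s = s₂} refl refl t₂)) ▹ λ H₂ t₃ →
        let H = H₁ ⊙ H₂ in
        conseq (λ { H₃ (L≡ , T≡) →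
            trans (reg= (H ⊙ H₃) rM refl) M″ ,
            (_ , carry H₃ refl refl t₃ ,
             trans (++-assoc w₂ (encSet (truth S P g M) cs) _)
               (trans (cong (w₂ ++_) (sym (++-assoc (encSet (truth S P g M) cs) _ rest))) w₂≡)) ,
            L≡ , T≡ })
          (clearBits-run S≤Z (trans (reg= H rOne refl) one″) (trans (reg= H r0 refl) z″) (trans (reg= H rS refl) S″)
            (trans (reg= H₂ rL refl) (trans (end u₁) |word|))
            (λ a → λ { (inj₁ a<B) → trans (mem= H₂ mT refl a) (trans (cells u₁ a)
                         (trans (contents-++ˡ (replicate B 0) (subst (a <_) (sym (length-replicate B)) a<B)) (contents-zeros B a)))
                     ; (inj₂ ≤a) → trans (mem= H₂ mT refl a) (trans (cells u₁ a)
                         (contents-beyond (replicate B 0 ++ table (bits P S M)) (subst (_≤ a) (sym |word|) ≤a))) })) }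
        where
        one″ = trans (reg= G rOne refl) one′
        z″ = trans (reg= G r0 refl) z′
        S″ = trans (reg= G rS refl) (trans (reg= F rS refl) S≡)
        P″ = trans (reg= G rP refl) (trans (reg= F rP refl) P≡)
        M″ = predecessor M≡ one″
        |word| : length (replicate B 0 ++ table (bits P S M)) ≡ B + (S + S)
        |word| = trans (length-++ (replicate B 0)) (cong₂ _+_ (length-replicate B) (length-table (bits P S M)))

  -- 121 = 12 + 23 + 25 + 61 adds up the four parts; the exponent 4 is the depth of loops in
  -- `writeFamily`.
  reduction-run : ∀ k n {S} cls .{{_ : NonZero k}} → S ≡ suc (n / k) →
    let cs = cls ++ pads (S * k) in
    k ≤ Z → S ≤ Z → S * k ≤ Z → 2 ^ S ≤ Z → length cs ≤ Z → All (λ c → length c ≤ Z) cs →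
    Run (reduction k) (initial (n ∷ length cls ∷ concatMap encClause cls)) 121 4
      (Tape mO rO (coverWord k S cs))
  reduction-run k n cls refl k≤Z S≤Z K≤Z P≤Z cs≤Z widths =
    setup-run {k} {n} S≤Z refl refl refl refl refl ▹ λ { F₁ (one , K≡ , m≡ , S≡ , KS≡ , P≡) →
    addPads-run K≤Z one (reg= F₁ r0 refl) KS≡ m≡ (tape (reg= F₁ rF refl) (mem= F₁ mF refl)) ▹ λ { F₂ (t₂ , m₂≡) →
    let one₂ = trans (reg= F₂ rOne refl) one
        z₂ = trans (reg= F₂ r0 refl) (reg= F₁ r0 refl)
        K₂ = trans (reg= F₂ rK refl) K≡
        S₂ = trans (reg= F₂ rS refl) S≡
        KS₂ = trans (reg= F₂ rKS refl) KS≡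
        P₂ = trans (reg= F₂ rP refl) P≡
        M≡ = trans m₂≡ (trans (cong (length cls +_) (sym (length-pads (suc (n / k) * k)))) (sym (length-++ cls)))
    in
    writeHeader-run k≤Z cs≤Z one₂ z₂ K₂ M≡ P₂
      (tape (reg= (F₁ ⊙ F₂) rO refl) (mem= (F₁ ⊙ F₂) mO refl)) ▹ λ F₃ t₃ →
    writeFamily-run {φ = contents (n ∷ length cls ∷ concatMap encClause cls ++ concatMap encClause (pads (suc (n / k) * k)))}
      k≤Z P≤Z S≤Z cs≤Z widths (trans (reg= F₃ rOne refl) one₂) (trans (reg= F₃ r0 refl) z₂)
      (trans (reg= F₃ rK refl) K₂) (trans (reg= F₃ rS refl) S₂) (trans (reg= F₃ rKS refl) KS₂) (trans (reg= F₃ rP refl) P₂)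
      (trans (reg= F₃ rm refl) M≡) (λ a → trans (mem= F₃ mF refl a) (cells t₂ a))
      (λ a → mem= (F₁ ⊙ (F₂ ⊙ F₃)) mT refl a)
      (λ a → cong (λ w → contents w a) (sym (concatMap-++ encClause cls _))) t₃ }}

-- Stars: connectivity, plane drawing, list of edges

star : ∀ m → Graph (suc m)
star m = record { adj = adj ; sym = symmetric ; irrefl = irreflexive }
  where
  adj : Fin (suc m) → Fin (suc m) → Bool
  adj zero    (suc _) = true
  adj (suc _) zero    = true
  adj _       _       = false
  symmetric : ∀ u v → adj u v ≡ adj v u
  symmetric zero    zero    = refl
  symmetric zero    (suc v) = refl
  symmetric (suc u) zero    = refl
  symmetric (suc u) (suc v) = refl
  irreflexive : ∀ v → adj v v ≡ false
  irreflexive zero    = refl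
  irreflexive (suc v) = refl

star-connected : ∀ {m} {S : Subset (suc m)} → zero Subset.∈ S → InducesConnected (star m) S
star-connected {m} {S} 0∈S = (zero , 0∈S) , path
  where
  path : ∀ {u v} → u Subset.∈ S → v Subset.∈ S → Star (λ x y → x Subset.∈ S × y Subset.∈ S × Graph.Adj (star m) x y) u v
  path {zero}  {zero}  u∈ v∈ = stay
  path {zero}  {suc v} u∈ v∈ = (u∈ , v∈ , tt) ◅ stay
  path {suc u} {zero}  u∈ v∈ = (u∈ , v∈ , tt) ◅ stay
  path {suc u} {suc v} u∈ v∈ = (u∈ , 0∈S , tt) ◅ (0∈S , v∈ , tt) ◅ stay

-- The centre is the origin and leaf i is (1, i), so spoke i consists of multiples of (1, i). Away
-- from the origin the slope determines the spoke.
star-planar : ∀ m → Planar (star m)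
star-planar m = record
  { position  = position
  ; bends     = λ _ → []
  ; injective = injective
  ; arcs      = arcs
  ; avoids    = avoids
  ; disjoint  = disjoint
  }
  where
  open Graph (star m) using (Edge; Edge?)

  height : ∀ {m} → Fin m → ℚ
  height i = fromℤ (ℤ.+ (toℕ i))

  height-injective : ∀ {n} {i j : Fin n} → height i ≡ height j → i ≡ j
  height-injective {i = i} {j} e = toℕ-injective (ℤₚ.+-injective (cong ℚ.numerator e))

  position : Fin (suc m) → Point
  position zero    = 0ℚ , 0ℚ
  position (suc i) = 1ℚ , height i

  injective : ∀ {u v} → position u ≡ position v → u ≡ v
  injective {zero}  {zero}  _ = refl
  injective {suc u} {suc v} e = cong suc (height-injective (cong proj₂ e))

  ray : ∀ {p} i → OnCurve p (position zero ∷ [ position (suc i) ]) → ∃[ s ] p ≡ (s , s ℚ.* height i)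
  ray i (inj₁ (s , _ , _ , x , y)) = s , cong₂ _,_
    (trans x (trans (ℚₚ.+-identityˡ _) (ℚₚ.*-identityʳ s)))
    (trans y (trans (ℚₚ.+-identityˡ _) (cong (s ℚ.*_) (ℚₚ.+-identityʳ (height i)))))
  ray i (inj₂ p≡) = 1ℚ , trans p≡ (cong (1ℚ ,_) (sym (ℚₚ.*-identityˡ (height i))))

  segment : Fin (suc m) × Fin (suc m) → List Point
  segment (u , v) = position u ∷ [ position v ]

  arcs : ∀ {e} → Edge e → IsArc (segment e)
  arcs {zero , suc i} _ = (λ ()) , (λ _ _ p≡ → p≡) , tt
  arcs {suc i , zero} (() , _)
  arcs {suc i , suc j} (_ , ())

  avoids : ∀ {u v} → Edge (u , v) → ∀ w → OnCurve (position w) (segment (u , v)) → w ≡ u ⊎ w ≡ v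
  avoids {zero}  {suc i} _ zero    _ = inj₁ refl
  avoids {zero}  {suc i} _ (suc w) on with ray {position (suc w)} i on
  ... | s , eq = inj₂ (cong suc (height-injective
    (trans (cong proj₂ eq) (trans (cong (ℚ._* height i) (sym (cong proj₁ eq))) (ℚₚ.*-identityˡ (height i))))))
  avoids {suc i} {zero} (() , _)
  avoids {suc i} {suc j} (_ , ())

  cancel : ∀ s {x y} → s ≢ 0ℚ → s ℚ.* x ≡ s ℚ.* y → x ≡ y
  cancel s {x} {y} s≢0 e = trans (sym (undo x)) (trans (cong ((ℚ.1/ s) ℚ.*_) e) (undo y))
    where
    instance _ = ℚ.≢-nonZero s≢0
    undo : ∀ z → (ℚ.1/ s) ℚ.* (s ℚ.* z) ≡ z
    undo z = trans (sym (ℚₚ.*-assoc (ℚ.1/ s) s z)) (trans (cong (ℚ._* z) (ℚₚ.*-inverseˡ s)) (ℚₚ.*-identityˡ z))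

  disjoint : ∀ {e e′} → Edge e → Edge e′ → e ≢ e′ → ∀ p → OnCurve p (segment e) → OnCurve p (segment e′) → ∃[ w ] p ≡ position w
  disjoint {zero , suc i} {zero , suc j} _ _ e≢ p on on′ with ray {p} i on | ray {p} j on′
  ... | s , refl | s′ , eq′ with s ℚ.≟ 0ℚ
  ...   | yes refl = zero , cong (0ℚ ,_) (ℚₚ.*-zeroˡ (height i))
  ...   | no s≢0   = contradiction (cong (λ i → zero , suc i) (height-injective (cancel s s≢0
                       (trans (cong proj₂ eq′) (cong (ℚ._* height j) (sym (cong proj₁ eq′))))))) e≢
  disjoint {suc i , zero} (() , _)
  disjoint {suc i , suc j} (_ , ())
  disjoint {zero , zero} (_ , ())
  disjoint {zero , suc i} {zero , zero} _ (_ , ())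
  disjoint {zero , suc i} {suc j , zero} _ (() , _)
  disjoint {zero , suc i} {suc j , suc j′} _ (_ , ())

-- The centre has the smallest number, so each edge is listed from it and the rows of the leaves
-- contribute nothing.
star-edges : ∀ m → Graph.edges (star m) ≡ tabulate (λ i → zero , suc i)
star-edges m = begin
  filter Edge? (map (zero ,_) (allFin (suc m)) ++ cartesianProduct (tabulate suc) (allFin (suc m)))
    ≡⟨ filter-++ Edge? (map (zero ,_) (allFin (suc m))) _ ⟩
  filter Edge? (map (zero ,_) (tabulate suc)) ++ filter Edge? (cartesianProduct (tabulate suc) (allFin (suc m)))
    ≡⟨ cong₂ _++_ (cong (filter Edge?) (map-tabulate suc (zero ,_))) (filter-none Edge? (none (All.tabulate⁺ (λ i {v} → leaf i v)))) ⟩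
  filter Edge? (tabulate (λ i → zero , suc i)) ++ []
    ≡⟨ ++-identityʳ _ ⟩
  filter Edge? (tabulate (λ i → zero , suc i))
    ≡⟨ filter-all Edge? (All.tabulate⁺ (λ i → s≤s z≤n , tt)) ⟩
  tabulate (λ i → zero , suc i) ∎
  where
  open Graph (star m) using (Edge; Edge?)
  open ≡-Reasoning
  leaf : ∀ i v → ¬ Edge (suc i , v)
  leaf i zero    (() , _)
  leaf i (suc v) (_ , ())
  none : ∀ {us vs} → All (λ u → ∀ {v} → ¬ Edge (u , v)) us → All (¬_ ∘ Edge) (cartesianProduct us vs)
  none []                   = []
  none {vs = vs} (h ∷ hs) = All.++⁺ (All.map⁺ (All.universal (λ v → h {v}) vs)) (none hs)

spokes-tabulate : ∀ j m {n} (f : Fin m → Fin n) → (∀ i → toℕ (f i) ≡ j + toℕ i) →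
  concatMap {A = Fin (suc n) × Fin (suc n)} (λ (u , v) → toℕ u ∷ toℕ v ∷ []) (tabulate (λ i → zero , suc (f i))) ≡ spokes j m
spokes-tabulate j zero    f f≡ = refl
spokes-tabulate j (suc m) f f≡ = cong₂ (λ a r → 0 ∷ a ∷ r)
  (trans (cong suc (trans (f≡ zero) (+-identityʳ j))) (+-comm 1 j))
  (spokes-tabulate (j + 1) m (f ∘ suc) (λ i → trans (f≡ (suc i)) (sym (+-assoc j 1 (toℕ i)))))

star-spokes : ∀ m → concatMap (λ (u , v) → toℕ u ∷ toℕ v ∷ []) (Graph.edges (star m)) ≡ spokes 0 m
star-spokes m = trans (cong (concatMap _) (star-edges m)) (spokes-tabulate 0 m id (λ _ → refl))

length-star-edges : ∀ m → length (Graph.edges (star m)) ≡ m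
length-star-edges m = trans (cong length (star-edges m)) (length-tabulate _)

-- Encoding of subsets

elements : ∀ {n} → ℕ → Vec Bool n → List ℕ
elements j []           = []
elements j (true  ∷ bs) = j ∷ elements (j + 1) bs
elements j (false ∷ bs) = elements (j + 1) bs

filter-suc : ∀ {n b} (S : Subset n) (xs : List (Fin n)) →
             filter (_∈? (b ∷ S)) (map suc xs) ≡ map suc (filter (_∈? S) xs)
filter-suc S []       = refl
filter-suc {b = b} S (x ∷ xs) with x ∈? S
... | yes _ = cong (suc x ∷_) (filter-suc S xs)
... | no _  = filter-suc S xs

-- The offset j is general because the induction passes to the tail, where every index is smaller by
-- one.
elements-shift : ∀ {n} j (S : Subset n) → map (_+ j) (map toℕ (filter (_∈? S) (allFin n))) ≡ elements j S
elements-shift {zero}  j [] = refl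
elements-shift {suc n} j (b ∷ S) = go b
  where
  rest : ∀ b → map (_+ j) (map toℕ (filter (_∈? (b ∷ S)) (tabulate suc))) ≡ elements (j + 1) S
  rest b = begin
    map (_+ j) (map toℕ (filter (_∈? (b ∷ S)) (tabulate suc)))        ≡⟨ cong (map (_+ j) ∘ map toℕ ∘ filter (_∈? (b ∷ S))) (sym (map-tabulate id suc)) ⟩
    map (_+ j) (map toℕ (filter (_∈? (b ∷ S)) (map suc (allFin n))))  ≡⟨ cong (map (_+ j) ∘ map toℕ) (filter-suc S (allFin n)) ⟩
    map (_+ j) (map toℕ (map suc (filter (_∈? S) (allFin n))))        ≡⟨ shift (filter (_∈? S) (allFin n)) ⟩
    map (_+ (j + 1)) (map toℕ (filter (_∈? S) (allFin n)))            ≡⟨ elements-shift (j + 1) S ⟩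
    elements (j + 1) S                                                ∎
    where
    open ≡-Reasoning
    shift : ∀ (xs : List (Fin n)) → map (_+ j) (map toℕ (map suc xs)) ≡ map (_+ (j + 1)) (map toℕ xs)
    shift []       = refl
    shift (x ∷ xs) = cong₂ _∷_ (trans (sym (+-suc (toℕ x) j)) (cong (toℕ x +_) (+-comm 1 j))) (shift xs)
  go : ∀ b → map (_+ j) (map toℕ (filter (_∈? (b ∷ S)) (allFin (suc n)))) ≡ elements j (b ∷ S)
  go true  = cong (j ∷_) (rest true)
  go false = rest false

encodeSubset-elements : ∀ {n} (S : Subset n) → encodeSubset S ≡ length (elements 0 S) ∷ elements 0 S
encodeSubset-elements {n} S = cong₂ _∷_ (trans (sym (length-map toℕ (filter (_∈? S) (allFin n)))) (cong length eq)) eq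
  where
  eq : map toℕ (filter (_∈? S) (allFin n)) ≡ elements 0 S
  eq = trans (map-+0 (map toℕ (filter (_∈? S) (allFin n)))) (elements-shift 0 S)
    where
    map-+0 : ∀ xs → xs ≡ map (_+ 0) xs
    map-+0 []       = refl
    map-+0 (x ∷ xs) = cong₂ _∷_ (sym (+-identityʳ x)) (map-+0 xs)

-- Bits of a number

value : ∀ {t} → Vec Bool t → ℕ
value []               = 0
value {suc t} (b ∷ bs) = (if b then 2 ^ t else 0) + value bs

value< : ∀ {t} (bs : Vec Bool t) → value bs < 2 ^ t
value< []                   = s≤s z≤n
value< {suc t} (true  ∷ bs) = +-monoʳ-< (2 ^ t) (≤-trans (value< bs) (≤-reflexive (sym (+-identityʳ _))))
value< {suc t} (false ∷ bs) = ≤-trans (value< bs) (m≤m+n (2 ^ t) _)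

value-surjective : ∀ t r → r < 2 ^ t → ∃[ bs ] value {t} bs ≡ r
value-surjective zero    zero    _  = [] , refl
value-surjective zero    (suc r) (s≤s ())
value-surjective (suc t) r r< with r <? 2 ^ t
... | yes r<2^t = let bs , e = value-surjective t r r<2^t in false ∷ bs , e
... | no  r≮2^t =
  let 2^t≤r = ≮⇒≥ r≮2^t
      bs , e = value-surjective t (r ∸ 2 ^ t)
        (+-cancelˡ-< (2 ^ t) _ _ (subst₂ _<_ (sym (m+[n∸m]≡n 2^t≤r)) (cong (2 ^ t +_) (+-identityʳ _)) r<))
  in true ∷ bs , trans (cong (2 ^ t +_) e) (m+[n∸m]≡n 2^t≤r)

private
  bits-step : ∀ P t x {b y} → nz (x + x + 1 ∸ P) ≡ b → (if b then x + x ∸ P else x + x) ≡ y →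
              bits P (suc t) x ≡ b ∷ bits P t y
  bits-step P t x refl refl = refl

  -- `bits` doubles x and keeps P. After some digits both are therefore scaled by a common power of
  -- two relative to the remaining digits; the factor c carries this through the induction.
  bits-scaled : ∀ c t (bs : Vec Bool t) → 0 < c → bits (c * 2 ^ t) t (c * value bs) ≡ bs
  bits-scaled c zero    []       0<c = refl
  bits-scaled c (suc t) (b ∷ bs) 0<c = begin
    bits (c * 2 ^ suc t) (suc t) (c * value (b ∷ bs))  ≡⟨ bits-step _ t (c * value (b ∷ bs)) (bit b) (rest b) ⟩
    b ∷ bits (c * 2 ^ suc t) t ((c + c) * value bs)    ≡⟨ cong (λ P → b ∷ bits P t ((c + c) * value bs)) P≡ ⟩
    b ∷ bits ((c + c) * 2 ^ t) t ((c + c) * value bs)  ≡⟨ cong (b ∷_) (bits-scaled (c + c) t bs (≤-trans 0<c (m≤m+n c c))) ⟩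
    b ∷ bs                                             ∎
    where
    open ≡-Reasoning
    open +-*-Solver using (solve; _:=_; _:+_; _:*_; con)
    P = c * 2 ^ suc t
    x : Bool → ℕ
    x b = c * value (b ∷ bs)
    P≡ : P ≡ (c + c) * 2 ^ t
    P≡ = solve 2 (λ c p → c :* (p :+ (p :+ con 0)) := (c :+ c) :* p) refl c (2 ^ t)
    double-true : x true + x true ≡ P + (c + c) * value bs
    double-true = solve 3 (λ c p v → c :* (p :+ v) :+ c :* (p :+ v) := c :* (p :+ (p :+ con 0)) :+ (c :+ c) :* v) refl c (2 ^ t) (value bs)
    double-false : x false + x false ≡ (c + c) * value bs
    double-false = sym (*-distribʳ-+ (value bs) c c)
    bit : ∀ b → nz (x b + x b + 1 ∸ P) ≡ b
    bit true  = cong nz (trans (cong (λ y → y + 1 ∸ P) double-true)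
                  (trans (cong (_∸ P) (+-assoc P ((c + c) * value bs) 1)) (trans (m+n∸m≡n P _) (+-comm _ 1))))
    bit false = cong nz (trans (cong (λ y → y + 1 ∸ P) double-false) (m≤n⇒m∸n≡0
                  (subst₂ _≤_ (+-comm 1 _) (sym P≡)
                    (*-monoʳ-< (c + c) {{>-nonZero (≤-trans 0<c (m≤m+n c c))}} (value< bs)))))
    rest : ∀ b → (if b then x b + x b ∸ P else x b + x b) ≡ (c + c) * value bs
    rest true  = trans (cong (_∸ P) double-true) (m+n∸m≡n P _)
    rest false = double-false

bits-value : ∀ {t} (bs : Vec Bool t) → bits (2 ^ t) t (value bs) ≡ bs
bits-value {t} bs = trans (cong₂ (λ P x → bits P t x) (sym (*-identityˡ _)) (sym (*-identityˡ _))) (bits-scaled 1 t bs (s≤s z≤n))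

bits-injective : ∀ {t x y} → x < 2 ^ t → y < 2 ^ t → bits (2 ^ t) t x ≡ bits (2 ^ t) t y → x ≡ y
bits-injective {t} x< y< e with value-surjective t _ x< | value-surjective t _ y<
... | xs , refl | ys , refl = cong value (trans (sym (bits-value xs)) (trans e (bits-value ys)))

-- Literals and truth tables

literal : ℕ → Bool → ℕ
literal v true  = v + v + 1
literal v false = v + v

literal-suc : ∀ v b → literal (suc v) b ≡ suc (suc (literal v b))
literal-suc v true  = cong (λ z → suc z + 1) (+-suc v v)
literal-suc v false = cong suc (+-suc v v)

literal-injective : ∀ v w {a b} → literal v a ≡ literal w b → v ≡ w × a ≡ b
literal-injective zero    zero    {true}  {true}  e = refl , refl
literal-injective zero    zero    {false} {false} e = refl , refl
literal-injective zero    (suc w) {true}  {b} e with trans e (literal-suc w b)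
... | ()
literal-injective zero    (suc w) {false} {b} e with trans e (literal-suc w b)
... | ()
literal-injective (suc v) zero    {a} {true}  e with trans (sym e) (literal-suc v a)
... | ()
literal-injective (suc v) zero    {a} {false} e with trans (sym e) (literal-suc v a)
... | ()
literal-injective (suc v) (suc w) {a} {b} e =
  let v≡w , a≡b = literal-injective v w (suc-injective (suc-injective
        (trans (sym (literal-suc v a)) (trans e (literal-suc w b))))) in cong suc v≡w , a≡b

literal-offset : ∀ g S j b → g * (S + S) + literal j b ≡ literal (g * S + j) b
literal-offset g S j true  = solve 3 (λ g s j → g :* (s :+ s) :+ (j :+ j :+ con 1) := g :* s :+ j :+ (g :* s :+ j) :+ con 1) refl g S j
  where open +-*-Solver using (solve; _:=_; _:+_; _:*_; con)
literal-offset g S j false = solve 3 (λ g s j → g :* (s :+ s) :+ (j :+ j) := g :* s :+ j :+ (g :* s :+ j)) refl g S j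
  where open +-*-Solver using (solve; _:=_; _:+_; _:*_; con)

table⁺ : ∀ {t} (bs : Vec Bool t) j → contents (table bs) (literal (toℕ j) (lookup bs j)) ≡ 1
table⁺ (true  ∷ bs) zero    = refl
table⁺ (false ∷ bs) zero    = refl
table⁺ (true  ∷ bs) (suc j) rewrite literal-suc (toℕ j) (lookup bs j) = table⁺ bs j
table⁺ (false ∷ bs) (suc j) rewrite literal-suc (toℕ j) (lookup bs j) = table⁺ bs j

table⁻ : ∀ {t} (bs : Vec Bool t) ℓ → nz (contents (table bs) ℓ) ≡ true → ∃[ j ] ℓ ≡ literal (toℕ j) (lookup bs j)
table⁻ (true  ∷ bs) (suc zero) e = zero , refl
table⁻ (false ∷ bs) zero       e = zero , refl
table⁻ (true  ∷ bs) (suc (suc ℓ)) e =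
  let j , ℓ≡ = table⁻ bs ℓ e in suc j , trans (cong (2 +_) ℓ≡) (sym (literal-suc (toℕ j) (lookup bs j)))
table⁻ (false ∷ bs) (suc (suc ℓ)) e =
  let j , ℓ≡ = table⁻ bs ℓ e in suc j , trans (cong (2 +_) ℓ≡) (sym (literal-suc (toℕ j) (lookup bs j)))

zeros⁺ : ∀ B xs i → contents (replicate B 0 ++ xs) (B + i) ≡ contents xs i
zeros⁺ zero    xs i = refl
zeros⁺ (suc B) xs i = zeros⁺ B xs i

zeros⁻ : ∀ B xs ℓ → nz (contents (replicate B 0 ++ xs) ℓ) ≡ true → ∃[ i ] ℓ ≡ B + i × nz (contents xs i) ≡ true
zeros⁻ zero    xs ℓ       e = ℓ , refl , e
zeros⁻ (suc B) xs (suc ℓ) e = let i , ℓ≡ , e′ = zeros⁻ B xs ℓ e in i , cong suc ℓ≡ , e′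

truth⁺ : ∀ S P g M j → truth S P g M (literal (g * S + toℕ j) (lookup (bits P S M) j)) ≡ 1
truth⁺ S P g M j = trans (cong (truth S P g M) (sym (literal-offset g S (toℕ j) (lookup (bits P S M) j))))
  (trans (zeros⁺ (g * (S + S)) (table (bits P S M)) (literal (toℕ j) (lookup (bits P S M) j))) (table⁺ (bits P S M) j))

truth⁻ : ∀ S P g M ℓ → nz (truth S P g M ℓ) ≡ true → ∃[ j ] ℓ ≡ literal (g * S + toℕ j) (lookup (bits P S M) j)
truth⁻ S P g M ℓ e =
  let i , ℓ≡ , e′ = zeros⁻ (g * (S + S)) (table (bits P S M)) ℓ e
      j , i≡ = table⁻ (bits P S M) i e′
  in j , trans ℓ≡ (trans (cong (g * (S + S) +_) i≡) (literal-offset g S (toℕ j) (lookup (bits P S M) j)))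

hits⁺ : ∀ {τ c ℓ} → ℓ ∈ c → τ ℓ ≡ 1 → nz (hits τ c) ≡ true
hits⁺ (here refl) e rewrite e = refl
hits⁺ {τ} {x ∷ c} (there ℓ∈) e with τ x
... | zero  = hits⁺ ℓ∈ e
... | suc _ = refl

hits⁻ : ∀ {τ} c → nz (hits τ c) ≡ true → ∃[ ℓ ] ℓ ∈ c × nz (τ ℓ) ≡ true
hits⁻ {τ} (x ∷ c) e with τ x in eq
... | zero  = let ℓ , ℓ∈ , p = hits⁻ c e in ℓ , there ℓ∈ , p
... | suc _ = x , here refl , cong nz eq

pad⁻ : ∀ v u {ℓ} → ℓ ∈ pad v u → ℓ ≡ literal v true ⊎ ∃[ b ] ℓ ≡ literal u b
pad⁻ v u (here e)                 = inj₁ e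
pad⁻ v u (there (here e))         = inj₂ (false , e)
pad⁻ v u (there (there (here e))) = inj₂ (true , e)

∈-pads : ∀ {K v u} → v < K → u < K → pad v u ∈ pads K
∈-pads v< u< = ∈-concatMap⁺ _ (lose (∈-downFrom⁺ v<) (∈-map⁺ _ (∈-downFrom⁺ u<)))

quotient-remainder : ∀ g {S j} .{{_ : NonZero S}} → j < S → (g * S + j) / S ≡ g × (g * S + j) % S ≡ j
quotient-remainder g {S} {j} j< =
  trans (+-distrib-/-∣ˡ j (n∣m*n g)) (trans (cong₂ _+_ (m*n/n≡m g S) (m<n⇒m/n≡0 j<)) (+-identityʳ g)) ,
  trans (cong (_% S) (+-comm (g * S) j)) (trans ([m+kn]%n≡m%n j g S) (m<n⇒m%n≡m j<))

grid-injective : ∀ {g h S i j} .{{_ : NonZero S}} → i < S → j < S → g * S + i ≡ h * S + j → g ≡ h × i ≡ j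
grid-injective {g} {h} {S} i< j< e =
  let q , r = quotient-remainder g i< ; q′ , r′ = quotient-remainder h j< in
  trans (sym q) (trans (cong (_/ S) e) q′) , trans (sym r) (trans (cong (_% S) e) r′)

grid< : ∀ {g k S j} → g < k → j < S → g * S + j < S * k
grid< {g} {k} {S} {j} g< j< = begin-strict
  g * S + j  <⟨ +-monoʳ-< (g * S) j< ⟩
  g * S + S  ≡⟨ +-comm (g * S) S ⟩
  suc g * S  ≤⟨ *-monoˡ-≤ S g< ⟩
  k * S      ≡⟨ *-comm k S ⟩
  S * k      ∎
  where open ≤-Reasoning

-- Lists, unions and functions on finite sets

lookup-fromList⁺ : ∀ {A B : Set} {xs : List A} {x} → x ∈ xs →
                   ∃[ i ] (∀ (f : A → B) → lookup (Vec.map f (fromList xs)) i ≡ f x)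
lookup-fromList⁺ (here refl) = zero , λ f → refl
lookup-fromList⁺ (there x∈)  = let i , h = lookup-fromList⁺ x∈ in suc i , h

lookup-fromList⁻ : ∀ {A B : Set} (xs : List A) i →
                   ∃[ x ] x ∈ xs × (∀ (f : A → B) → lookup (Vec.map f (fromList xs)) i ≡ f x)
lookup-fromList⁻ (x ∷ xs) zero    = x , here refl , λ f → refl
lookup-fromList⁻ (x ∷ xs) (suc i) = let y , y∈ , h = lookup-fromList⁻ xs i in y , there y∈ , h

∈-⋃⁺ : ∀ {n} {x : Fin n} {ss} → Any (x Subset.∈_) ss → x Subset.∈ ⋃ ss
∈-⋃⁺ (here x∈)   = Subset.x∈p∪q⁺ (inj₁ x∈)
∈-⋃⁺ (there any) = Subset.x∈p∪q⁺ (inj₂ (∈-⋃⁺ any))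

∈-⋃⁻ : ∀ {n} {x : Fin n} ss → x Subset.∈ ⋃ ss → ∃[ i ] x Subset.∈ List.lookup ss i
∈-⋃⁻ []       x∈ = contradiction x∈ Subset.∉⊥
∈-⋃⁻ (s ∷ ss) x∈ with Subset.x∈p∪q⁻ s (⋃ ss) x∈
... | inj₁ x∈s = zero , x∈s
... | inj₂ x∈⋃ = let i , x∈i = ∈-⋃⁻ ss x∈⋃ in suc i , x∈i

unique-map : ∀ {A B : Set} (f : A → B) {xs} → (∀ {x y} → x ∈ xs → y ∈ xs → f x ≡ f y → x ≡ y) →
             Unique xs → Unique (map f xs)
unique-map f inj []         = []
unique-map f inj (x∉ ∷ uxs) =
  All.tabulate (λ y∈ fx≡y → let z , z∈ , y≡ = ∈-map⁻ f y∈ in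
    All.lookup x∉ z∈ (inj (here refl) (there z∈) (trans fx≡y y≡))) ∷
  unique-map f (λ x∈ y∈ → inj (there x∈) (there y∈)) uxs

concatMap-cartesianProduct : ∀ {A B C : Set} (f : A × B → List C) xs ys →
  concatMap f (cartesianProduct xs ys) ≡ concatMap (λ x → concatMap (λ y → f (x , y)) ys) xs
concatMap-cartesianProduct f []       ys = refl
concatMap-cartesianProduct f (x ∷ xs) ys = trans (concatMap-++ f (map (x ,_) ys) _)
  (cong₂ _++_ (concatMap-map f (x ,_) ys) (concatMap-cartesianProduct f xs ys))

length-cartesianProduct : ∀ {A B : Set} (xs : List A) (ys : List B) →
                          length (cartesianProduct xs ys) ≡ length xs * length ys
length-cartesianProduct []       ys = refl
length-cartesianProduct (x ∷ xs) ys = trans (length-++ (map (x ,_) ys))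
  (cong₂ _+_ (length-map (x ,_) ys) (length-cartesianProduct xs ys))

-- Pigeonhole: if s missed i, then i and the k values of the injective s would be k + 1 distinct
-- elements of `Fin l`.
section-surjective : ∀ {l k} (f : Fin l → Fin k) (s : Fin k → Fin l) → (∀ x → f (s x) ≡ x) → l ≤ k →
                     ∀ i → s (f i) ≡ i
section-surjective {l} {k} f s fs l≤k i with s (f i) Fin.≟ i
... | yes e = e
... | no ≢i = contradiction (injective⇒≤ h-injective) (<⇒≱ (s≤s l≤k))
  where
  h : Fin (suc k) → Fin l
  h zero    = i
  h (suc x) = s x
  i≢ : ∀ x → i ≢ s x
  i≢ x i≡ = ≢i (trans (cong s (trans (cong f i≡) (fs x))) (sym i≡))
  h-injective : ∀ {x y} → h x ≡ h y → x ≡ y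
  h-injective {zero}  {zero}  _ = refl
  h-injective {zero}  {suc y} e = contradiction e (i≢ y)
  h-injective {suc x} {zero}  e = contradiction (sym e) (i≢ x)
  h-injective {suc x} {suc y} e = cong suc (trans (sym (fs x)) (trans (cong f e) (fs y)))

extend : ∀ {A : Set} {k} → A → (Fin k → A) → ℕ → A
extend {k = zero}  d f _       = d
extend {k = suc k} d f zero    = f zero
extend {k = suc k} d f (suc x) = extend d (f ∘ suc) x

extend-toℕ : ∀ {A : Set} {k} d (f : Fin k → A) x → extend d f (toℕ x) ≡ f x
extend-toℕ d f zero    = refl
extend-toℕ d f (suc x) = extend-toℕ d (f ∘ suc) x

-- Stated for encoded clauses, so that it also covers the pads and the variables beyond those of the
-- formula.
Satisfied : ℕ → List (List ℕ) → (ℕ → Bool) → Set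
Satisfied K cs β = ∀ {c} → c ∈ cs → ∃[ v ] v < K × literal v (β v) ∈ c

-- Covers of the star against satisfying assignments

module Reduction (k S : ℕ) (cs : List (List ℕ)) (2≤k : 2 ≤ k) .{{_ : NonZero S}} (pads⊆cs : ∀ {c} → c ∈ pads (S * k) → c ∈ cs) where

  P : ℕ
  P = 2 ^ S

  satisfies : ℕ → ℕ → List ℕ → Bool
  satisfies g M c = nz (hits (truth S P g M) c)

  coverSet : ℕ → ℕ → Subset (suc (length cs))
  coverSet g M = true ∷ Vec.map (satisfies g M) (fromList cs)

  choices : List (ℕ × ℕ)
  choices = cartesianProduct (downFrom k) (downFrom P)

  sets : List (Subset (suc (length cs)))
  sets = map (uncurry coverSet) choices

  satisfies⁺ : ∀ {g M c} j → literal (g * S + toℕ j) (lookup (bits P S M) j) ∈ c → satisfies g M c ≡ true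
  satisfies⁺ {g} {M} j ℓ∈ = hits⁺ ℓ∈ (truth⁺ S P g M j)

  satisfies⁻ : ∀ {g M} c → satisfies g M c ≡ true → ∃[ j ] literal (g * S + toℕ j) (lookup (bits P S M) j) ∈ c
  satisfies⁻ {g} {M} c e =
    let ℓ , ℓ∈ , ℓ-true = hits⁻ c e
        j , ℓ≡ = truth⁻ S P g M ℓ ℓ-true
    in j , subst (_∈ c) ℓ≡ ℓ∈

  0<S : 0 < S
  0<S = >-nonZero⁻¹ S

  -- The first variable of group g padded with itself: all sets of group g contain this clause, and
  -- no others do. Selectors tell groups apart and force a cover to use each group.
  selector : ℕ → List ℕ
  selector g = pad (g * S + 0) (g * S + 0)

  selector∈ : ∀ {g} → g < k → selector g ∈ cs
  selector∈ g< = pads⊆cs (∈-pads (grid< g< 0<S) (grid< g< 0<S))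

  selector⁺ : ∀ g M → satisfies g M (selector g) ≡ true
  selector⁺ g M = satisfies⁺ {g} {M} {selector g} j (subst (λ i → literal (g * S + i) b ∈ selector g) (sym (toℕ-fromℕ< 0<S)) (both b))
    where
    j = fromℕ< 0<S
    b = lookup (bits P S M) j
    both : ∀ b → literal (g * S + 0) b ∈ selector g
    both true  = here refl
    both false = there (here refl)

  same-group : ∀ {g h i} (j : Fin S) → i < S → ∀ {a b} → literal (h * S + toℕ j) a ≡ literal (g * S + i) b → h ≡ g
  same-group {g} {h} {i} j i< {a} {b} e =
    proj₁ (grid-injective (toℕ<n j) i< (proj₁ (literal-injective (h * S + toℕ j) (g * S + i) {a} {b} e)))

  selector⁻ : ∀ {g h M} → satisfies h M (selector g) ≡ true → h ≡ g
  selector⁻ {g} {h} {M} e with satisfies⁻ {h} {M} (selector g) e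
  ... | j , ℓ∈ with pad⁻ (g * S + 0) (g * S + 0) ℓ∈
  ...   | inj₁ ℓ≡       = same-group j 0<S {lookup (bits P S M) j} {true} ℓ≡
  ...   | inj₂ (b , ℓ≡) = same-group j 0<S {lookup (bits P S M) j} {b} ℓ≡

  another : ∀ g → ∃[ h ] h < k × h ≢ g
  another zero    = 1 , 2≤k , λ ()
  another (suc _) = 0 , ≤-trans (s≤s z≤n) 2≤k , λ ()

  -- Pairing variable j of group g with a variable of another group h leaves group g nothing but the
  -- positive literal. Among the sets of group g the clause thus reads off bit j, so different
  -- assignments give different sets. The group h exists because k ≥ 2.
  probe : ∀ {g} (j : Fin S) → g < k → ∃[ c ] c ∈ cs × (∀ M → satisfies g M c ≡ lookup (bits P S M) j)
  probe {g} j g< with another g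
  ... | h , h< , h≢g = c , pads⊆cs (∈-pads (grid< g< (toℕ<n j)) (grid< h< 0<S)) , λ M → iff (forward M) (backward M)
    where
    c = pad (g * S + toℕ j) (h * S + 0)
    iff : ∀ {a b} → (a ≡ true → b ≡ true) → (b ≡ true → a ≡ true) → a ≡ b
    iff {true}  {b}     f _ = sym (f refl)
    iff {false} {true}  _ g = g refl
    iff {false} {false} _ _ = refl
    forward : ∀ M → satisfies g M c ≡ true → lookup (bits P S M) j ≡ true
    forward M e with satisfies⁻ {g} {M} c e
    ... | i , ℓ∈ with pad⁻ (g * S + toℕ j) (h * S + 0) ℓ∈
    ...   | inj₂ (b , ℓ≡) = contradiction (sym (same-group i 0<S {lookup (bits P S M) i} {b} ℓ≡)) h≢g
    ...   | inj₁ ℓ≡ with literal-injective (g * S + toℕ i) (g * S + toℕ j) {lookup (bits P S M) i} {true} ℓ≡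
    ...     | v≡ , b≡ = subst (λ j → lookup (bits P S M) j ≡ true) (toℕ-injective (proj₂ (grid-injective {g} {g} (toℕ<n i) (toℕ<n j) v≡))) b≡
    backward : ∀ M → lookup (bits P S M) j ≡ true → satisfies g M c ≡ true
    backward M e = satisfies⁺ {g} {M} {c} j (subst (λ b → literal (g * S + toℕ j) b ∈ c) (sym e) (here refl))

  coverSet-cong : ∀ g M h N → coverSet g M ≡ coverSet h N → ∀ {c} → c ∈ cs → satisfies g M c ≡ satisfies h N c
  coverSet-cong g M h N e c∈ =
    let i , at = lookup-fromList⁺ c∈ in
    trans (sym (at (satisfies g M))) (trans (cong (λ s → lookup s (suc i)) e) (at (satisfies h N)))

  coverSet-injective : ∀ {x y} → x ∈ choices → y ∈ choices → uncurry coverSet x ≡ uncurry coverSet y → x ≡ y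
  coverSet-injective {g , M} {h , N} x∈ y∈ e =
    let g∈ , M∈ = ∈-cartesianProduct⁻ (downFrom k) (downFrom P) x∈
        h∈ , N∈ = ∈-cartesianProduct⁻ (downFrom k) (downFrom P) y∈
        h≡g = selector⁻ {g} {h} {N} (trans (sym (coverSet-cong g M h N e (selector∈ (∈-downFrom⁻ g∈)))) (selector⁺ g M))
    in cong₂ _,_ (sym h≡g) (bits-injective (∈-downFrom⁻ M∈) (∈-downFrom⁻ N∈)
         (trans (sym (tabulate∘lookup _)) (trans (tabulate-cong (same-bits (∈-downFrom⁻ g∈) h≡g e)) (tabulate∘lookup _))))
    where
    same-bits : ∀ {g h M N} → g < k → h ≡ g → coverSet g M ≡ coverSet h N → ∀ j → lookup (bits P S M) j ≡ lookup (bits P S N) j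
    same-bits {g} {M = M} {N} g< refl e j =
      let c , c∈ , p = probe j g< in trans (sym (p M)) (trans (coverSet-cong g M g N e c∈) (p N))

  sets-unique : Unique sets
  sets-unique = unique-map (uncurry coverSet) coverSet-injective (cartesianProduct⁺ (downFrom⁺ k) (downFrom⁺ P))

  coverInstance : CoverInstance
  coverInstance = record
    { graph     = star (length cs)
    ; planar    = star-planar (length cs)
    ; family    = sets
    ; distinct  = sets-unique
    ; connected = All.tabulate (λ s∈ → star-connected (centre s∈))
    ; k         = k
    }
    where
    centre : ∀ {s} → s ∈ sets → zero Subset.∈ s
    centre s∈ with ∈-map⁻ (uncurry coverSet) s∈
    ... | _ , _ , refl = here

  length-sets : length sets ≡ k * P
  length-sets = trans (length-map _ choices) (trans (length-cartesianProduct (downFrom k) (downFrom P))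
    (cong₂ _*_ (length-downFrom k) (length-downFrom P)))

  elements-members : ∀ τ J ds → elements J (Vec.map (λ c → nz (hits τ c)) (fromList ds)) ≡ members τ J ds
  elements-members τ J []       = refl
  elements-members τ J (c ∷ ds) with nz (hits τ c)
  ... | true  = cong (J ∷_) (elements-members τ (J + 1) ds)
  ... | false = elements-members τ (J + 1) ds

  encode-coverSet : ∀ g M → encodeSubset (coverSet g M) ≡ encSet (truth S P g M) cs
  encode-coverSet g M = trans (encodeSubset-elements (coverSet g M))
    (cong (λ ms → suc (length ms) ∷ 0 ∷ ms) (elements-members (truth S P g M) 1 cs))

  encode-instance : encodeCover coverInstance ≡ coverWord k S cs
  encode-instance = cong (k ∷_) (cong₂ _∷_ (+-comm 1 _) (cong₂ _∷_ (length-star-edges (length cs))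
    (trans (cong₂ _++_ (star-spokes (length cs)) (cong₂ _∷_ length-sets encode-sets))
           (sym (++-assoc (spokes 0 (length cs)) [ k * P ] _)))))
    where
    encode-sets : concatMap encodeSubset sets ≡ concatMap (encGroup S P cs) (downFrom k)
    encode-sets = trans (concatMap-map encodeSubset (uncurry coverSet) choices)
      (trans (concatMap-cong (λ (g , M) → encode-coverSet g M) choices)
             (concatMap-cartesianProduct (λ (g , M) → encSet (truth S P g M) cs) (downFrom k) (downFrom P)))

  cover-complete : ∀ β → Satisfied (S * k) cs β → HasCover coverInstance
  cover-complete β sat = map chosen (downFrom k) , sublist (downFrom k) , trans (length-map chosen (downFrom k)) (length-downFrom k) ,
    Subset.⊆-antisym Subset.⊆⊤ (λ {x} _ → ∈-⋃⁺ (covered x))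
    where
    row : ℕ → Vec Bool S
    row g = Vec.tabulate (λ j → β (g * S + toℕ j))
    chosen : ℕ → Subset (suc (length cs))
    chosen g = coverSet g (value (row g))
    -- The family is a concatenation of one block per group, and one set of each block is kept.
    sublist : ∀ gs → map chosen gs ⊆ map (uncurry coverSet) (cartesianProduct gs (downFrom P))
    sublist []       = []
    sublist (g ∷ gs) = subst (map chosen (g ∷ gs) ⊆_) (sym (map-++ (uncurry coverSet) (map (g ,_) (downFrom P)) _))
      (Sublist.++⁺ (Sublist.from∈ (∈-map⁺ (uncurry coverSet) (∈-map⁺ (g ,_) (∈-downFrom⁺ (value< (row g)))))) (sublist gs))
    covered : ∀ x → Any (x Subset.∈_) (map chosen (downFrom k))
    covered zero    = lose (∈-map⁺ chosen (∈-downFrom⁺ (≤-trans (s≤s z≤n) 2≤k))) here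
    covered (suc x) with lookup-fromList⁻ cs x
    ... | c , c∈ , at with sat c∈
    ... | v , v< , ℓ∈ = lose (∈-map⁺ chosen (∈-downFrom⁺ (m<n*o⇒m/o<n (subst (v <_) (*-comm S k) v<))))
      (there (lookup⇒[]= x _ (trans (at (satisfies g (value (row g)))) (satisfies⁺ {g} {value (row g)} {c} j
        (subst₂ (λ v b → literal v b ∈ c) v≡ (trans (cong β v≡) (sym (trans (cong (λ r → lookup r j) (bits-value (row g))) (lookup∘tabulate _ j)))) ℓ∈)))))
      where
      g = v / S
      j = fromℕ< (m%n<n v S)
      v≡ : v ≡ g * S + toℕ j
      v≡ = trans (m≡m%n+[m/n]*n v S) (trans (+-comm (v % S) _) (cong (g * S +_) (sym (toℕ-fromℕ< (m%n<n v S)))))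

  module Sound (𝒮 : List (Subset (suc (length cs)))) (𝒮⊆ : 𝒮 ⊆ sets) (|𝒮| : length 𝒮 ≡ k) (⋃𝒮 : ⋃ 𝒮 ≡ ⊤) where

    Index : Set
    Index = Fin (length 𝒮)

    origin : ∀ (i : Index) → ∃[ g ] ∃[ M ] g < k × List.lookup 𝒮 i ≡ coverSet g M
    origin i with ∈-map⁻ (uncurry coverSet) (Sublist.lookup 𝒮⊆ (∈-lookup i))
    ... | (g , M) , x∈ , e = g , M , ∈-downFrom⁻ (proj₁ (∈-cartesianProduct⁻ (downFrom k) (downFrom P) x∈)) , e

    groupOf : Index → Fin k
    groupOf i = fromℕ< (proj₁ (proj₂ (proj₂ (origin i))))

    rowOf : Index → ℕ
    rowOf i = proj₁ (proj₂ (origin i))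

    origin-set : ∀ i → List.lookup 𝒮 i ≡ coverSet (toℕ (groupOf i)) (rowOf i)
    origin-set i = let _ , _ , g< , e = origin i in trans e (cong (λ g → coverSet g (rowOf i)) (sym (toℕ-fromℕ< g<)))

    covering : ∀ {c} → c ∈ cs → ∃[ i ] satisfies (toℕ (groupOf i)) (rowOf i) c ≡ true
    covering {c} c∈ =
      let x , at = lookup-fromList⁺ c∈
          i , x∈i = ∈-⋃⁻ 𝒮 (subst (suc x Subset.∈_) (sym ⋃𝒮) Subset.∈⊤)
      in i , trans (sym (at (satisfies (toℕ (groupOf i)) (rowOf i))))
               (trans (cong (λ s → lookup s (suc x)) (sym (origin-set i))) ([]=⇒lookup x∈i))

    representative : ∀ g → ∃[ i ] groupOf i ≡ g
    representative g = let i , e = covering (selector∈ (toℕ<n g)) in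
      i , toℕ-injective (selector⁻ {toℕ g} {toℕ (groupOf i)} {rowOf i} e)

    member : Fin k → Index
    member g = proj₁ (representative g)

    -- As many sets are chosen as there are groups, so no group is chosen twice.
    member-unique : ∀ i → member (groupOf i) ≡ i
    member-unique = section-surjective groupOf member (λ g → proj₂ (representative g)) (≤-reflexive |𝒮|)

    -- The defaults here and in `assignment` are never reached for a variable below S · k.
    rowAt : ℕ → ℕ
    rowAt = extend 0 (rowOf ∘ member)

    rowAt-group : ∀ i → rowAt (toℕ (groupOf i)) ≡ rowOf i
    rowAt-group i = trans (extend-toℕ 0 (rowOf ∘ member) (groupOf i)) (cong rowOf (member-unique i))

    assignment : ℕ → Bool
    assignment v = extend false (lookup (bits P S (rowAt (v / S)))) (v % S)

    satisfied : Satisfied (S * k) cs assignment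
    satisfied {c} c∈ =
      let i , e = covering c∈
          j , ℓ∈ = satisfies⁻ {toℕ (groupOf i)} {rowOf i} c e
      in toℕ (groupOf i) * S + toℕ j , grid< (toℕ<n (groupOf i)) (toℕ<n j) ,
         subst (λ b → literal (toℕ (groupOf i) * S + toℕ j) b ∈ c) (sym (assigned i j)) ℓ∈
      where
      assigned : ∀ i j → assignment (toℕ (groupOf i) * S + toℕ j) ≡ lookup (bits P S (rowOf i)) j
      assigned i j =
        let q , r = quotient-remainder (toℕ (groupOf i)) (toℕ<n j) in
        trans (cong₂ (λ g j → extend false (lookup (bits P S (rowAt g))) j) q r)
          (trans (cong (λ M → extend false (lookup (bits P S M)) (toℕ j)) (rowAt-group i)) (extend-toℕ false (lookup (bits P S (rowOf i))) j))

  cover-sound : HasCover coverInstance → ∃[ β ] Satisfied (S * k) cs β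
  cover-sound (𝒮 , 𝒮⊆ , |𝒮| , ⋃𝒮) = assignment , satisfied
    where open Sound 𝒮 𝒮⊆ |𝒮| ⋃𝒮

-- The number of clauses

unique-lookup : ∀ {A : Set} {xs : List A} → Unique xs → ∀ {i j} → List.lookup xs i ≡ List.lookup xs j → i ≡ j
unique-lookup (x∉ ∷ u) {zero}  {zero}  e = refl
unique-lookup (x∉ ∷ u) {zero}  {suc j} e = contradiction e (All.lookup x∉ (∈-lookup j))
unique-lookup (x∉ ∷ u) {suc i} {zero}  e = contradiction (sym e) (All.lookup x∉ (∈-lookup i))
unique-lookup (x∉ ∷ u) {suc i} {suc j} e = cong suc (unique-lookup u e)

unique-length≤ : ∀ {A : Set} {N} (f : A → Fin N) {xs} → (∀ {x y} → x ∈ xs → y ∈ xs → f x ≡ f y → x ≡ y) →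
                 Unique xs → length xs ≤ N
unique-length≤ f {xs} inj u = injective⇒≤ {f = f ∘ List.lookup xs} (λ {i} {j} e → unique-lookup u (inj (∈-lookup i) (∈-lookup j) e))

bit : Bool → Fin 2
bit false = zero
bit true  = suc zero

bit-injective : ∀ {a b} → bit a ≡ bit b → a ≡ b
bit-injective {false} {false} _ = refl
bit-injective {true}  {true}  _ = refl

-- A clause of at most q literals is a word of length q over the 2n literals and a blank, whence (2n
-- + 1)^q. Longer clauses are cut off, so injectivity needs the bound on the width.
clauseCode : ∀ {n} q → Clause n → Fin (suc (n * 2) ^ q)
clauseCode zero    _             = zero
clauseCode {n} (suc q) []        = combine {suc (n * 2)} zero (clauseCode {n} q [])
clauseCode {n} (suc q) ((v , b) ∷ C) = combine {suc (n * 2)} (suc (combine v (bit b))) (clauseCode q C)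

clauseCode-injective : ∀ {n} q {C D : Clause n} → length C ≤ q → length D ≤ q →
                       clauseCode q C ≡ clauseCode q D → C ≡ D
clauseCode-injective zero    {[]} {[]} _ _ _ = refl
clauseCode-injective (suc q) {[]} {[]} _ _ _ = refl
clauseCode-injective {n} (suc q) {[]} {(v , b) ∷ D} _ _ e
  with combine-injective {suc (n * 2)} zero (clauseCode {n} q []) (suc (combine v (bit b))) (clauseCode q D) e
... | () , _
clauseCode-injective {n} (suc q) {(v , b) ∷ C} {[]} _ _ e
  with combine-injective {suc (n * 2)} (suc (combine v (bit b))) (clauseCode q C) zero (clauseCode {n} q []) e
... | () , _
clauseCode-injective {n} (suc q) {(v , b) ∷ C} {(w , c) ∷ D} (s≤s C≤) (s≤s D≤) e
  with combine-injective {suc (n * 2)} (suc (combine v (bit b))) (clauseCode q C) (suc (combine w (bit c))) (clauseCode q D) e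
... | vb≡wc , C≡D with combine-injective v (bit b) w (bit c) (suc-injective′ vb≡wc)
  where
  suc-injective′ : ∀ {n} {i j : Fin n} → _≡_ {A = Fin (suc n)} (suc i) (suc j) → i ≡ j
  suc-injective′ refl = refl
... | refl , b≡c = cong₂ (λ b D → (v , b) ∷ D) (bit-injective b≡c) (clauseCode-injective q C≤ D≤ C≡D)

clauses≤ : ∀ {q} (φ : CNF q) → length (CNF.clauses φ) ≤ suc (CNF.n φ * 2) ^ q
clauses≤ {q} φ = unique-length≤ (clauseCode q)
  (λ C∈ D∈ → clauseCode-injective q (All.lookup width C∈) (All.lookup width D∈)) distinct
  where open CNF φ

-- The reduction applied to a formula

encodeLiteral-literal : ∀ {n} (v : Fin n) b → encodeLiteral (v , b) ≡ literal (toℕ v) b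
encodeLiteral-literal v true  = cong (λ z → toℕ v + z + 1) (+-identityʳ (toℕ v))
encodeLiteral-literal v false = trans (+-identityʳ _) (cong (toℕ v +_) (+-identityʳ (toℕ v)))

pads⁻ : ∀ {K c} → c ∈ pads K → ∃[ v ] ∃[ u ] v < K × u < K × c ≡ pad v u
pads⁻ {K} c∈ with find (∈-concatMap⁻ (λ v → map (pad v) (downFrom K)) {xs = downFrom K} c∈)
... | v , v∈ , c∈′ with ∈-map⁻ (pad v) c∈′
... | u , u∈ , c≡ = v , u , ∈-downFrom⁻ v∈ , ∈-downFrom⁻ u∈ , c≡

module _ {q} {φ : CNF q} {K : ℕ} where

  open CNF φ

  private
    codes : List (List ℕ)
    codes = map (map encodeLiteral) clauses

  satisfiable⇒ : n < K → Satisfiable φ → ∃[ β ] Satisfied K (codes ++ pads K) β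
  satisfiable⇒ n<K (α , sat) = β , satisfied
    where
    -- The variables from n on occur in pads only, which are tautologies, so any default would do.
    β = extend false α
    satisfied : Satisfied K (codes ++ pads K) β
    satisfied c∈ with ∈-++⁻ codes c∈
    ... | inj₂ c∈pads with pads⁻ {K} c∈pads
    ...   | v , u , v< , u< , refl = u , u< , both (β u)
      where
      both : ∀ b → literal u b ∈ pad v u
      both true  = there (there (here refl))
      both false = there (here refl)
    satisfied c∈ | inj₁ c∈codes with ∈-map⁻ (map encodeLiteral) c∈codes
    ...   | C , C∈ , refl with find (All.lookup sat C∈)
    ...     | (v , b) , ℓ∈ , αv≡b = toℕ v , <-trans (toℕ<n v) n<K ,
      subst (_∈ map encodeLiteral C) (trans (encodeLiteral-literal v b)
        (cong (literal (toℕ v)) (trans (sym αv≡b) (sym (extend-toℕ false α v))))) (∈-map⁺ encodeLiteral ℓ∈)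

  satisfiable⇐ : ∀ β → Satisfied K (codes ++ pads K) β → Satisfiable φ
  satisfiable⇐ β satisfied = (λ v → β (toℕ v)) , All.tabulate clause
    where
    clause : ∀ {C} → C ∈ clauses → Satisfies (λ v → β (toℕ v)) C
    clause C∈ with satisfied (∈-++⁺ˡ (∈-map⁺ (map encodeLiteral) C∈))
    ... | w , _ , ℓ∈ with ∈-map⁻ encodeLiteral ℓ∈
    ... | (v , b) , vb∈ , ℓ≡ with literal-injective w (toℕ v) {β w} {b} (trans ℓ≡ (encodeLiteral-literal v b))
    ... | w≡v , βw≡b = lose vb∈ (trans (cong β (sym w≡v)) βw≡b)

-- The decision procedure for a formula and its cost

-- The coefficient that `cost-from-steps` gives for the 121 of `reduction-run`.
overhead : ℕ
overhead = 121 * (2 * (5 + 121))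

-- One summand for the clauses of the formula and one for the K² pads, both relative to 2^S.
clauseFactor : ℕ → ℕ → ℕ
clauseFactor q k = suc (2 * k) ^ q * proj₁ (pow≤exp q) + k * k * proj₁ (pow≤exp 2)

-- Times 2^S it bounds the rounds of every loop: number of clauses, k, clause width q, pad width 3.
sizeFactor : ℕ → ℕ → ℕ
sizeFactor q k = clauseFactor q k + k + q + 3

open Shift rO mO

-- The answer appears in `rO`, which is register 0 of the shifted program, and is copied to the
-- actual register 0 by adding zero.
after : Program → Program → Program
after R A = R ⨾ shift A ⨾ (rOne :=# 0 ⨾ 0 := rO ⊕ rOne)

outputs-after : ∀ {R A w w′ s out t u} → R ∶ initial w ⟶[ u ] s → Simulates s (initial w′) → out ≤ 1 →
                Outputs A w′ out t → ∃[ v ] v ≤ u + t + 3 × Outputs (after R A) w out v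
outputs-after {t = t} {u} run sim out≤1 (s′ , run′ , out≡) with simulate run′ sim
... | s″ , run″ , sim″ =
  -- The answer is 0 or 1, so it has length 1 like the two zeros; together they cost 3.
  _ , +-monoʳ-≤ (u + t) (+-mono-≤ (len-≤ {0} {0} z≤n) (+-mono-≤ (len-≤ {reg s″ rO} {0} (subst (_≤ 1) (sym out″) out≤1)) (len-≤ {0} {0} z≤n))) ,
  _ , seq (seq run run″) (seq const add) , trans (+-identityʳ _) out″
  where
  out″ = trans (Simulates.regs sim″ 0) out≡

decider : Program → ℕ → Program
decider A k = after (reduction k) A

module FromFormula {q} (φ : CNF q) (k S : ℕ) (2≤k : 2 ≤ k) .{{_ : NonZero S}} (n<K : CNF.n φ < S * k) where

  open CNF φ

  K : ℕ
  K = S * k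

  codes cs : List (List ℕ)
  codes = map (map encodeLiteral) clauses
  cs = codes ++ pads K

  open Reduction k S cs 2≤k (∈-++⁺ʳ codes) public

  encode-formula : encodeCNF φ ≡ n ∷ length codes ∷ concatMap encClause codes
  encode-formula = cong (n ∷_) (cong₂ _∷_ (sym (length-map _ clauses))
    (trans (concatMap-cong (λ C → cong (_∷ map encodeLiteral C) (sym (length-map encodeLiteral C))) clauses)
           (sym (concatMap-map encClause (map encodeLiteral) clauses))))

  satisfiable⇒cover : Satisfiable φ → HasCover coverInstance
  satisfiable⇒cover sat = let β , satisfied = satisfiable⇒ {φ = φ} n<K sat in cover-complete β satisfied

  cover⇒satisfiable : HasCover coverInstance → Satisfiable φ
  cover⇒satisfiable cover = let β , satisfied = cover-sound cover in satisfiable⇐ {φ = φ} {K} β satisfied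

  D E Z : ℕ
  D = clauseFactor q k
  E = sizeFactor q k
  Z = E * 2 ^ S

  0<2^S : 0 < 2 ^ S
  0<2^S = m^n>0 2 S

  -- As n < S · k with k fixed, the (2n + 1)^q possible clauses are polynomially many in S, hence
  -- O(2^S).
  length-codes≤ : length codes ≤ suc (2 * k) ^ q * proj₁ (pow≤exp q) * 2 ^ S
  length-codes≤ = begin
    length codes                                        ≡⟨ length-map _ clauses ⟩
    length clauses                                      ≤⟨ clauses≤ φ ⟩
    suc (n * 2) ^ q                                     ≤⟨ ^-monoˡ-≤ q (s≤s (*-monoˡ-≤ 2 (<⇒≤ n<K))) ⟩
    suc (S * k * 2) ^ q                                 ≤⟨ ^-monoˡ-≤ q affine ⟩
    (suc (2 * k) * suc S) ^ q                           ≡⟨ ^-distribʳ-* q (suc (2 * k)) (suc S) ⟩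
    suc (2 * k) ^ q * suc S ^ q                         ≤⟨ *-monoʳ-≤ (suc (2 * k) ^ q) (proj₂ (pow≤exp q) S) ⟩
    suc (2 * k) ^ q * (proj₁ (pow≤exp q) * 2 ^ S)       ≡⟨ sym (*-assoc (suc (2 * k) ^ q) _ _) ⟩
    suc (2 * k) ^ q * proj₁ (pow≤exp q) * 2 ^ S         ∎
    where
    open ≤-Reasoning
    affine : suc (S * k * 2) ≤ suc (2 * k) * suc S
    affine = ≤-trans (m≤m+n _ (S + 2 * k)) (≤-reflexive
      (solve 2 (λ s k → con 1 :+ s :* k :* con 2 :+ (s :+ con 2 :* k) := (con 1 :+ con 2 :* k) :* (con 1 :+ s)) refl S k))
      where open +-*-Solver using (solve; _:=_; _:+_; _:*_; con)

  K²≤ : K * K ≤ k * k * proj₁ (pow≤exp 2) * 2 ^ S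
  K²≤ = begin
    S * k * (S * k)                            ≤⟨ *-mono-≤ (*-monoˡ-≤ k (n≤1+n S)) (*-monoˡ-≤ k (n≤1+n S)) ⟩
    suc S * k * (suc S * k)                    ≡⟨ solve 2 (λ s k → s :* k :* (s :* k) := k :* k :* (s :* (s :* con 1))) refl (suc S) k ⟩
    k * k * suc S ^ 2                          ≤⟨ *-monoʳ-≤ (k * k) (proj₂ (pow≤exp 2) S) ⟩
    k * k * (proj₁ (pow≤exp 2) * 2 ^ S)        ≡⟨ sym (*-assoc (k * k) _ _) ⟩
    k * k * proj₁ (pow≤exp 2) * 2 ^ S          ∎
    where
    open ≤-Reasoning
    open +-*-Solver using (solve; _:=_; _:+_; _:*_; con)

  length-cs≤ : length cs ≤ D * 2 ^ S
  length-cs≤ = begin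
    length cs                   ≡⟨ trans (length-++ codes) (cong (length codes +_) (length-pads K)) ⟩
    length codes + K * K        ≤⟨ +-mono-≤ length-codes≤ K²≤ ⟩
    _                           ≡⟨ sym (*-distribʳ-+ (2 ^ S) (suc (2 * k) ^ q * proj₁ (pow≤exp q)) _) ⟩
    D * 2 ^ S                   ∎
    where open ≤-Reasoning

  size≤ : CoverInstance.size coverInstance ≤ (k + D + 1) * 2 ^ S
  size≤ = begin
    length sets + suc (length cs)         ≡⟨ cong₂ _+_ length-sets (+-comm 1 (length cs)) ⟩
    k * 2 ^ S + (length cs + 1)           ≤⟨ +-monoʳ-≤ (k * 2 ^ S) (+-mono-≤ length-cs≤ 0<2^S) ⟩
    k * 2 ^ S + (D * 2 ^ S + 2 ^ S)       ≡⟨ solve 3 (λ k d p → k :* p :+ (d :* p :+ p) := (k :+ d :+ con 1) :* p) refl k D (2 ^ S) ⟩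
    (k + D + 1) * 2 ^ S                   ∎
    where
    open ≤-Reasoning
    open +-*-Solver using (solve; _:=_; _:+_; _:*_; con)

  E≤Z : E ≤ Z
  E≤Z = m≤m*n E (2 ^ S) {{>-nonZero 0<2^S}}

  q+3≤E : q + 3 ≤ E
  q+3≤E = ≤-trans (m≤n+m (q + 3) (D + k)) (≤-reflexive (sym (+-assoc (D + k) q 3)))

  k≤E : k ≤ E
  k≤E = ≤-trans (m≤n+m k D) (≤-trans (m≤m+n (D + k) q) (m≤m+n (D + k + q) 3))

  D≤E : D ≤ E
  D≤E = ≤-trans (m≤m+n D k) (≤-trans (m≤m+n (D + k) q) (m≤m+n (D + k + q) 3))

  k≤Z : k ≤ Z
  k≤Z = ≤-trans k≤E E≤Z

  q+3≤Z : q + 3 ≤ Z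
  q+3≤Z = ≤-trans q+3≤E E≤Z

  K≤Z : K ≤ Z
  K≤Z = ≤-trans (≤-reflexive (*-comm S k)) (*-mono-≤ k≤E (<⇒≤ (n<2^n S)))

  2^S≤Z : 2 ^ S ≤ Z
  2^S≤Z = ≤-trans (≤-reflexive (sym (+-identityʳ _))) (*-monoˡ-≤ (2 ^ S) {1} {E} (≤-trans (m≤n+m 1 (q + 2)) (≤-trans (≤-reflexive (+-assoc q 2 1)) q+3≤E)))

  S≤Z : S ≤ Z
  S≤Z = ≤-trans (<⇒≤ (n<2^n S)) 2^S≤Z

  cs≤Z : length cs ≤ Z
  cs≤Z = ≤-trans length-cs≤ (*-monoˡ-≤ (2 ^ S) D≤E)

  widths : All (λ c → length c ≤ Z) cs
  widths = All.++⁺ (All.map⁺ (All.map (λ {C} C≤q → ≤-trans (≤-reflexive (length-map encodeLiteral C)) (≤-trans C≤q (≤-trans (m≤m+n q 3) q+3≤Z))) width))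
    (All.tabulate λ c∈ → let _ , _ , _ , _ , c≡ = pads⁻ {K} c∈ in ≤-trans (≤-reflexive (cong length c≡)) (≤-trans (m≤n+m 3 q) q+3≤Z))

  -- A crude choice: the length of the word and the entries themselves, not just their binary
  -- lengths, are at most L. For the cost it is enough that L = O(Z^4).
  L : ℕ
  L = 4 * (Z * Z)

  instance
    Z≢0 : NonZero Z
    Z≢0 = >-nonZero (≤-trans (m≤n+m 1 (q + 2)) (≤-trans (≤-reflexive (+-assoc q 2 1)) q+3≤Z))

  Z≤L : Z ≤ L
  Z≤L = ≤-trans (m≤m*n Z Z) (m≤n*m (Z * Z) 4)

  word : List ℕ
  word = n ∷ length codes ∷ concatMap encClause codes

  L≥2Z : Z + Z ≤ L
  L≥2Z = ≤-trans (+-mono-≤ (m≤m*n Z Z) (m≤m*n Z Z)) (≤-trans (≤-reflexive (cong (Z * Z +_) (sym (+-identityʳ _)))) (*-monoˡ-≤ (Z * Z) (m≤m+n 2 2)))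

  length-codes≤Z : length codes ≤ Z
  length-codes≤Z = ≤-trans (≤-trans (m≤m+n _ _) (≤-reflexive (sym (length-++ codes)))) cs≤Z

  word-entries : All (_≤ L) word
  word-entries = ≤-trans (<⇒≤ n<K) (≤-trans K≤Z Z≤L) ∷ ≤-trans length-codes≤Z Z≤L ∷
    All.concat⁺ (All.map⁺ (All.map⁺ (All.map (λ {C} C≤q →
      ≤-trans (≤-reflexive (length-map encodeLiteral C)) (≤-trans C≤q (≤-trans (m≤m+n q 3) (≤-trans q+3≤Z Z≤L))) ∷
      All.map⁺ (All.universal code≤L C)) width)))
    where
    code≤L : ∀ ℓ → encodeLiteral ℓ ≤ L
    code≤L (v , b) = begin
      2 * toℕ v + (if b then 1 else 0)   ≤⟨ +-monoʳ-≤ (2 * toℕ v) (bit≤ b) ⟩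
      2 * toℕ v + 2                      ≡⟨ trans (+-comm (2 * toℕ v) 2) (sym (*-suc 2 (toℕ v))) ⟩
      2 * suc (toℕ v)                    ≤⟨ *-monoʳ-≤ 2 (≤-trans (toℕ<n v) (≤-trans (<⇒≤ n<K) K≤Z)) ⟩
      2 * Z                              ≡⟨ cong (Z +_) (+-identityʳ Z) ⟩
      Z + Z                              ≤⟨ L≥2Z ⟩
      L                                  ∎
      where
      open ≤-Reasoning
      bit≤ : ∀ b → (if b then 1 else 0) ≤ 2
      bit≤ true  = s≤s z≤n
      bit≤ false = z≤n

  length-word : length word ≤ L
  length-word = begin
    2 + length (concatMap encClause codes)   ≤⟨ +-monoʳ-≤ 2 (length-concatMap≤ Z codes short) ⟩
    2 + length codes * Z                     ≤⟨ +-mono-≤ 2≤ (*-monoˡ-≤ Z length-codes≤Z) ⟩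
    2 * (Z * Z) + Z * Z                      ≡⟨ +-comm (2 * (Z * Z)) (Z * Z) ⟩
    3 * (Z * Z)                              ≤⟨ *-monoˡ-≤ (Z * Z) (n≤1+n 3) ⟩
    L                                        ∎
    where
    open ≤-Reasoning
    2≤ : 2 ≤ 2 * (Z * Z)
    2≤ = *-monoʳ-≤ 2 {1} {Z * Z} (>-nonZero⁻¹ (Z * Z) {{m*n≢0 Z Z}})
    short : All (λ c → length (encClause c) ≤ Z) codes
    short = All.map⁺ (All.map (λ {C} C≤q → ≤-trans (s≤s (≤-trans (≤-reflexive (length-map encodeLiteral C)) C≤q))
      (≤-trans (≤-reflexive (+-comm 1 q)) (≤-trans (+-monoʳ-≤ q (s≤s z≤n)) q+3≤Z))) width)
    length-concatMap≤ : ∀ b xs → All (λ c → length (encClause c) ≤ b) xs → length (concatMap encClause xs) ≤ length xs * b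
    length-concatMap≤ b []       []       = z≤n
    length-concatMap≤ b (x ∷ xs) (h ∷ hs) = ≤-trans (≤-reflexive (length-++ (encClause x))) (+-mono-≤ h (length-concatMap≤ b xs hs))

  initial-bounded : Bounded L (initial word)
  initial-bounded = bounded
    (update-all (_≤ 2 ^ L) (λ _ → 0) 0 (exp length-word) (λ _ → z≤n))
    (update-all (λ f → ∀ i → f i ≤ 2 ^ L) (λ _ _ → 0) 0 (entries word-entries) (λ _ _ → z≤n))
    where
    exp : ∀ {x} → x ≤ L → x ≤ 2 ^ L
    exp x≤ = ≤-trans x≤ (<⇒≤ (n<2^n L))
    entries : ∀ {w} → All (_≤ L) w → ∀ i → contents w i ≤ 2 ^ L
    entries []       i       = z≤n
    entries (x≤ ∷ _) zero    = exp x≤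
    entries (_ ∷ xs) (suc i) = entries xs i

  maxConstant-reduction : maxConstant (reduction k) ≤ 2 ^ L
  maxConstant-reduction = ≤-trans (constants 2≤k) (≤-trans k≤Z (≤-trans Z≤L (<⇒≤ (n<2^n L))))
    where
    constants : ∀ {k} → 2 ≤ k → maxConstant (reduction k) ≤ k
    -- Matching exposes k as a double successor, so that the maximum of the constants 1 and k
    -- computes.
    constants (s≤s (s≤s z≤n)) = ≤-refl

  -- The pointer behind the output is at the same time register 0 of the simulated machine, where
  -- the length of its input is expected. Higher registers and memories are untouched, since
  -- comparing a written one with `rO + suc x` or `mO + suc a` computes to `false`.
  simulates-initial : ∀ {s w} → Frame (reduction k) (initial word) s → Tape mO rO w s → Simulates s (initial w)
  simulates-initial {s} {w} F t = simulates registers memories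
    where
    registers : ∀ x → reg s (rO + x) ≡ reg (initial w) x
    registers zero    = end t
    registers (suc x) = reg= F (rO + suc x) refl
    memories : ∀ a i → mem s (mO + a) i ≡ mem (initial w) a i
    memories zero    = cells t
    memories (suc a) = mem= F (mO + suc a) refl

  Preprocessed : Set
  Preprocessed = ∃[ s ] ∃[ t ] reduction k ∶ initial (encodeCNF φ) ⟶[ t ] s × t ≤ overhead * Z ^ 8 ×
    Simulates s (initial (encodeCover coverInstance))

  preprocess : .{{_ : NonZero k}} → S ≡ suc (n / k) → Preprocessed
  preprocess S≡ = measure (Correctness.reduction-run Z k n codes S≡ k≤Z S≤Z K≤Z 2^S≤Z cs≤Z widths)
    where
    L≤ : L ≤ 4 * Z ^ 4
    L≤ = *-monoʳ-≤ 4 (*-monoʳ-≤ Z (m≤m*n Z (Z ^ 2) {{m^n≢0 Z 2}}))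
    measure : Runs.Run Z (reduction k) (initial word) 121 4 (Tape mO rO (coverWord k S cs)) → Preprocessed
    measure (Runs.ran {s} {t} run steps≤ t₁) = s , t ,
      subst (λ w → reduction k ∶ initial w ⟶[ t ] s) (sym encode-formula) run ,
      cost-from-steps Z 121 L≤ steps≤ (proj₁ (cost run maxConstant-reduction initial-bounded)) ,
      subst (λ w → Simulates s (initial w)) (sym encode-instance) (simulates-initial (frame run) t₁)

  decide-by : .{{_ : NonZero k}} → S ≡ suc (n / k) → ∀ A {out t} → out ≤ 1 → Outputs A (encodeCover coverInstance) out t →
    ∃[ u ] u ≤ overhead * Z ^ 8 + t + 3 × Outputs (decider A k) (encodeCNF φ) out u
  decide-by S≡ A {t = t} out≤1 output =
    let s , u , run , u≤ , sim = preprocess S≡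
        v , v≤ , output′ = outputs-after run sim out≤1 output
    in v , ≤-trans v≤ (+-monoˡ-≤ 3 (+-monoˡ-≤ t u≤)) , output′

-- Choice of the parameters

-- This is 1/(e + 1), as a rational stores its denominator minus one; hence `pred e` wherever 1/e is
-- meant.
unitFraction : ℕ → ℚ
unitFraction e = mkℚ (ℤ.+ 1) e (1-coprimeTo (suc e))

0<unitFraction : ∀ e → 0ℚ ℚ.< unitFraction e
0<unitFraction e = ℚ.*<* (ℤ.+<+ (s≤s z≤n))

0<numerator : ∀ {ε} → 0ℚ ℚ.< ε → 1 ≤ ∣ ↥ ε ∣
0<numerator {mkℚ (ℤ.+ zero) d _} 0<ε = contradiction (ℚₚ.drop-*<* 0<ε) (ℤₚ.<-irrefl refl)
0<numerator {mkℚ (ℤ.+ suc _) _ _} _  = s≤s z≤n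
0<numerator {mkℚ (ℤ.-[1+ _ ]) _ _} _ = s≤s z≤n

-- Every constructed instance has parameter exactly k. So `f k` is one factor of the constant `C q`,
-- and k₀ ≤ k makes the assumed time bound apply to all of them.
no-algorithm : SETH → ∀ (f : ℕ → ℕ) (ε : ℚ) → 1 ≤ ∣ ↥ ε ∣ → ∀ k → 16 ≤ k → ∣ ↥ ε ∣ ≤ k → ∀ k₀ → k₀ ≤ k →
  ¬ (∃[ A ] Decides ConnectedCover by A within
       λ I t → k₀ ≤ CoverInstance.k I →
         t ≤ f (CoverInstance.k I) · CoverInstance.size I ^[ CoverInstance.k I − ε ])
no-algorithm seth f ε 1≤p k 16≤k p≤k k₀ k₀≤k (A , decides) =
  let q , hard = seth (unitFraction (pred e)) (0<unitFraction (pred e)) in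
  hard (decider A k , C q , 0 , λ φ → decide φ)
  where
  p = ∣ ↥ ε ∣
  d = ↧ₙ ε
  e = k * d
  instance
    k≢0 : NonZero k
    k≢0 = >-nonZero (≤-trans (s≤s z≤n) 16≤k)
    e≢0 : NonZero e
    e≢0 = m*n≢0 k d
  G C : ℕ → ℕ
  G q = f k ^ d * (k + clauseFactor q k + 1) ^ (e ∸ p) * 2 ^ (k * d)
  C q = (overhead + 3) * (sizeFactor q k ^ 8 * 2 ^ k) + G q
  2≤k : 2 ≤ k
  2≤k = ≤-trans (s≤s (s≤s z≤n)) 16≤k
  module _ {q} (φ : CNF q) where
    open CNF φ
    S = suc (n / k)
    n<Sk : n < S * k
    n<Sk = n<1+n/k*k n k
    Sk≤ : S * k ≤ n + k
    Sk≤ = ≤-trans (+-monoʳ-≤ k (m/n*n≤m n k)) (≤-reflexive (+-comm k n))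
    open FromFormula φ k S 2≤k n<Sk
    Answer : Set
    Answer = ∃[ u ] (0 ≤ n → u ≤ C q ·[2− unitFraction (pred e) ]^ n) ×
      ((Satisfiable φ × Outputs (decider A k) (encodeCNF φ) 1 u) ⊎ (¬ Satisfiable φ × Outputs (decider A k) (encodeCNF φ) 0 u))
    within : ∀ {t u} → t ≤ f k · CoverInstance.size coverInstance ^[ k − ε ] → u ≤ overhead * Z ^ 8 + t + 3 →
             u ≤ C q ·[2− unitFraction (pred e) ]^ n
    within {t} {u} t≤ u≤ = subst (λ e → u * e ^ n ≤ C q * (2 * e ∸ 1) ^ n) (sym (suc-pred e))
      (total-≤ (overhead) {sizeFactor q k} {k} {n} {S} {e} {G q} {t} 16≤k (≤-trans 2≤k (m≤m*n k d)) Sk≤ (>-nonZero⁻¹ Z) u≤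
        (solving-≤ {k} {n} {S} {CoverInstance.size coverInstance} {k + clauseFactor q k + 1} {p} {t} {f k} d (<⇒≤ n<Sk) Sk≤ 1≤p (≤-trans p≤k (m≤m*n k d)) (≤-trans (s≤s z≤n) (m≤n+m _ (length sets))) size≤ t≤))
    decide : Answer
    decide = answer (decides coverInstance)
      where
      answer : _ → Answer
      answer (t , t≤ , inj₁ (cover , out)) =
        let u , u≤ , out′ = decide-by refl A (s≤s z≤n) out in
        u , (λ _ → within (t≤ k₀≤k) u≤) , inj₁ (cover⇒satisfiable cover , out′)
      answer (t , t≤ , inj₂ (no-cover , out)) =
        let u , u≤ , out′ = decide-by refl A z≤n out in
        u , (λ _ → within (t≤ k₀≤k) u≤) , inj₂ ((λ sat → no-cover (satisfiable⇒cover sat)) , out′)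

theorem1p8 : SETH →
    ∀ (f : ℕ → ℕ) → Computable f →
    ∀ (ε : ℚ) → 0ℚ ℚ.< ε →
    ∀ (k₀ : ℕ) →
    ¬ (∃[ A ] Decides ConnectedCover by A within
    λ I t → k₀ ≤ CoverInstance.k I →
    t ≤ f (CoverInstance.k I) · CoverInstance.size I ^[ CoverInstance.k I − ε ])
theorem1p8 seth f _ ε 0<ε k₀ =
  -- The parameter is at least 16 for the cost of the reduction, at least the numerator of ε so that
  -- k - ε is not negative, and at least k₀ so that the time bound applies.
  no-algorithm seth f ε (0<numerator 0<ε) (16 + (∣ ↥ ε ∣ + k₀)) (m≤m+n 16 _)
    (≤-trans (m≤m+n ∣ ↥ ε ∣ k₀) (m≤n+m _ 16)) k₀ (≤-trans (m≤n+m k₀ ∣ ↥ ε ∣) (m≤n+m _ 16))
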